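{- For every natural number $k \geq 2$ there exist a natural number $\ell$ and a constant $c_k > 0$ (depending only on $k$) such that $\mathrm{ex}(n, \theta_{k,\ell}) \geq c_k\, n^{1+1/k}$ for all sufficiently large $n$. That is, $\mathrm{ex}(n, \theta_{k, \ell}) = \Omega_k(n^{1 + 1/k})$.
   Context: For a graph $H$, $\mathrm{ex}(n,H)$ denotes the maximum number of edges in a graph on $n$ vertices that contains no (not necessarily induced) subgraph isomorphic to $H$. For natural numbers $k$ and $\ell$, $\theta_{k,\ell}$ denotes the graph consisting of $\ell$ internally vertex-disjoint paths, each of length $k$ (i.e. with $k$ edges), all having the same two endpoints. The notation $\Omega_k$ means the implied constant depends only on $k$. -}

module Defs where

open import Data.Nat using (ℕ; zero; suc; _+_; _*_; _∸_; _^_; _≤_; _<_; _<ᵇ_)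
open import Data.Bool using (Bool; true; false; if_then_else_; _∧_)
open import Data.Fin using (Fin; zero; suc; toℕ)
open import Data.List using (List; map; allFin)
open import Data.Nat.ListAction using (sum)
open import Data.Product using (Σ; ∃; ∃-syntax; _×_; _,_)
open import Data.Sum using (_⊎_; inj₁; inj₂)
open import Relation.Binary.PropositionalEquality using (_≡_)
open import Relation.Nullary using (¬_)
open import Function.Definitions using (Injective)

record Graph (n : ℕ) : Set where
  field
    adj    : Fin n → Fin n → Bool
    sym    : ∀ i j → adj i j ≡ adj j i
    irrefl : ∀ i → adj i i ≡ false
open Graph public

edges : ∀ {n} → Graph n → ℕ
edges {n} G =
  sum (map (λ i → sum (map (λ j → if (toℕ i <ᵇ toℕ j) ∧ adj G i j then 1 else 0)
                           (allFin n)))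
           (allFin n))

record Pattern : Set₁ where
  field
    V : Set
    E : V → V → Set
open Pattern public

Contains : ∀ {n} → Graph n → Pattern → Set
Contains {n} G H =
  Σ (V H → Fin n) λ f → Injective _≡_ _≡_ f × (∀ x y → E H x y → adj G (f x) (f y) ≡ true)

-- Theta graph θ_{k,ℓ} (for k ≥ 2): endpoints inj₁ 0, inj₁ 1, and internal
-- vertices inj₂ (j , i) for path j < ℓ and position i < k - 1.
-- Path j is  end0 - (j,0) - (j,1) - ... - (j,k-2) - end1, which has k edges.
ThetaV : ℕ → ℕ → Set
ThetaV k ℓ = Fin 2 ⊎ (Fin ℓ × Fin (k ∸ 1))

data ThetaStep (k ℓ : ℕ) : ThetaV k ℓ → ThetaV k ℓ → Set where
  start : ∀ j i → toℕ i ≡ 0 → ThetaStep k ℓ (inj₁ zero) (inj₂ (j , i))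
  mid   : ∀ j i i' → toℕ i' ≡ suc (toℕ i) → ThetaStep k ℓ (inj₂ (j , i)) (inj₂ (j , i'))
  end   : ∀ j i → suc (toℕ i) ≡ k ∸ 1 → ThetaStep k ℓ (inj₂ (j , i)) (inj₁ (suc zero))

Theta : ℕ → ℕ → Pattern
Theta k ℓ = record { V = ThetaV k ℓ ; E = λ x y → ThetaStep k ℓ x y ⊎ ThetaStep k ℓ y x }

-- "ex(n, H) ≥ (p/q) · n^{1+1/k}" : some H-free graph on n vertices has
-- e edges with e ≥ (p/q) n^{(k+1)/k}, i.e. (q e)^k ≥ p^k n^{k+1}.
ExAtLeast : (n : ℕ) → Pattern → (k p q : ℕ) → Set
ExAtLeast n H k p q =
  ∃[ G ] (¬ Contains {n} G H) × (p ^ k * n ^ (k + 1) ≤ (q * edges G) ^ k)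

{-# OPTIONS --safe #-}

-- Over K = Z/p consider the bipartite graph on K^k + K^k in which P is joined to (b , y) iff y = g(P , b), where g is
-- a polynomial map of bounded degree; it has 2 p^k vertices and p^(k+1) edges. For suitable g it contains no theta
-- graph with many paths, by an elementary version of Bukh's and Conlon's random algebraic argument.
--
-- Take g(e) as a sum over several linear forms λ of univariate polynomials in λ(e). Among the ℓ internally disjoint
-- paths from x to y all edges are distinct, so one form λ separates them. With the other summands fixed, the M
-- coefficients c of the summand of λ are, by interpolation, rational functions of the M coordinates of the internal
-- vertices of any s of the paths. Let u₁, …, u_s be the values of λ at the first edges of these s paths. Any M + 1
-- rational functions of M parameters satisfy a polynomial relation of bounded degree; apply this to the u's together
-- with any M − s + 1 of the coordinates of c. If ℓ is large, the u's run through a large grid while c stays fixed,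
-- so all coefficients of the relation with respect to the u's vanish, and every M − s + 1 coordinates of c satisfy a
-- nontrivial equation. Only O(p^(M−s)) vectors c do so. For s = 2k + 1 this beats the O(p^(2k)) choices of (x , y , λ),
-- so some g works for all of them. Chebyshev's method provides primes p of every order of magnitude.

module Submission where

-- The design rests on a balance: s paths of length k have s(k-1) internal vertices with k
-- coordinates each, and sk edges that impose k-1 equations each. Parameters and coefficients
-- therefore both number M = sk(k-1), and the u's are the surplus that produces relations.
-- Interpolation needs distinct nodes, but a single form takes only p values on p^(k+1) points;
-- hence several forms. Their number depends only on k and ℓ, because they lie on a moment curve,
-- where two points collide under at most k + 1 of them. The grid arises by dividing the ℓ = sΔ
-- paths into s blocks of Δ: one path is picked from each block independently, and Δ exceeds the
-- degree of the relation in each u. The set of bad c is not treated as a variety; equations for all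
-- its projections give the point count by induction on coordinates. All degrees, and so Δ, ℓ and Λ,
-- are fixed before p; a large p then supplies enough elements of K for nodes and grids. Isolated
-- vertices, and primes at bounded ratios, lead from 2p^k to every n.

open import Defs hiding (sym; V; E)

-- Primes in intervals of bounded ratio, by Chebyshev's method.

module PrimesInIntervals where
  open import Data.Nat
  open import Data.Nat.Properties
  open import Data.Nat.Divisibility
  open import Data.Nat.Primality
  open import Data.Nat.Primality.Factorisation using (factorise)
  open import Data.Nat.Tactic.RingSolver using (solve-∀)
  open import Data.List using ([]; _∷_)
  open import Data.List.Relation.Unary.All using ([]; _∷_)
  open import Data.Product using (_×_; _,_; ∃-syntax)
  open import Data.Sum using (_⊎_; inj₁; inj₂)
  open import Data.Empty using (⊥-elim)
  open import Relation.Nullary using (¬_; yes; no)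
  open import Relation.Binary.PropositionalEquality

  -- binom a b is the binomial coefficient (a + b) choose a
  binom : ℕ → ℕ → ℕ
  binom zero    b       = 1
  binom (suc a) zero    = 1
  binom (suc a) (suc b) = binom a (suc b) + binom (suc a) b

  binom-zeroʳ : ∀ a → binom a 0 ≡ 1
  binom-zeroʳ zero    = refl
  binom-zeroʳ (suc a) = refl

  binom-! : ∀ a b → binom a b * (a ! * b !) ≡ (a + b) !
  binom-! zero    b = trans (+-identityʳ _) (+-identityʳ _)
  binom-! (suc a) zero = trans (+-identityʳ _) (trans (*-identityʳ _) (cong (λ x → suc x !) (sym (+-identityʳ a))))
  binom-! (suc a) (suc b) = begin
    (binom a (suc b) + binom (suc a) b) * (suc a ! * suc b !)
      ≡⟨ rearrange a b (binom a (suc b)) (binom (suc a) b) (a !) (b !) ⟩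
    suc a * (binom a (suc b) * (a ! * suc b !)) + suc b * (binom (suc a) b * (suc a ! * b !))
      ≡⟨ cong₂ (λ x y → suc a * x + suc b * y) (binom-! a (suc b)) (binom-! (suc a) b) ⟩
    suc a * (a + suc b) ! + suc b * (suc a + b) !
      ≡⟨ cong (λ x → suc a * x ! + suc b * (suc a + b) !) (+-suc a b) ⟩
    suc a * (suc a + b) ! + suc b * (suc a + b) !
      ≡⟨ *-distribʳ-+ ((suc a + b) !) (suc a) (suc b) ⟨
    (suc a + suc b) * (suc a + b) !
      ≡⟨ cong (λ x → (suc a + suc b) * x !) (sym (+-suc a b)) ⟩
    (suc a + suc b) ! ∎
    where
    open ≡-Reasoning
    rearrange : ∀ a b x y f g → (x + y) * ((f + a * f) * (g + b * g)) ≡ (1 + a) * (x * (f * (g + b * g))) + (1 + b) * (y * ((f + a * f) * g))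
    rearrange = solve-∀

  binom-≤2^ : ∀ a b → binom a b ≤ 2 ^ (a + b)
  binom-≤2^ zero    b = m^n>0 2 b
  binom-≤2^ (suc a) zero = m^n>0 2 (suc a + 0)
  binom-≤2^ (suc a) (suc b) = begin
    binom a (suc b) + binom (suc a) b ≤⟨ +-mono-≤ (binom-≤2^ a (suc b)) (binom-≤2^ (suc a) b) ⟩
    2 ^ (a + suc b) + 2 ^ (suc a + b) ≡⟨ cong (λ x → 2 ^ (a + suc b) + 2 ^ x) (+-suc a b) ⟨
    2 ^ (a + suc b) + 2 ^ (a + suc b) ≡⟨ cong (2 ^ (a + suc b) +_) (+-identityʳ _) ⟨
    2 ^ (suc a + suc b) ∎
    where open ≤-Reasoning

  -- Each of the two summands in Pascal's rule is at least the previous central coefficient.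
  2^≤binom : ∀ n → 2 ^ n ≤ binom n n
  2^≤binom zero = ≤-refl
  2^≤binom (suc n) = +-mono-≤ (≤-trans (2^≤binom n) (stepʳ n n))
                              (≤-trans (≤-reflexive (+-identityʳ _)) (≤-trans (2^≤binom n) (stepˡ n n)))
    where
    stepʳ : ∀ a b → binom a b ≤ binom a (suc b)
    stepʳ zero    b = ≤-refl
    stepʳ (suc a) b = m≤n+m _ _
    stepˡ : ∀ a b → binom a b ≤ binom (suc a) b
    stepˡ a zero    = ≤-reflexive (binom-zeroʳ a)
    stepˡ a (suc b) = m≤m+n _ _

  binom-absorbʳ : ∀ a b → suc b * binom a (suc b) ≡ suc (a + b) * binom a b
  binom-absorbʳ a b = *-cancelʳ-≡ _ _ (a ! * b !) {{a !* b !≢0}} (begin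
    suc b * binom a (suc b) * (a ! * b !) ≡⟨ r₁ b (binom a (suc b)) (a !) (b !) ⟩
    binom a (suc b) * (a ! * suc b !)     ≡⟨ binom-! a (suc b) ⟩
    (a + suc b) !                         ≡⟨ cong _! (+-suc a b) ⟩
    suc (a + b) * (a + b) !               ≡⟨ cong (suc (a + b) *_) (binom-! a b) ⟨
    suc (a + b) * (binom a b * (a ! * b !)) ≡⟨ *-assoc (suc (a + b)) (binom a b) _ ⟨
    suc (a + b) * binom a b * (a ! * b !) ∎)
    where
    open ≡-Reasoning
    r₁ : ∀ b x f g → (1 + b) * x * (f * g) ≡ x * (f * (g + b * g))
    r₁ = solve-∀

  binom-absorbˡ : ∀ a b → suc a * binom (suc a) b ≡ suc b * binom a (suc b)
  binom-absorbˡ a b = *-cancelʳ-≡ _ _ (a ! * b !) {{a !* b !≢0}} (begin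
    suc a * binom (suc a) b * (a ! * b !) ≡⟨ r₁ a (binom (suc a) b) (a !) (b !) ⟩
    binom (suc a) b * (suc a ! * b !)     ≡⟨ binom-! (suc a) b ⟩
    (suc a + b) !                         ≡⟨ cong _! (+-suc a b) ⟨
    (a + suc b) !                         ≡⟨ binom-! a (suc b) ⟨
    binom a (suc b) * (a ! * suc b !)     ≡⟨ r₂ b (binom a (suc b)) (a !) (b !) ⟨
    suc b * binom a (suc b) * (a ! * b !) ∎)
    where
    open ≡-Reasoning
    r₁ : ∀ a x f g → (1 + a) * x * (f * g) ≡ x * ((f + a * f) * g)
    r₁ = solve-∀
    r₂ : ∀ b x f g → (1 + b) * x * (f * g) ≡ x * (f * (g + b * g))
    r₂ = solve-∀

  -- Leibniz's harmonic triangle: 1/((a+1) C(n,a+1)) is the difference of 1/(a C(n-1,a)) and 1/(a C(n,a)).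
  leibniz-∣ : ∀ {X L} → (∀ j → 1 ≤ j → j ≤ X → j ∣ L) → ∀ a b → suc a + b ≤ X → suc a * binom (suc a) b ∣ L
  leibniz-∣ {L = L} mult zero b le = subst (_∣ L) (sym (eq b)) (mult (suc b) (s≤s z≤n) le)
    where
    one : ∀ b → binom 1 b ≡ suc b
    one zero    = refl
    one (suc b) = cong suc (one b)
    eq : ∀ b → 1 * binom 1 b ≡ suc b
    eq b = trans (+-identityʳ _) (one b)
  leibniz-∣ {X} {L} mult (suc a) b le
    with leibniz-∣ mult a b (≤-trans (n≤1+n _) le) | leibniz-∣ mult a (suc b) (subst (_≤ X) (cong suc (sym (+-suc a b))) le)
  ... | divides x Lx | divides y Ly = divides (x ∸ y) (*-cancelˡ-≡ _ _ m (begin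
    m * L                           ≡⟨ m+n∸n≡m (m * L) (suc b * L) ⟨
    m * L + suc b * L ∸ suc b * L   ≡⟨ cong (_∸ suc b * L) (sym (*-distribʳ-+ L m (suc b))) ⟩
    (m + suc b) * L ∸ suc b * L     ≡⟨ cong (λ u → u * L ∸ suc b * L) (+-suc m b) ⟩
    suc (m + b) * L ∸ suc b * L     ≡⟨ cong₂ (λ u v → suc (m + b) * u ∸ suc b * v) Lx Ly ⟩
    suc (m + b) * (x * (m * binom m b)) ∸ suc b * (y * (m * binom m (suc b)))
      ≡⟨ cong₂ _∸_ (rearrange (suc (m + b)) x m (binom m b)) (rearrange (suc b) y m (binom m (suc b))) ⟩
    m * x * (suc (m + b) * binom m b) ∸ m * y * (suc b * binom m (suc b))
      ≡⟨ cong (λ u → m * x * u ∸ m * y * (suc b * binom m (suc b))) (binom-absorbʳ m b) ⟨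
    m * x * (suc b * binom m (suc b)) ∸ m * y * (suc b * binom m (suc b))
      ≡⟨ cong (λ u → m * x * u ∸ m * y * u) (binom-absorbˡ m b) ⟨
    m * x * Z ∸ m * y * Z           ≡⟨ *-distribʳ-∸ Z (m * x) (m * y) ⟨
    (m * x ∸ m * y) * Z             ≡⟨ cong (_* Z) (*-distribˡ-∸ m x y) ⟨
    m * (x ∸ y) * Z                 ≡⟨ *-assoc m (x ∸ y) Z ⟩
    m * ((x ∸ y) * Z)               ∎))
    where
    open ≡-Reasoning
    m = suc a
    Z = suc m * binom (suc m) b
    rearrange : ∀ c x m B → c * (x * (m * B)) ≡ m * x * (c * B)
    rearrange = solve-∀

  primePart : ℕ → ℕ
  primePart n with prime? n
  ... | yes _ = n
  ... | no  _ = 1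

  primorial : ℕ → ℕ
  primorial zero    = 1
  primorial (suc n) = primePart (suc n) * primorial n

  primePart-prime : ∀ {p} → Prime p → primePart p ≡ p
  primePart-prime {p} pp with prime? p
  ... | yes _  = refl
  ... | no ¬pp = ⊥-elim (¬pp pp)

  ∣primorial : ∀ {p n} → Prime p → p ≤ n → p ∣ primorial n
  ∣primorial {p} {zero}  pp z≤n = ⊥-elim (¬prime[0] pp)
  ∣primorial {p} {suc n} pp le with p ≟ suc n
  ... | yes refl = subst (λ x → p ∣ x * primorial n) (sym (primePart-prime pp)) (m∣m*n _)
  ... | no p≢    = ∣n⇒∣m*n (primePart (suc n)) (∣primorial pp (≤-pred (≤∧≢⇒< le p≢)))

  primorialFrom : ℕ → ℕ → ℕ
  primorialFrom n zero    = 1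
  primorialFrom n (suc j) = primePart (suc (n + j)) * primorialFrom n j

  primorial-+ : ∀ n j → primorial (n + j) ≡ primorialFrom n j * primorial n
  primorial-+ n zero    = trans (cong primorial (+-identityʳ n)) (sym (+-identityʳ _))
  primorial-+ n (suc j) = begin
    primorial (n + suc j)                       ≡⟨ cong primorial (+-suc n j) ⟩
    primePart (suc (n + j)) * primorial (n + j) ≡⟨ cong (primePart (suc (n + j)) *_) (primorial-+ n j) ⟩
    primePart (suc (n + j)) * (primorialFrom n j * primorial n) ≡⟨ *-assoc (primePart (suc (n + j))) _ _ ⟨
    primorialFrom n (suc j) * primorial n       ∎
    where open ≡-Reasoning

  ∣primorialFrom⇒≤ : ∀ {p} n j → Prime p → p ∣ primorialFrom n j → p ≤ n + j
  ∣primorialFrom⇒≤ n zero    pp p∣1 = ⊥-elim (¬prime[1] (subst Prime (∣1⇒≡1 p∣1) pp))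
  ∣primorialFrom⇒≤ {p} n (suc j) pp p∣ with euclidsLemma (primePart (suc (n + j))) _ pp p∣
  ... | inj₂ p∣′ = ≤-trans (∣primorialFrom⇒≤ n j pp p∣′) (+-monoʳ-≤ n (n≤1+n j))
  ... | inj₁ p∣′ with prime? (suc (n + j))
  ...   | yes _ = ≤-trans (∣⇒≤ p∣′) (≤-reflexive (sym (+-suc n j)))
  ...   | no  _ = ⊥-elim (¬prime[1] (subst Prime (∣1⇒≡1 p∣′) pp))

  prime∣!⇒≤ : ∀ {p} n → Prime p → p ∣ n ! → p ≤ n
  prime∣!⇒≤ zero    pp p∣ = ⊥-elim (¬prime[1] (subst Prime (∣1⇒≡1 p∣) pp))
  prime∣!⇒≤ (suc n) pp p∣ with euclidsLemma (suc n) (n !) pp p∣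
  ... | inj₁ p∣′ = ∣⇒≤ p∣′
  ... | inj₂ p∣′ = ≤-trans (prime∣!⇒≤ n pp p∣′) (n≤1+n n)

  ∣! : ∀ {j} n → 1 ≤ j → j ≤ n → j ∣ n !
  ∣! {suc j} n _ le = ∣-trans (m∣m*n (j !)) (m≤n⇒m!∣n! le)

  prime∣binom : ∀ {p} n → Prime p → n < p → p ≤ n + n → p ∣ binom n n
  prime∣binom {p} n pp lt le
    with euclidsLemma (binom n n) (n ! * n !) pp
           (subst (p ∣_) (sym (binom-! n n)) (∣! (n + n) (≤-trans (s≤s z≤n) lt) le))
  ... | inj₁ d = d
  ... | inj₂ d with euclidsLemma (n !) (n !) pp d
  ...   | inj₁ e = ⊥-elim (<⇒≱ lt (prime∣!⇒≤ n pp e))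
  ...   | inj₂ e = ⊥-elim (<⇒≱ lt (prime∣!⇒≤ n pp e))

  -- Each prime in (n, 2n] divides the central coefficient. A newly added prime exceeds all prime
  -- factors of the product so far, so Euclid's lemma places it in the cofactor `w`.
  primorialFrom∣binom : ∀ n j → j ≤ n → primorialFrom n j ∣ binom n n
  primorialFrom∣binom n zero    le = 1∣ _
  primorialFrom∣binom n (suc j) le with prime? (suc (n + j)) | primorialFrom∣binom n j (≤-trans (n≤1+n j) le)
  ... | no _   | d = subst (_∣ binom n n) (sym (+-identityʳ _)) d
  ... | yes pp | divides w eq
    with euclidsLemma w _ pp (subst (suc (n + j) ∣_) eq (prime∣binom n pp (s≤s (m≤m+n n j))
           (subst (_≤ n + n) (+-suc n j) (+-monoʳ-≤ n le))))
  ...   | inj₂ d = ⊥-elim (<-irrefl refl (∣primorialFrom⇒≤ n j pp d))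
  ...   | inj₁ d = subst (suc (n + j) * primorialFrom n j ∣_) (sym eq) (*-monoˡ-∣ (primorialFrom n j) d)

  primorial-double : ∀ n → primorial (n + n) ≤ 2 ^ (n + n) * primorial n
  primorial-double n = begin
    primorial (n + n)                 ≡⟨ primorial-+ n n ⟩
    primorialFrom n n * primorial n   ≤⟨ *-monoˡ-≤ (primorial n) (∣⇒≤ {{>-nonZero (≤-trans (m^n>0 2 n) (2^≤binom n))}} (primorialFrom∣binom n n ≤-refl)) ⟩
    binom n n * primorial n           ≤⟨ *-monoˡ-≤ (primorial n) (binom-≤2^ n n) ⟩
    2 ^ (n + n) * primorial n         ∎
    where open ≤-Reasoning

  -- Erdős's bound 4^x for the primorial, at powers of two: passing from 2^r to 2^(r+1) costs
  -- 2^(r+1) in the exponent, and this geometric series stays below twice its last term.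
  primorial-2^ : ∀ r → primorial (2 ^ r) ≤ 2 ^ (2 * 2 ^ r)
  primorial-2^ zero    = s≤s z≤n
  primorial-2^ (suc r) = begin
    primorial (2 ^ r + (2 ^ r + 0))   ≡⟨ cong primorial dbl ⟩
    primorial (2 ^ r + 2 ^ r)         ≤⟨ primorial-double (2 ^ r) ⟩
    2 ^ (2 ^ r + 2 ^ r) * primorial (2 ^ r) ≤⟨ *-monoʳ-≤ (2 ^ (2 ^ r + 2 ^ r)) (primorial-2^ r) ⟩
    2 ^ (2 ^ r + 2 ^ r) * 2 ^ (2 * 2 ^ r)   ≡⟨ ^-distribˡ-+-* 2 (2 ^ r + 2 ^ r) (2 * 2 ^ r) ⟨
    2 ^ (2 ^ r + 2 ^ r + 2 * 2 ^ r)   ≡⟨ cong (2 ^_) (fin (2 ^ r)) ⟩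
    2 ^ (2 * 2 ^ suc r)               ∎
    where
    open ≤-Reasoning
    dbl : 2 ^ r + (2 ^ r + 0) ≡ 2 ^ r + 2 ^ r
    dbl = cong (2 ^ r +_) (+-identityʳ _)
    fin : ∀ x → x + x + 2 * x ≡ 2 * (2 * x)
    fin = solve-∀

  -- An interval without primes leaves the primorial unchanged. The alternative is recorded in this
  -- form because it caps the large primes in the common multiple of `chebyshev`.
  primeBetween : ∀ y j → (∃[ p ] Prime p × y < p × p ≤ y + j) ⊎ primorial (y + j) ≡ primorial y
  primeBetween y zero = inj₂ (cong primorial (+-identityʳ y))
  primeBetween y (suc j) with primeBetween y j
  ... | inj₁ (p , pp , lt , le) = inj₁ (p , pp , lt , ≤-trans le (+-monoʳ-≤ y (n≤1+n j)))
  ... | inj₂ eq with prime? (suc (y + j)) in peq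
  ...   | yes pp = inj₁ (suc (y + j) , pp , s≤s (m≤m+n y j) , ≤-reflexive (sym (+-suc y j)))
  ...   | no  _  = inj₂ (trans (cong primorial (+-suc y j)) (trans (cong (_* primorial (y + j)) lem) (trans (+-identityʳ _) eq)))
    where
    lem : primePart (suc (y + j)) ≡ 1
    lem rewrite peq = refl

  -- A number j ≤ S² either has all its (at most E) prime factors ≤ S, or it is p · a with p > S and a ≤ S.
  ∣commonMultiple : ∀ S E j → 1 ≤ j → j < 2 ^ E → j ≤ S * S → j ∣ (S !) ^ E * primorial (S * S)
  ∣commonMultiple S zero    j 1≤j (s≤s j≤0) le = ⊥-elim (<⇒≱ 1≤j j≤0)
  ∣commonMultiple S (suc E) j 1≤j j<2^ le with factorise j {{>-nonZero 1≤j}}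
  ... | record { factors = [] ; isFactorisation = eq } = subst (_∣ _) (sym eq) (1∣ _)
  ... | record { factors = p ∷ ps ; isFactorisation = eq ; factorsPrime = pp ∷ _ } = split (p ≤? S)
    where
    open import Data.Nat.ListAction using (product)
    open ≤-Reasoning
    a = product ps
    p>1 : 1 < p
    p>1 = nonTrivial⇒n>1 p {{prime⇒nonTrivial pp}}
    1≤a : 1 ≤ a
    1≤a = n≢0⇒n>0 λ a≡0 → <⇒≱ 1≤j (≤-reflexive (trans eq (trans (cong (p *_) a≡0) (*-zeroʳ p))))
    p≤j : p ≤ j
    p≤j = ≤-trans (≤-trans (≤-reflexive (sym (*-identityʳ p))) (*-monoʳ-≤ p 1≤a)) (≤-reflexive (sym eq))
    a≤j : a ≤ j
    a≤j = ≤-trans (≤-trans (≤-reflexive (sym (*-identityˡ a))) (*-monoˡ-≤ a (<⇒≤ p>1))) (≤-reflexive (sym eq))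
    2a≤j : 2 * a ≤ j
    2a≤j = ≤-trans (*-monoˡ-≤ a p>1) (≤-reflexive (sym eq))
    split : _ → j ∣ (S !) ^ suc E * primorial (S * S)
    split (yes p≤S) = subst₂ _∣_ (sym eq) (sym (*-assoc (S !) ((S !) ^ E) _))
      (*-pres-∣ (∣! S (<⇒≤ p>1) p≤S)
        (∣commonMultiple S E a 1≤a (*-cancelˡ-< 2 a (2 ^ E) (≤-<-trans 2a≤j j<2^)) (≤-trans a≤j le)))
    split (no p≰S) = subst₂ _∣_ (trans (*-comm a p) (sym eq)) refl
      (*-pres-∣ (∣-trans (∣! S 1≤a a≤S) (m∣m*n ((S !) ^ E))) (∣primorial pp (≤-trans p≤j le)))
      where
      a≤S : a ≤ S
      a≤S = ≮⇒≥ λ S<a → <⇒≱ (*-mono-< (≰⇒> p≰S) S<a) (≤-trans (≤-reflexive (sym eq)) le)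

  !≤^ : ∀ n → n ! ≤ n ^ n
  !≤^ zero    = ≤-refl
  !≤^ (suc n) = *-monoʳ-≤ (suc n) (≤-trans (!≤^ n) (^-monoˡ-≤ n (n≤1+n n)))

  -- This is the hypothesis a * (5 + y) < 2 ^ e of `chebyshev` at y = 16 + 2b, a = 10 + b, e = 8 +
  -- b. At b = 0 it reads 210 < 256; one step earlier it would be 171 < 128, which explains the
  -- offset 16.
  exponent-bound : ∀ b → (10 + b) * (21 + 2 * b) < 2 ^ (8 + b)
  exponent-bound zero    = ≤ᵇ⇒≤ 211 256 _
  exponent-bound (suc b) = begin-strict
    (10 + suc b) * (21 + 2 * suc b)       ≤⟨ m≤m+n _ (167 + 37 * b + 2 * b * b) ⟩
    (10 + suc b) * (21 + 2 * suc b) + (167 + 37 * b + 2 * b * b) ≡⟨ eq b ⟩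
    2 * ((10 + b) * (21 + 2 * b))         <⟨ *-monoʳ-< 2 (exponent-bound b) ⟩
    2 ^ (8 + suc b) ∎
    where
    open ≤-Reasoning
    eq : ∀ b → (10 + (1 + b)) * (21 + 2 * (1 + b)) + (167 + 37 * b + 2 * b * b) ≡ 2 * ((10 + b) * (21 + 2 * b))
    eq = solve-∀

  -- Chebyshev's argument: without a prime in the interval, 2^n ≤ binom n n would exceed the common multiple above.
  chebyshev : ∀ a e y → a + a ≡ 4 + y → a * (5 + y) < 2 ^ e → e + a ≡ 2 + y →
              ∃[ p ] Prime p × 2 ^ y < p × p ≤ 16 * 2 ^ y
  chebyshev a e y a+a≡4+y aE<2^e e+a≡2+y = main (2 ^ a) (2 ^ y) refl (m^n>0 2 y) SS (2^E) aES (primorial-2^ y)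
    where
    open ≤-Reasoning
    E = 5 + y
    SS : 2 ^ a * 2 ^ a ≡ 16 * 2 ^ y
    SS = trans (sym (^-distribˡ-+-* 2 a a)) (trans (cong (2 ^_) a+a≡4+y) (^-distribˡ-+-* 2 4 y))
    2^E : 16 * 2 ^ y < 2 ^ E
    2^E = subst (_< 2 ^ E) (^-distribˡ-+-* 2 4 y) (^-monoʳ-< 2 (s≤s (s≤s z≤n)) (n<1+n (4 + y)))
    aES : a * E * 2 ^ a < 4 * 2 ^ y
    aES = <-≤-trans (*-monoˡ-< (2 ^ a) {{m^n≢0 2 a}} aE<2^e)
      (≤-reflexive (trans (sym (^-distribˡ-+-* 2 e a)) (trans (cong (2 ^_) e+a≡2+y) (^-distribˡ-+-* 2 2 y))))
    main : ∀ S Y → S ≡ 2 ^ a → 0 < Y → S * S ≡ 16 * Y → 16 * Y < 2 ^ E → a * E * S < 4 * Y →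
           primorial Y ≤ 2 ^ (2 * Y) → ∃[ p ] Prime p × Y < p × p ≤ 16 * Y
    main S Y S≡2^a Y>0 SS 2^E aES primorialY with primeBetween Y (15 * Y)
    ... | inj₁ pr = pr
    ... | inj₂ same = ⊥-elim (<⇒≱ small big)
      where
      -- Since 2n = 16 * Y = S * S, all numbers up to 2n divide `L`, and Leibniz's triangle gives n
      -- * binom n n ∣ L. As `S` is of the order of the square root of `Y`, the small primes
      -- contribute only `a * E * S` to the exponent.
      n = 8 * Y
      L = (S !) ^ E * primorial (S * S)
      mult : ∀ j → 1 ≤ j → j ≤ 16 * Y → j ∣ L
      mult j 1≤j le = ∣commonMultiple S E j 1≤j (≤-<-trans le 2^E) (≤-trans le (≤-reflexive (sym SS)))
      n≢0 : NonZero n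
      n≢0 = m*n≢0 8 Y {{_}} {{>-nonZero Y>0}}
      L≢0 : NonZero L
      L≢0 = m*n≢0 _ _ {{m^n≢0 (S !) E {{S !≢0}}}} {{pr≢0 (S * S)}}
        where
        pp≢0 : ∀ m → NonZero (primePart (suc m))
        pp≢0 m with prime? (suc m)
        ... | yes _ = _
        ... | no  _ = _
        pr≢0 : ∀ m → NonZero (primorial m)
        pr≢0 zero    = _
        pr≢0 (suc m) = m*n≢0 _ _ {{pp≢0 m}} {{pr≢0 m}}
      binom∣ : ∀ m → .{{NonZero m}} → m + m ≤ 16 * Y → m * binom m m ∣ L
      binom∣ (suc m) le = leibniz-∣ mult m (suc m) le
      2^n≤L : 2 ^ n ≤ L
      2^n≤L = begin
        2 ^ n          ≤⟨ 2^≤binom n ⟩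
        binom n n      ≤⟨ m≤n*m (binom n n) n {{n≢0}} ⟩
        n * binom n n  ≤⟨ ∣⇒≤ {{L≢0}} (binom∣ n {{n≢0}} (≤-reflexive (r Y))) ⟩
        L              ∎
        where
        r : ∀ Y → 8 * Y + 8 * Y ≡ 16 * Y
        r = solve-∀
      primorial≤ : primorial (S * S) ≤ 2 ^ (2 * Y)
      primorial≤ = begin
        primorial (S * S)       ≡⟨ cong primorial SS ⟩
        primorial (Y + 15 * Y)  ≡⟨ same ⟩
        primorial Y             ≤⟨ primorialY ⟩
        2 ^ (2 * Y)             ∎
      !^≤ : (S !) ^ E ≤ 2 ^ (a * E * S)
      !^≤ = begin
        (S !) ^ E          ≤⟨ ^-monoˡ-≤ E (!≤^ S) ⟩
        (S ^ S) ^ E        ≡⟨ cong (λ x → (x ^ S) ^ E) S≡2^a ⟩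
        ((2 ^ a) ^ S) ^ E  ≡⟨ cong (_^ E) (^-*-assoc 2 a S) ⟩
        (2 ^ (a * S)) ^ E  ≡⟨ ^-*-assoc 2 (a * S) E ⟩
        2 ^ (a * S * E)    ≡⟨ cong (2 ^_) (r a S E) ⟩
        2 ^ (a * E * S)    ∎
        where
        r : ∀ a S E → a * S * E ≡ a * E * S
        r = solve-∀
      big : n ≤ a * E * S + 2 * Y
      big = ≮⇒≥ λ lt → <⇒≱ (^-monoʳ-< 2 (s≤s (s≤s z≤n)) lt) (begin
        2 ^ n                           ≤⟨ 2^n≤L ⟩
        L                               ≤⟨ *-mono-≤ !^≤ primorial≤ ⟩
        2 ^ (a * E * S) * 2 ^ (2 * Y)   ≡⟨ ^-distribˡ-+-* 2 (a * E * S) (2 * Y) ⟨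
        2 ^ (a * E * S + 2 * Y)         ∎)
      small : a * E * S + 2 * Y < n
      small = begin-strict
        a * E * S + 2 * Y   <⟨ +-monoˡ-< (2 * Y) aES ⟩
        4 * Y + 2 * Y       ≤⟨ ≤-trans (m≤m+n _ (2 * Y)) (≤-reflexive (r Y)) ⟩
        8 * Y               ∎
        where
        r : ∀ Y → 4 * Y + 2 * Y + 2 * Y ≡ 8 * Y
        r = solve-∀

  -- Even exponents make 16 * 2 ^ y the square of 2 ^ (10 + b), the threshold between small and
  -- large primes.
  primeAbove : ∀ b → ∃[ p ] Prime p × 2 ^ (16 + 2 * b) < p × p ≤ 16 * 2 ^ (16 + 2 * b)
  primeAbove b = chebyshev (10 + b) (8 + b) (16 + 2 * b) (r₁ b) (exponent-bound b) (r₂ b)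
    where
    r₁ : ∀ b → 10 + b + (10 + b) ≡ 20 + 2 * b
    r₁ = solve-∀
    r₂ : ∀ b → 8 + b + (10 + b) ≡ 18 + 2 * b
    r₂ = solve-∀

-- Sums over finite sets, exchange of summation and the union bound.

module Counting where
  open import Data.Nat
  open import Data.Nat.Properties
  open import Data.Nat.Tactic.RingSolver using (solve-∀)
  open import Data.Fin using (Fin; zero; suc; punchIn)
  import Data.Fin as Fin
  import Data.Fin.Properties as Fin
  open import Data.Vec using (Vec; []; _∷_; _[_]≔_)
  open import Data.Product using (_,_; ∃-syntax)
  open import Function using (_∘_)
  open import Function.Definitions using (Injective)
  open import Relation.Nullary using (yes; no)
  open import Relation.Binary.PropositionalEquality
  open import Algebra.Properties.CommutativeMonoid.Sum +-0-commutativeMonoid using (sum-remove; ∑-distrib-+) renaming (sum to ∑) public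

  ^-distribʳ-* : ∀ o m n → (m * n) ^ o ≡ m ^ o * n ^ o
  ^-distribʳ-* zero    m n = refl
  ^-distribʳ-* (suc o) m n = trans (cong (m * n *_) (^-distribʳ-* o m n)) (rearrange m n (m ^ o) (n ^ o))
    where
    rearrange : ∀ m n a b → m * n * (a * b) ≡ m * a * (n * b)
    rearrange = solve-∀

  ∑-mono : ∀ {n} {f g : Fin n → ℕ} → (∀ i → f i ≤ g i) → ∑ f ≤ ∑ g
  ∑-mono {zero}  le = z≤n
  ∑-mono {suc n} le = +-mono-≤ (le zero) (∑-mono (le ∘ suc))

  ∑-const : ∀ n c → ∑ {n} (λ _ → c) ≡ n * c
  ∑-const zero    c = refl
  ∑-const (suc n) c = cong (c +_) (∑-const n c)

  ∑-find : ∀ {n} (f : Fin n → ℕ) B → ∑ f < n * B → ∃[ i ] f i < B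
  ∑-find {zero}  f B ()
  ∑-find {suc n} f B lt with f zero <? B
  ... | yes f<B = zero , f<B
  ... | no  f≮B with ∑-find (f ∘ suc) B (+-cancelˡ-< B _ _ (≤-<-trans (+-monoˡ-≤ _ (≮⇒≥ f≮B)) lt))
  ...   | i , f<B = suc i , f<B

  ≤∑ : ∀ {n} (f : Fin n → ℕ) i → f i ≤ ∑ f
  ≤∑ {suc n} f zero    = m≤m+n _ _
  ≤∑ {suc n} f (suc i) = ≤-trans (≤∑ (f ∘ suc) i) (m≤n+m _ _)

  ∑-injection : ∀ {m n} (φ : Fin m → Fin n) → Injective _≡_ _≡_ φ → (f : Fin n → ℕ) → ∑ (f ∘ φ) ≤ ∑ f
  ∑-injection {zero}          φ inj f = z≤n
  ∑-injection {suc m} {zero}  φ inj f with φ zero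
  ... | ()
  ∑-injection {suc m} {suc n} φ inj f = begin
    f (φ zero) + ∑ (f ∘ φ ∘ suc)                      ≡⟨ cong (f (φ zero) +_) (∑-cong λ i → cong f (sym (Fin.punchIn-punchOut (avoid i)))) ⟩
    f (φ zero) + ∑ (f ∘ punchIn (φ zero) ∘ ψ)         ≤⟨ +-monoʳ-≤ _ (∑-injection ψ ψ-inj (f ∘ punchIn (φ zero))) ⟩
    f (φ zero) + ∑ (f ∘ punchIn (φ zero))             ≡⟨ sum-remove f ⟨
    ∑ f                                               ∎
    where
    open ≤-Reasoning
    ∑-cong : ∀ {n} {f g : Fin n → ℕ} → (∀ i → f i ≡ g i) → ∑ f ≡ ∑ g
    ∑-cong eq = ≤-antisym (∑-mono λ i → ≤-reflexive (eq i)) (∑-mono λ i → ≤-reflexive (sym (eq i)))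
    avoid : ∀ i → φ zero ≢ φ (suc i)
    avoid i eq with inj eq
    ... | ()
    ψ : Fin m → Fin n
    ψ i = Fin.punchOut (avoid i)
    ψ-inj : Injective _≡_ _≡_ ψ
    ψ-inj {i} {j} eq = Fin.suc-injective (inj (Fin.punchOut-injective (avoid i) (avoid j) eq))

  -- Sums are abstracted to monotone additive functionals, so that one Fubini rule exchanges sums
  -- over `Fin`, over vectors and over vectors of vectors.
  record Additive {A : Set} (T : (A → ℕ) → ℕ) : Set where
    field
      T-mono : ∀ {f g} → (∀ a → f a ≤ g a) → T f ≤ T g
      T-+    : ∀ f g → T (λ a → f a + g a) ≡ T f + T g
      T-zero : T (λ _ → 0) ≡ 0

    T-cong : ∀ {f g} → (∀ a → f a ≡ g a) → T f ≡ T g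
    T-cong eq = ≤-antisym (T-mono λ a → ≤-reflexive (eq a)) (T-mono λ a → ≤-reflexive (sym (eq a)))

    T-scale : ∀ c f → T (λ a → c * f a) ≡ c * T f
    T-scale zero    f = T-zero
    T-scale (suc c) f = trans (T-+ f _) (cong (T f +_) (T-scale c f))

    T-∑ : ∀ {n} (F : Fin n → A → ℕ) → ∑ (λ i → T (F i)) ≡ T (λ a → ∑ (λ i → F i a))
    T-∑ {zero}  F = sym T-zero
    T-∑ {suc n} F = trans (cong (T (F zero) +_) (T-∑ (F ∘ suc))) (sym (T-+ (F zero) _))

  record Summation (A : Set) : Set₁ where
    field
      S        : (A → ℕ) → ℕ
      card     : ℕ
      additive : Additive S
      S-const  : ∀ c → S (λ _ → c) ≡ card * c
      S-find   : ∀ f B → S f < card * B → ∃[ a ] f a < B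
      S-fubini : ∀ {B : Set} {T : (B → ℕ) → ℕ} → Additive T → (F : A → B → ℕ) →
                 S (λ a → T (F a)) ≡ T (λ b → S (λ a → F a b))
    open Additive additive public renaming (T-mono to S-mono; T-+ to S-+; T-zero to S-zero; T-cong to S-cong; T-scale to S-scale; T-∑ to S-∑)

  finSummation : ∀ n → Summation (Fin n)
  finSummation n = record
    { S        = ∑
    ; card     = n
    ; additive = record { T-mono = ∑-mono ; T-+ = ∑-distrib-+ ; T-zero = trans (∑-const n 0) (*-zeroʳ n) }
    ; S-const  = ∑-const n
    ; S-find   = ∑-find
    ; S-fubini = λ add F → Additive.T-∑ add F
    }

  module _ {A : Set} (SA : Summation A) where
    open Summation SA

    vecSum : ∀ n → (Vec A n → ℕ) → ℕ
    vecSum zero    f = f []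
    vecSum (suc n) f = S (λ a → vecSum n (f ∘ (a ∷_)))

    vecSum-additive : ∀ n → Additive (vecSum n)
    vecSum-additive zero    = record { T-mono = λ le → le [] ; T-+ = λ _ _ → refl ; T-zero = refl }
    vecSum-additive (suc n) = record
      { T-mono = λ le → S-mono λ a → V.T-mono λ v → le (a ∷ v)
      ; T-+    = λ f g → trans (S-cong λ a → V.T-+ _ _) (S-+ _ _)
      ; T-zero = trans (S-cong λ a → V.T-zero) S-zero
      }
      where module V = Additive (vecSum-additive n)

    vecSum-const : ∀ n c → vecSum n (λ _ → c) ≡ card ^ n * c
    vecSum-const zero    c = sym (+-identityʳ c)
    vecSum-const (suc n) c = trans (S-cong λ a → vecSum-const n c) (trans (S-const _) (sym (*-assoc card (card ^ n) c)))

    vecSum-find : ∀ n f B → vecSum n f < card ^ n * B → ∃[ v ] f v < B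
    vecSum-find zero    f B lt = [] , <-≤-trans lt (≤-reflexive (+-identityʳ B))
    vecSum-find (suc n) f B lt
      with S-find _ (card ^ n * B) (<-≤-trans lt (≤-reflexive (*-assoc card (card ^ n) B)))
    ... | a , lt′ with vecSum-find n (f ∘ (a ∷_)) B lt′
    ...   | v , lt″ = a ∷ v , lt″

    vecSum-fubini : ∀ n {B : Set} {T : (B → ℕ) → ℕ} → Additive T → (F : Vec A n → B → ℕ) →
                    vecSum n (λ v → T (F v)) ≡ T (λ b → vecSum n (λ v → F v b))
    vecSum-fubini zero    add F = refl
    vecSum-fubini (suc n) add F = trans (S-cong λ a → vecSum-fubini n add (F ∘ (a ∷_))) (S-fubini add _)

    vecSummation : ∀ n → Summation (Vec A n)
    vecSummation n = record
      { S        = vecSum n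
      ; card     = card ^ n
      ; additive = vecSum-additive n
      ; S-const  = vecSum-const n
      ; S-find   = vecSum-find n
      ; S-fubini = vecSum-fubini n
      }

    -- Fubini moves coordinate `t` innermost; the other coordinates then give card ^ (n - 1) fibres
    -- of weight at most `B`. The factor `card` on the left avoids the subtraction in the exponent,
    -- and `a₀` fills the place that the update overwrites.
    vecSum-update : ∀ n (t : Fin n) → A → (F : Vec A n → ℕ) (B : ℕ) →
                    (∀ v → S (λ a → F (v [ t ]≔ a)) ≤ B) → card * vecSum n F ≤ card ^ n * B
    vecSum-update (suc n) zero a₀ F B bound = begin
      card * S (λ a → vecSum n (λ v → F (a ∷ v)))   ≡⟨ cong (card *_) (S-fubini (vecSum-additive n) _) ⟩
      card * vecSum n (λ v → S (λ a → F (a ∷ v)))   ≤⟨ *-monoʳ-≤ card (Additive.T-mono (vecSum-additive n) λ v → bound (a₀ ∷ v)) ⟩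
      card * vecSum n (λ _ → B)                     ≡⟨ cong (card *_) (vecSum-const n B) ⟩
      card * (card ^ n * B)                         ≡⟨ *-assoc card (card ^ n) B ⟨
      card ^ suc n * B                              ∎
      where open ≤-Reasoning
    vecSum-update (suc n) (suc t) a₀ F B bound = begin
      card * S (λ a → vecSum n (λ v → F (a ∷ v)))   ≡⟨ S-scale card _ ⟨
      S (λ a → card * vecSum n (λ v → F (a ∷ v)))   ≤⟨ S-mono (λ a → vecSum-update n t a₀ (F ∘ (a ∷_)) B (λ v → bound (a ∷ v))) ⟩
      S (λ _ → card ^ n * B)                        ≡⟨ S-const _ ⟩
      card * (card ^ n * B)                         ≡⟨ *-assoc card (card ^ n) B ⟨
      card ^ suc n * B                              ∎
      where open ≤-Reasoning

    -- Event `i` is controlled through the single coordinate `t i`: whatever the other coordinates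
    -- are, it has probability at most B / card. With I * B < card the expected number of events is
    -- below 1, so some vector avoids all of them.
    unionBound : ∀ n I (F : Fin I → Vec A n → ℕ) (t : Fin I → Fin n) B → A → 0 < card →
                 (∀ i v → S (λ a → F i (v [ t i ]≔ a)) ≤ B) → I * B < card → ∃[ v ] (∀ i → F i v ≡ 0)
    unionBound n I F t B a₀ card>0 bound sparse with vecSum-find n (λ v → ∑ (λ i → F i v)) 1 total
      where
      open ≤-Reasoning
      module V = Additive (vecSum-additive n)
      rearrange : ∀ i p b → i * (p * b) ≡ p * (i * b)
      rearrange = solve-∀
      total : vecSum n (λ v → ∑ (λ i → F i v)) < card ^ n * 1
      total = *-cancelˡ-< card _ _ (begin-strict
        card * vecSum n (λ v → ∑ (λ i → F i v))   ≡⟨ cong (card *_) (V.T-∑ F) ⟨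
        card * ∑ (λ i → vecSum n (F i))           ≡⟨ Summation.S-scale (finSummation I) card (λ i → vecSum n (F i)) ⟨
        ∑ (λ i → card * vecSum n (F i))           ≤⟨ ∑-mono (λ i → vecSum-update n (t i) a₀ (F i) B (bound i)) ⟩
        ∑ {I} (λ _ → card ^ n * B)                ≡⟨ ∑-const I _ ⟩
        I * (card ^ n * B)                        ≡⟨ rearrange I (card ^ n) B ⟩
        card ^ n * (I * B)                        <⟨ *-monoʳ-< (card ^ n) {{m^n≢0 card n {{>-nonZero card>0}}}} sparse ⟩
        card ^ n * card                           ≡⟨ trans (*-comm (card ^ n) card) (cong (card *_) (sym (*-identityʳ (card ^ n)))) ⟩
        card * (card ^ n * 1)                     ∎)
    ... | v , s≤s none = v , λ i → n≤0⇒n≡0 (≤-trans (≤∑ (λ i → F i v) i) none)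

-- Polynomials, fractions, linear algebra and interpolation over a finite domain.

module FiniteDomains where
  open import Level using (0ℓ)
  open import Data.Nat using (ℕ; zero; suc; _≤_; _<_; z≤n; s≤s) renaming (_+_ to _+ℕ_; _*_ to _*ℕ_; _^_ to _^ℕ_)
  import Data.Nat.Properties as ℕ
  open import Data.Fin using (Fin; zero; suc; _≟_; punchIn; combine; quotient; remainder)
  import Data.Fin.Properties as Fin
  open import Data.List using (List; []; _∷_; length; map)
  import Data.List.Properties as List
  open import Data.List.Relation.Unary.All using (All; []; _∷_)
  import Data.List.Relation.Unary.All as All
  open import Data.List.Relation.Unary.AllPairs using ([]; _∷_)
  open import Data.List.Relation.Unary.Unique.Propositional using (Unique)
  open import Data.Vec using (Vec; []; _∷_; lookup)
  import Data.Vec as Vec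
  open import Data.Vec.Functional using (insertAt)
  open import Data.Vec.Functional.Properties using (insertAt-lookup; insertAt-punchIn)
  open import Data.Product using (Σ; _×_; _,_; proj₁; proj₂; ∃-syntax)
  open import Data.Sum using (_⊎_; inj₁; inj₂)
  open import Data.Unit using (⊤; tt)
  open import Data.Empty using (⊥-elim)
  open import Function using (_∘_)
  open import Function.Definitions using (Injective)
  open import Relation.Nullary using (¬_; yes; no)
  open import Relation.Nullary.Decidable using (¬?)
  open import Relation.Binary.PropositionalEquality
  open import Algebra.Core using (Op₁; Op₂)
  open import Algebra.Structures using (IsCommutativeRing)
  open import Algebra.Bundles using (CommutativeRing)
  import Algebra.Solver.Ring.NaturalCoefficients.Default
  import Algebra.Properties.Semiring.Sum
  import Algebra.Properties.Ring

  open Counting using () renaming (∑ to ∑ℕ)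

  -- Quotients are kept as pairs of numerator and denominator throughout, so cancellation by
  -- `noZeroDivisors` takes the place of division.
  record FiniteDomain (q : ℕ) : Set where
    field
      _⊕_ _⊗_           : Op₂ (Fin q)
      ⊖_                : Op₁ (Fin q)
      𝟘 𝟙               : Fin q
      isCommutativeRing : IsCommutativeRing _≡_ _⊕_ _⊗_ ⊖_ 𝟘 𝟙
      noZeroDivisors    : ∀ x y → x ⊗ y ≡ 𝟘 → x ≡ 𝟘 ⊎ y ≡ 𝟘
      𝟙≢𝟘               : 𝟙 ≢ 𝟘

  -- The cost of one operation on fractions: a product of two polynomials takes d + d, and the
  -- scalar -1 in a difference one more.
  opDegree : ℕ → ℕ
  opDegree d = suc (d +ℕ d)

  ≤opDegree : ∀ d → d ≤ opDegree d
  ≤opDegree d = ℕ.m≤n⇒m≤1+n (ℕ.m≤m+n d d)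

  ≤opDegree² : ∀ d → d ≤ opDegree (opDegree d)
  ≤opDegree² d = ℕ.≤-trans (≤opDegree d) (≤opDegree (opDegree d))

  -- A Newton step performs two operations before the recursive call (difference, quotient) and two
  -- after it (product, difference).
  interpolationDegree : ℕ → ℕ → ℕ
  interpolationDegree zero    d = d
  interpolationDegree (suc m) d = opDegree (opDegree (interpolationDegree m (opDegree (opDegree d))))

  ≤interpolationDegree : ∀ m d → d ≤ interpolationDegree m d
  ≤interpolationDegree zero    d = ℕ.≤-refl
  ≤interpolationDegree (suc m) d = ℕ.≤-trans (≤opDegree² d) (ℕ.≤-trans (≤interpolationDegree m _) (≤opDegree² _))

  module Polynomials {q : ℕ} (F : FiniteDomain q) where

    K : Set
    K = Fin q

    ring : CommutativeRing 0ℓ 0ℓ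
    ring = record { isCommutativeRing = FiniteDomain.isCommutativeRing F }

    open CommutativeRing ring using (_+_; _*_; -_; 0#; 1#) public
    open Algebra.Solver.Ring.NaturalCoefficients.Default (CommutativeRing.commutativeSemiring ring) using (solve; con; _:+_; _:*_; _:=_)
    open IsCommutativeRing (FiniteDomain.isCommutativeRing F) public
      using (+-identityˡ; +-identityʳ; *-identityˡ; *-identityʳ; zeroˡ; zeroʳ; +-assoc; *-assoc; *-comm; +-comm; -‿inverseˡ; -‿inverseʳ)
    open Algebra.Properties.Semiring.Sum (CommutativeRing.semiring ring) public
      using (sum-remove; ∑-distrib-+; *-distribˡ-sum; *-distribʳ-sum; sum-cong-≗; sum-replicate-zero) renaming (sum to ∑)
    open Algebra.Properties.Ring (CommutativeRing.ring ring) public using (-‿distribˡ-*; -1*x≈-x)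

    1≢0 : 1# ≢ 0#
    1≢0 = FiniteDomain.𝟙≢𝟘 F

    *-cancel-0 : ∀ {x y} → x ≢ 0# → x * y ≡ 0# → y ≡ 0#
    *-cancel-0 {x} {y} x≢0 eq with FiniteDomain.noZeroDivisors F x y eq
    ... | inj₁ x≡0 = ⊥-elim (x≢0 x≡0)
    ... | inj₂ y≡0 = y≡0

    *-≢0 : ∀ {x y} → x ≢ 0# → y ≢ 0# → x * y ≢ 0#
    *-≢0 x≢0 y≢0 eq = y≢0 (*-cancel-0 x≢0 eq)

    infixl 6 _−_
    _−_ : K → K → K
    x − y = x + - y

    −-+ : ∀ x y → (x − y) + y ≡ x
    −-+ x y = trans (+-assoc x (- y) y) (trans (cong (x +_) (-‿inverseˡ y)) (+-identityʳ x))

    −≡0⇒≡ : ∀ {x y} → x − y ≡ 0# → x ≡ y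
    −≡0⇒≡ {x} {y} eq = trans (sym (−-+ x y)) (trans (cong (_+ y) eq) (+-identityˡ y))

    +-−-cancel : ∀ x y → (x + y) − x ≡ y
    +-−-cancel x y = trans (cong (_− x) (+-comm x y)) (trans (+-assoc y x (- x)) (trans (cong (y +_) (-‿inverseʳ x)) (+-identityʳ y)))

    pow : K → ℕ → K
    pow x zero    = 1#
    pow x (suc n) = x * pow x n

    isZero : K → ℕ
    isZero x with x ≟ 0#
    ... | yes _ = 1
    ... | no  _ = 0

    isZero-yes : ∀ {x} → x ≡ 0# → isZero x ≡ 1
    isZero-yes {x} eq with x ≟ 0#
    ... | yes _  = refl
    ... | no neq = ⊥-elim (neq eq)

    isZero-no : ∀ {x} → x ≢ 0# → isZero x ≡ 0
    isZero-no {x} neq with x ≟ 0#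
    ... | yes eq = ⊥-elim (neq eq)
    ... | no _   = refl

    isZero≤1 : ∀ x → isZero x ≤ 1
    isZero≤1 x with x ≟ 0#
    ... | yes _ = s≤s z≤n
    ... | no  _ = z≤n

    ev : List K → K → K
    ev []       x = 0#
    ev (a ∷ as) x = a + x * ev as x

    suffixEvs : K → List K → List K
    suffixEvs r []       = []
    suffixEvs r (a ∷ as) = ev (a ∷ as) r ∷ suffixEvs r as

    length-suffixEvs : ∀ r as → length (suffixEvs r as) ≡ length as
    length-suffixEvs r []       = refl
    length-suffixEvs r (a ∷ as) = cong suc (length-suffixEvs r as)

    -- Synthetic division: the first Horner value is the remainder, and the others are the
    -- coefficients of the quotient by X - r.
    quot : K → List K → List K
    quot r []       = []
    quot r (a ∷ as) = suffixEvs r as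

    ev-suffixEvs : ∀ r as x → ev (suffixEvs r as) x ≡ ev as r + x * ev (quot r as) x
    ev-suffixEvs r []       x = sym (trans (+-identityˡ _) (zeroʳ x))
    ev-suffixEvs r (a ∷ as) x = refl

    -- Writing the point as d + r keeps the identity free of subtraction, within reach of the
    -- semiring solver.
    ev-quot : ∀ as d r → ev as (d + r) ≡ ev as r + d * ev (quot r as) (d + r)
    ev-quot []       d r = sym (trans (+-identityˡ _) (zeroʳ d))
    ev-quot (a ∷ as) d r = begin
      a + (d + r) * ev as (d + r)
        ≡⟨ cong (λ y → a + (d + r) * y) (ev-quot as d r) ⟩
      a + (d + r) * (ev as r + d * ev (quot r as) (d + r))
        ≡⟨ rearrange a d r (ev as r) (ev (quot r as) (d + r)) ⟩
      (a + r * ev as r) + d * (ev as r + (d + r) * ev (quot r as) (d + r))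
        ≡⟨ cong (λ y → (a + r * ev as r) + d * y) (ev-suffixEvs r as (d + r)) ⟨
      (a + r * ev as r) + d * ev (suffixEvs r as) (d + r) ∎
      where
      open ≡-Reasoning
      rearrange : ∀ a d r e w → a + (d + r) * (e + d * w) ≡ (a + r * e) + d * (e + (d + r) * w)
      rearrange = solve 5 (λ a d r e w → a :+ (d :+ r) :* (e :+ d :* w) := (a :+ r :* e) :+ d :* (e :+ (d :+ r) :* w)) refl

    ev-− : ∀ as x r → (x − r) * ev (quot r as) x ≡ ev as x − ev as r
    ev-− as x r = sym (begin
      ev as x − ev as r                                ≡⟨ cong (_− ev as r) (subst (λ y → ev as y ≡ ev as r + (x − r) * ev (quot r as) y) (−-+ x r) (ev-quot as (x − r) r)) ⟩
      (ev as r + (x − r) * ev (quot r as) x) − ev as r ≡⟨ +-−-cancel (ev as r) _ ⟩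
      (x − r) * ev (quot r as) x ∎)
      where open ≡-Reasoning

    -- Division by X - r preserves the other roots, as there are no zero divisors. By induction the
    -- quotient has zero coefficients, and undoing Horner's scheme carries this back to `as`.
    roots⇒zero : ∀ as rs → Unique rs → length as ≤ length rs → All (λ r → ev as r ≡ 0#) rs → All (_≡ 0#) as
    roots⇒zero []       rs       u        le       zs       = []
    roots⇒zero (a ∷ as) (r ∷ rs) (r∉ ∷ u) (s≤s le) (z ∷ zs) = a≡0 ∷ as≡0
      where
      open ≡-Reasoning
      quotRoots : ∀ {rs} → All (r ≢_) rs → All (λ r′ → ev (a ∷ as) r′ ≡ 0#) rs → All (λ r′ → ev (suffixEvs r as) r′ ≡ 0#) rs
      quotRoots []          []       = []
      quotRoots {r′ ∷ _} (r≢ ∷ ps) (z′ ∷ zs) = *-cancel-0 (λ eq → r≢ (sym (−≡0⇒≡ eq))) (begin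
        (r′ − r) * ev (suffixEvs r as) r′ ≡⟨ ev-− (a ∷ as) r′ r ⟩
        ev (a ∷ as) r′ − ev (a ∷ as) r    ≡⟨ cong₂ _−_ z′ z ⟩
        0# − 0#                           ≡⟨ -‿inverseʳ 0# ⟩
        0#                                ∎) ∷ quotRoots ps zs
      unsuffix : ∀ as → All (_≡ 0#) (suffixEvs r as) → All (_≡ 0#) as
      ev-zero : ∀ as → All (_≡ 0#) (suffixEvs r as) → ev as r ≡ 0#
      ev-zero []       _       = refl
      ev-zero (b ∷ bs) (p ∷ _) = p
      drop-* : ∀ b e → e ≡ 0# → b + r * e ≡ 0# → b ≡ 0#
      drop-* b e refl eq = trans (sym (+-identityʳ b)) (trans (cong (b +_) (sym (zeroʳ r))) eq)
      unsuffix []       _        = []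
      unsuffix (b ∷ bs) (p ∷ ps) = drop-* b (ev bs r) (ev-zero bs ps) p ∷ unsuffix bs ps
      quot≡0 : All (_≡ 0#) (suffixEvs r as)
      quot≡0 = roots⇒zero (suffixEvs r as) rs u (ℕ.≤-trans (ℕ.≤-reflexive (length-suffixEvs r as)) le) (quotRoots r∉ zs)
      as≡0 : All (_≡ 0#) as
      as≡0 = unsuffix as quot≡0
      a≡0 : a ≡ 0#
      a≡0 = drop-* a (ev as r) (ev-zero as quot≡0) z

    ev-allZero : ∀ {as} → All (_≡ 0#) as → ∀ x → ev as x ≡ 0#
    ev-allZero []          x = refl
    ev-allZero (refl ∷ zs) x = trans (+-identityˡ _) (trans (cong (x *_) (ev-allZero zs x)) (zeroʳ x))

    record Roots {n} (as : List K) (τ : Fin n → K) : Set where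
      field
        roots  : List K
        unique : Unique roots
        image  : All (λ r → ∃[ i ] r ≡ τ i) roots
        areRoots : All (λ r → ev as r ≡ 0#) roots
        count  : length roots ≡ ∑ℕ (λ i → isZero (ev as (τ i)))

    findRoots : ∀ {n} as (τ : Fin n → K) → Injective _≡_ _≡_ τ → Roots as τ
    findRoots {zero}  as τ inj = record { roots = [] ; unique = [] ; image = [] ; areRoots = [] ; count = refl }
    findRoots {suc n} as τ inj with findRoots as (τ ∘ suc) (Fin.suc-injective ∘ inj) | ev as (τ zero) ≟ 0#
    ... | record { roots = rs ; unique = u ; image = im ; areRoots = zs ; count = c } | no nz =
      record { roots = rs ; unique = u ; image = All.map (λ (i , e) → suc i , e) im ; areRoots = zs
             ; count = trans c (sym (cong (_+ℕ ∑ℕ (λ i → isZero (ev as (τ (suc i))))) (isZero-no nz))) }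
    ... | record { roots = rs ; unique = u ; image = im ; areRoots = zs ; count = c } | yes z =
      record { roots = τ zero ∷ rs ; unique = fresh im ∷ u ; image = (zero , refl) ∷ All.map (λ (i , e) → suc i , e) im ; areRoots = z ∷ zs
             ; count = trans (cong suc c) (sym (cong (_+ℕ ∑ℕ (λ i → isZero (ev as (τ (suc i))))) (isZero-yes z))) }
      where
      fresh : ∀ {rs} → All (λ r → ∃[ i ] r ≡ τ (suc i)) rs → All (τ zero ≢_) rs
      fresh []             = []
      fresh ((i , e) ∷ ps) = (λ eq → Fin.0≢1+n (inj (trans eq e))) ∷ fresh ps

    rootCount : ∀ {n} as (τ : Fin n → K) → Injective _≡_ _≡_ τ → ¬ All (_≡ 0#) as → ∑ℕ (λ i → isZero (ev as (τ i))) ≤ length as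
    rootCount as τ inj nz = ℕ.≮⇒≥ λ lt → nz (roots⇒zero as roots unique (ℕ.≤-trans (ℕ.<⇒≤ lt) (ℕ.≤-reflexive (sym count))) areRoots)
      where open Roots (findRoots as τ inj)

    manyRoots : ∀ {n} as (τ : Fin n → K) → Injective _≡_ _≡_ τ → length as ≤ n → (∀ i → ev as (τ i) ≡ 0#) → All (_≡ 0#) as
    manyRoots {n} as τ inj le zs = roots⇒zero as roots unique (ℕ.≤-trans le (ℕ.≤-reflexive (sym (trans count (total τ zs))))) areRoots
      where
      open Roots (findRoots as τ inj)
      total : ∀ {n} (τ : Fin n → K) → (∀ i → ev as (τ i) ≡ 0#) → ∑ℕ (λ i → isZero (ev as (τ i))) ≡ n
      total {zero}  τ zs = refl
      total {suc n} τ zs = cong₂ _+ℕ_ (isZero-yes (zs zero)) (total (τ ∘ suc) (zs ∘ suc))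

    infixl 6 _⊞_
    _⊞_ : List K → List K → List K
    []       ⊞ bs       = bs
    (a ∷ as) ⊞ []       = a ∷ as
    (a ∷ as) ⊞ (b ∷ bs) = (a + b) ∷ (as ⊞ bs)

    ev-⊞ : ∀ as bs x → ev (as ⊞ bs) x ≡ ev as x + ev bs x
    ev-⊞ []       bs       x = sym (+-identityˡ _)
    ev-⊞ (a ∷ as) []       x = sym (+-identityʳ _)
    ev-⊞ (a ∷ as) (b ∷ bs) x = trans (cong (λ y → (a + b) + x * y) (ev-⊞ as bs x)) (rearrange a b x (ev as x) (ev bs x))
      where
      rearrange : ∀ a b x e f → (a + b) + x * (e + f) ≡ (a + x * e) + (b + x * f)
      rearrange = solve 5 (λ a b x e f → (a :+ b) :+ x :* (e :+ f) := (a :+ x :* e) :+ (b :+ x :* f)) refl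

    length-⊞ : ∀ {d} as bs → length as ≤ d → length bs ≤ d → length (as ⊞ bs) ≤ d
    length-⊞ []       bs       le       le′       = le′
    length-⊞ (a ∷ as) []       le       le′       = le
    length-⊞ (a ∷ as) (b ∷ bs) (s≤s le) (s≤s le′) = s≤s (length-⊞ as bs le le′)

    infixl 7 _⊠_
    _⊠_ : List K → List K → List K
    []       ⊠ bs = []
    (a ∷ as) ⊠ bs = map (a *_) bs ⊞ (0# ∷ as ⊠ bs)

    ev-⊠ : ∀ as bs x → ev (as ⊠ bs) x ≡ ev as x * ev bs x
    ev-⊠ []       bs x = sym (zeroˡ _)
    ev-⊠ (a ∷ as) bs x = begin
      ev (map (a *_) bs ⊞ (0# ∷ as ⊠ bs)) x          ≡⟨ ev-⊞ (map (a *_) bs) (0# ∷ as ⊠ bs) x ⟩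
      ev (map (a *_) bs) x + (0# + x * ev (as ⊠ bs) x) ≡⟨ cong₂ _+_ (ev-scale bs) (trans (+-identityˡ _) (cong (x *_) (ev-⊠ as bs x))) ⟩
      a * ev bs x + x * (ev as x * ev bs x)          ≡⟨ rearrange a x (ev as x) (ev bs x) ⟩
      (a + x * ev as x) * ev bs x                    ∎
      where
      open ≡-Reasoning
      rearrange : ∀ a x e f → a * f + x * (e * f) ≡ (a + x * e) * f
      rearrange = solve 4 (λ a x e f → a :* f :+ x :* (e :* f) := (a :+ x :* e) :* f) refl
      rearrange′ : ∀ a b x e → a * b + x * (a * e) ≡ a * (b + x * e)
      rearrange′ = solve 4 (λ a b x e → a :* b :+ x :* (a :* e) := a :* (b :+ x :* e)) refl
      ev-scale : ∀ bs → ev (map (a *_) bs) x ≡ a * ev bs x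
      ev-scale []       = sym (zeroʳ a)
      ev-scale (b ∷ bs) = trans (cong (λ y → a * b + x * y) (ev-scale bs)) (rearrange′ a b x (ev bs x))

    length-⊠ : ∀ as bs → length (as ⊠ bs) ≤ length as +ℕ length bs
    length-⊠ []       bs = z≤n
    length-⊠ (a ∷ as) bs = length-⊞ (map (a *_) bs) (0# ∷ as ⊠ bs)
      (ℕ.≤-trans (ℕ.≤-reflexive (List.length-map (a *_) bs)) (ℕ.m≤n+m _ (suc (length as))))
      (s≤s (length-⊠ as bs))

    Uni : ℕ → (K → K) → Set
    Uni d f = Σ (List K) λ as → length as ≤ d × (∀ x → f x ≡ ev as x)

    -- d bounds the number of coefficients with respect to each variable: one more than the degree.
    SepPoly : ∀ n → ℕ → (Vec K n → K) → Set
    SepPoly zero    d f = ⊤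
    SepPoly (suc n) d f = (∀ zs → Uni d (λ x → f (x ∷ zs))) × (∀ x → SepPoly n d (λ zs → f (x ∷ zs)))

    sep-weaken : ∀ {n d e f} → d ≤ e → SepPoly n d f → SepPoly n e f
    sep-weaken {zero}  le p = tt
    sep-weaken {suc n} le (p , r) =
      (λ zs → let as , le′ , e = p zs in as , ℕ.≤-trans le′ le , e) , (λ x → sep-weaken le (r x))

    sep-const : ∀ {n} c → SepPoly n 1 (λ _ → c)
    sep-const {zero}  c = tt
    sep-const {suc n} c = (λ zs → c ∷ [] , s≤s z≤n , λ x → sym (trans (cong (c +_) (zeroʳ x)) (+-identityʳ c))) , (λ x → sep-const c)

    sep-lookup : ∀ {n} (i : Fin n) → SepPoly n 2 (λ z → lookup z i)
    sep-lookup {suc n} zero =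
      (λ zs → 0# ∷ 1# ∷ [] , s≤s (s≤s z≤n) , λ x → sym (linear x)) , (λ x → sep-weaken (s≤s z≤n) (sep-const x))
      where
      linear : ∀ x → 0# + x * (1# + x * 0#) ≡ x
      linear = solve 1 (λ x → con 0 :+ x :* (con 1 :+ x :* con 0) := x) refl
    sep-lookup {suc n} (suc i) =
      (λ zs → let p = sep-const {1} (lookup zs i) in let as , le , e = proj₁ p [] in as , ℕ.≤-trans le (s≤s z≤n) , e) ,
      (λ x → sep-lookup i)

    sep-+ : ∀ {n d f g} → SepPoly n d f → SepPoly n d g → SepPoly n d (λ z → f z + g z)
    sep-+ {zero}  p q = tt
    sep-+ {suc n} (p , r) (p′ , r′) =
      (λ zs → let as , le , e = p zs ; bs , le′ , e′ = p′ zs in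
        as ⊞ bs , length-⊞ as bs le le′ , λ x → trans (cong₂ _+_ (e x) (e′ x)) (sym (ev-⊞ as bs x))) ,
      (λ x → sep-+ (r x) (r′ x))

    sep-* : ∀ {n d d′ f g} → SepPoly n d f → SepPoly n d′ g → SepPoly n (d +ℕ d′) (λ z → f z * g z)
    sep-* {zero}  p q = tt
    sep-* {suc n} (p , r) (p′ , r′) =
      (λ zs → let as , le , e = p zs ; bs , le′ , e′ = p′ zs in
        as ⊠ bs , ℕ.≤-trans (length-⊠ as bs) (ℕ.+-mono-≤ le le′) , λ x → trans (cong₂ _*_ (e x) (e′ x)) (sym (ev-⊠ as bs x))) ,
      (λ x → sep-* (r x) (r′ x))

    sep-scale : ∀ {n d f} c → SepPoly n d f → SepPoly n (suc d) (λ z → c * f z)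
    sep-scale c p = sep-* (sep-const c) p

    sep-∑ : ∀ {n d m} {f : Fin m → Vec K n → K} → 1 ≤ d → (∀ i → SepPoly n d (f i)) → SepPoly n d (λ z → ∑ (λ i → f i z))
    sep-∑ {m = zero}  1≤d p = sep-weaken 1≤d (sep-const 0#)
    sep-∑ {m = suc m} 1≤d p = sep-+ (p zero) (sep-∑ 1≤d (p ∘ suc))

    sep-pow : ∀ {n d f} i → SepPoly n d f → SepPoly n (suc (i *ℕ d)) (λ z → pow (f z) i)
    sep-pow zero    p = sep-const 1#
    sep-pow {d = d} (suc i) p = sep-weaken (ℕ.≤-reflexive (ℕ.+-suc d (i *ℕ d))) (sep-* p (sep-pow i p))

    module Grid {d : ℕ} (g : Fin d → K) (g-inj : Injective _≡_ _≡_ g) where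

      gridPoint : ∀ n → Fin (d ^ℕ n) → Vec K n
      gridPoint zero    β = []
      gridPoint (suc n) β = g (quotient (d ^ℕ n) β) ∷ gridPoint n (remainder {d} (d ^ℕ n) β)

      gridPoint-combine : ∀ n i β → gridPoint (suc n) (combine i β) ≡ g i ∷ gridPoint n β
      gridPoint-combine n i β = cong (λ (i , β) → g i ∷ gridPoint n β) (Fin.remQuot-combine {d} i β)

      -- By induction f(g i, z) = 0 for every `i` and every `z`; as a function of its first
      -- variable, f has at most d coefficients and d roots.
      vanish : ∀ n {f} → SepPoly n d f → (∀ β → f (gridPoint n β) ≡ 0#) → ∀ z → f z ≡ 0#
      vanish zero    p zs []      = zs zero
      vanish (suc n) {f} (p , r) zs (x ∷ z) with p z
      ... | as , le , e = trans (e x) (ev-allZero (manyRoots as g g-inj le λ i → trans (sym (e (g i)))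
        (vanish n (r (g i)) (λ β → trans (cong f (sym (gridPoint-combine n i β))) (zs (combine i β))) z)) x)

    -- Gaussian elimination without division: cross-multiplying with the pivot `a` of row 0 removes
    -- column `j` from the other equations. The solution of the smaller system is scaled by `a`, and
    -- row 0 then dictates the entry `xj`.
    kernel : ∀ A B (v : Fin B → Fin A → K) → B < A →
             Σ (Fin A → K) λ x → (∃[ i ] x i ≢ 0#) × (∀ b → ∑ (λ i → x i * v b i) ≡ 0#)
    kernel (suc A) zero    v lt = (λ _ → 1#) , (zero , 1≢0) , λ ()
    kernel (suc A) (suc B) v (s≤s lt) with Fin.any? (λ i → ¬? (v zero i ≟ 0#))
    ... | no none with kernel (suc A) B (v ∘ suc) (ℕ.m≤n⇒m≤1+n lt)
    ...   | x , nz , sol = x , nz , solves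
      where
      solves : ∀ b → ∑ (λ i → x i * v b i) ≡ 0#
      row0 : ∀ i → v zero i ≡ 0#
      row0 i with v zero i ≟ 0#
      ... | yes eq = eq
      ... | no neq = ⊥-elim (none (i , neq))
      solves zero    = trans (sum-cong-≗ λ i → trans (cong (x i *_) (row0 i)) (zeroʳ _)) (sum-replicate-zero (suc A))
      solves (suc b) = sol b
    kernel (suc A) (suc B) v (s≤s lt) | yes (j , a≢0) = x , nonzero , solves
      where
      open ≡-Reasoning
      a = v zero j
      v′ : Fin B → Fin A → K
      v′ b i = a * v (suc b) (punchIn j i) + - v zero (punchIn j i) * v (suc b) j
      rec = kernel A B v′ lt
      x′ = proj₁ rec
      xj = ∑ (λ i → x′ i * - v zero (punchIn j i))
      x : Fin (suc A) → K
      x = insertAt (λ i → a * x′ i) j xj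
      nonzero : ∃[ i ] x i ≢ 0#
      nonzero = let i , x≢0 = proj₁ (proj₂ rec) in
        punchIn j i , λ eq → *-≢0 a≢0 x≢0 (trans (sym (insertAt-punchIn (λ i → a * x′ i) j xj i)) eq)
      expand : ∀ b → ∑ (λ i → x i * v b i) ≡ ∑ (λ i → x′ i * (a * v b (punchIn j i) + - v zero (punchIn j i) * v b j))
      expand b = begin
        ∑ (λ i → x i * v b i)
          ≡⟨ sum-remove {i = j} (λ i → x i * v b i) ⟩
        x j * v b j + ∑ (λ i → x (punchIn j i) * v b (punchIn j i))
          ≡⟨ cong₂ _+_ (cong (_* v b j) (insertAt-lookup _ j xj)) (sum-cong-≗ λ i → cong (_* v b (punchIn j i)) (insertAt-punchIn _ j xj i)) ⟩
        xj * v b j + ∑ (λ i → a * x′ i * v b (punchIn j i))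
          ≡⟨ cong (_+ ∑ (λ i → a * x′ i * v b (punchIn j i))) (*-distribʳ-sum (v b j) (λ i → x′ i * - v zero (punchIn j i))) ⟩
        ∑ (λ i → x′ i * - v zero (punchIn j i) * v b j) + ∑ (λ i → a * x′ i * v b (punchIn j i))
          ≡⟨ ∑-distrib-+ (λ i → x′ i * - v zero (punchIn j i) * v b j) (λ i → a * x′ i * v b (punchIn j i)) ⟨
        ∑ (λ i → x′ i * - v zero (punchIn j i) * v b j + a * x′ i * v b (punchIn j i))
          ≡⟨ sum-cong-≗ (λ i → rearrange (x′ i) (- v zero (punchIn j i)) (v b j) a (v b (punchIn j i))) ⟩
        ∑ (λ i → x′ i * (a * v b (punchIn j i) + - v zero (punchIn j i) * v b j)) ∎
        where
        rearrange : ∀ x n y a w → x * n * y + a * x * w ≡ x * (a * w + n * y)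
        rearrange = solve 5 (λ x n y a w → x :* n :* y :+ a :* x :* w := x :* (a :* w :+ n :* y)) refl
      solves : ∀ b → ∑ (λ i → x i * v b i) ≡ 0#
      solves (suc b) = trans (expand (suc b)) (proj₂ (proj₂ rec) b)
      solves zero    = trans (expand zero) (trans (sum-cong-≗ λ i → trans (cong (x′ i *_) (cancel (v zero (punchIn j i)))) (zeroʳ _)) (sum-replicate-zero A))
        where
        cancel : ∀ y → a * y + - y * a ≡ 0#
        cancel y = trans (cong₂ _+_ (*-comm a y) (sym (-‿distribˡ-* y a))) (-‿inverseʳ (y * a))

    record Poly (n D : ℕ) : Set where
      field
        fun    : Vec K n → K
        isPoly : SepPoly n D fun
    open Poly public

    record Frac (n D : ℕ) : Set where
      field
        num den : Poly n D
    open Frac public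

    -- Fractions are partial: their denominators contain differences of interpolation nodes and
    -- vanish at parameters where nodes collide. Being defined at `z` is therefore part of the
    -- relation.
    Rep : ∀ {n D} → Vec K n → Frac n D → K → Set
    Rep z f a = fun (den f) z ≢ 0# × fun (num f) z ≡ a * fun (den f) z

    data Reps {n D} (z : Vec K n) : ∀ {N} → Vec (Frac n D) N → Vec K N → Set where
      []  : Reps z [] []
      _∷_ : ∀ {N f a} {fs : Vec (Frac n D) N} {w} → Rep z f a → Reps z fs w → Reps z (f ∷ fs) (a ∷ w)

    weaken : ∀ {n d e} → d ≤ e → Frac n d → Frac n e
    weaken le f = record
      { num = record { fun = fun (num f) ; isPoly = sep-weaken le (isPoly (num f)) }
      ; den = record { fun = fun (den f) ; isPoly = sep-weaken le (isPoly (den f)) } }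

    polyFrac : ∀ {n d} → 1 ≤ d → (f : Vec K n → K) → SepPoly n d f → Frac n d
    polyFrac 1≤d f p = record { num = record { fun = f ; isPoly = p } ; den = record { fun = λ _ → 1# ; isPoly = sep-weaken 1≤d (sep-const 1#) } }

    polyFrac-rep : ∀ {n d z} {1≤d : 1 ≤ d} {f : Vec K n → K} {p : SepPoly n d f} → Rep z (polyFrac 1≤d f p) (f z)
    polyFrac-rep = 1≢0 , sym (*-identityʳ _)

    infixl 6 _⊟_
    infixl 7 _⊡_ _⊘_
    _⊟_ _⊡_ _⊘_ : ∀ {n d} → Frac n d → Frac n d → Frac n (opDegree d)
    f ⊟ g = record
      { num = record { fun = λ z → fun (num f) z * fun (den g) z + - 1# * (fun (num g) z * fun (den f) z)
                     ; isPoly = sep-+ (sep-weaken (ℕ.n≤1+n _) (sep-* (isPoly (num f)) (isPoly (den g)))) (sep-scale (- 1#) (sep-* (isPoly (num g)) (isPoly (den f)))) }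
      ; den = record { fun = λ z → fun (den f) z * fun (den g) z ; isPoly = sep-weaken (ℕ.n≤1+n _) (sep-* (isPoly (den f)) (isPoly (den g))) } }
    f ⊡ g = record
      { num = record { fun = λ z → fun (num f) z * fun (num g) z ; isPoly = sep-weaken (ℕ.n≤1+n _) (sep-* (isPoly (num f)) (isPoly (num g))) }
      ; den = record { fun = λ z → fun (den f) z * fun (den g) z ; isPoly = sep-weaken (ℕ.n≤1+n _) (sep-* (isPoly (den f)) (isPoly (den g))) } }
    f ⊘ g = record
      { num = record { fun = λ z → fun (num f) z * fun (den g) z ; isPoly = sep-weaken (ℕ.n≤1+n _) (sep-* (isPoly (num f)) (isPoly (den g))) }
      ; den = record { fun = λ z → fun (den f) z * fun (num g) z ; isPoly = sep-weaken (ℕ.n≤1+n _) (sep-* (isPoly (den f)) (isPoly (num g))) } }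

    ⊟-rep : ∀ {n d z a b} {f g : Frac n d} → Rep z f a → Rep z g b → Rep z (f ⊟ g) (a − b)
    ⊟-rep {z = z} {a} {b} {f} {g} (u≢0 , eq) (v≢0 , eq′) = *-≢0 u≢0 v≢0 , (begin
      fun (num f) z * v + - 1# * (fun (num g) z * u) ≡⟨ cong₂ (λ x y → x * v + - 1# * (y * u)) eq eq′ ⟩
      a * u * v + - 1# * (b * v * u)                 ≡⟨ rearrange a b u v (- 1#) ⟩
      (a + - 1# * b) * (u * v)                       ≡⟨ cong (λ x → (a + x) * (u * v)) (-1*x≈-x b) ⟩
      (a − b) * (u * v)                              ∎)
      where
      open ≡-Reasoning
      u = fun (den f) z
      v = fun (den g) z
      rearrange : ∀ a b u v m → a * u * v + m * (b * v * u) ≡ (a + m * b) * (u * v)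
      rearrange = solve 5 (λ a b u v m → a :* u :* v :+ m :* (b :* v :* u) := (a :+ m :* b) :* (u :* v)) refl

    ⊡-rep : ∀ {n d z a b} {f g : Frac n d} → Rep z f a → Rep z g b → Rep z (f ⊡ g) (a * b)
    ⊡-rep {z = z} {a} {b} {f} {g} (u≢0 , eq) (v≢0 , eq′) = *-≢0 u≢0 v≢0 ,
      trans (cong₂ _*_ eq eq′) (rearrange a b (fun (den f) z) (fun (den g) z))
      where
      rearrange : ∀ a b u v → (a * u) * (b * v) ≡ (a * b) * (u * v)
      rearrange = solve 4 (λ a b u v → (a :* u) :* (b :* v) := (a :* b) :* (u :* v)) refl

    ⊘-rep : ∀ {n d z a b x} {f g : Frac n d} → Rep z f a → Rep z g b → b ≢ 0# → b * x ≡ a → Rep z (f ⊘ g) x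
    ⊘-rep {z = z} {a} {b} {x} {f} {g} (u≢0 , eq) (v≢0 , eq′) b≢0 refl =
      *-≢0 u≢0 (λ e → *-≢0 b≢0 v≢0 (trans (sym eq′) e)) ,
      trans (cong (_* v) eq) (trans (rearrange b x u v) (cong (λ y → x * (u * y)) (sym eq′)))
      where
      u = fun (den f) z
      v = fun (den g) z
      rearrange : ∀ b x u v → b * x * u * v ≡ x * (u * (b * v))
      rearrange = solve 4 (λ b x u v → b :* x :* u :* v := x :* (u :* (b :* v))) refl

    -- Newton interpolation: the values of (P(X) − P(μ₀)) / (X − μ₀) at the other nodes determine its coefficients
    -- recursively, and those are the successive Horner values of P at μ₀.

    dividedDifferences : ∀ {n d m} → Frac n d → Frac n d → Vec (Frac n d) m → Vec (Frac n d) m → Vec (Frac n (opDegree (opDegree d))) m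
    dividedDifferences μ₀ y₀ []       []       = []
    dividedDifferences μ₀ y₀ (μ ∷ μs) (y ∷ ys) = ((y ⊟ y₀) ⊘ (μ ⊟ μ₀)) ∷ dividedDifferences μ₀ y₀ μs ys

    -- Consecutive Horner values satisfy e_i = c_i + μ₀ e_(i+1), so c_i is recovered as e_i - μ₀
    -- e_(i+1), and the last coefficient is the last value itself.
    unHorner : ∀ {n d m} → Frac n d → Frac n d → Vec (Frac n d) m → Vec (Frac n (opDegree (opDegree d))) (suc m)
    unHorner {d = d} μ₀ y []       = weaken (ℕ.≤-trans (≤opDegree d) (≤opDegree _)) y ∷ []
    unHorner {d = d} μ₀ y (c ∷ cs) = (weaken (≤opDegree d) y ⊟ μ₀ ⊡ c) ∷ unHorner μ₀ c cs

    interpolate : ∀ {n d} m → Vec (Frac n d) m → Vec (Frac n d) m → Vec (Frac n (interpolationDegree m d)) m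
    interpolate         zero    []       []       = []
    interpolate {d = d} (suc m) (μ ∷ μs) (y ∷ ys) =
      unHorner (weaken le μ) (weaken le y)
        (interpolate m (Vec.map (weaken (≤opDegree² d)) μs) (dividedDifferences μ y μs ys))
      where
      le : d ≤ interpolationDegree m (opDegree (opDegree d))
      le = ℕ.≤-trans (≤opDegree² d) (≤interpolationDegree m _)

    Distinct : ∀ {m} → Vec K m → Set
    Distinct []       = ⊤
    Distinct (x ∷ xs) = (∀ i → lookup xs i ≢ x) × Distinct xs

    hornerVec : ∀ {m} → K → Vec K m → Vec K m
    hornerVec r []       = []
    hornerVec r (c ∷ cs) = ev (Vec.toList (c ∷ cs)) r ∷ hornerVec r cs

    toList-hornerVec : ∀ {m} r (cs : Vec K m) → Vec.toList (hornerVec r cs) ≡ suffixEvs r (Vec.toList cs)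
    toList-hornerVec r []       = refl
    toList-hornerVec r (c ∷ cs) = cong (ev (Vec.toList (c ∷ cs)) r ∷_) (toList-hornerVec r cs)

    weaken-reps : ∀ {n d e m z} {le : d ≤ e} {fs : Vec (Frac n d) m} {v} → Reps z fs v → Reps z (Vec.map (weaken le) fs) v
    weaken-reps []      = []
    weaken-reps (x ∷ r) = x ∷ weaken-reps r

    unHorner-reps : ∀ {n d m z r} {μ₀ y : Frac n d} {fs : Vec (Frac n d) m} c (cs : Vec K m) → Rep z μ₀ r →
                    Rep z y (ev (Vec.toList (c ∷ cs)) r) → Reps z fs (hornerVec r cs) → Reps z (unHorner μ₀ y fs) (c ∷ cs)
    unHorner-reps {z = z} {r} {y = y} c [] μ-rep y-rep [] = subst (Rep z y) (trans (cong (c +_) (zeroʳ r)) (+-identityʳ c)) y-rep ∷ []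
    unHorner-reps {z = z} {r} {μ₀} {y} {f ∷ _} c (c′ ∷ cs) μ-rep y-rep (f-rep ∷ reps) =
      subst (Rep z (weaken (≤opDegree _) y ⊟ μ₀ ⊡ f)) (trans (cong (_− r * ev (Vec.toList (c′ ∷ cs)) r) (+-comm c _)) (+-−-cancel _ c))
        (⊟-rep {f = weaken (≤opDegree _) y} {g = μ₀ ⊡ f} y-rep (⊡-rep {f = μ₀} {g = f} μ-rep f-rep))
      ∷ unHorner-reps c′ cs μ-rep f-rep reps

    -- The recursion runs on `hornerVec r cs`, the coefficients of the quotient by X - r, whose
    -- values solve (r′ - r) x = P(r′) - P(r); distinct nodes keep these denominators from
    -- vanishing.
    interpolate-reps : ∀ {n d z} m {μs ys : Vec (Frac n d) m} {rs} (cs : Vec K m) → Distinct rs → Reps z μs rs →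
                       Reps z ys (Vec.map (ev (Vec.toList cs)) rs) → Reps z (interpolate m μs ys) cs
    interpolate-reps zero    []       _ [] [] = []
    interpolate-reps {z = z} (suc m) {μ ∷ μs} {y ∷ ys} {r ∷ rs} (c ∷ cs) (r∉ , dist) (μ-rep ∷ μ-reps) (y-rep ∷ y-reps) =
      unHorner-reps c cs μ-rep y-rep
        (interpolate-reps m (hornerVec r cs) dist (weaken-reps μ-reps) (differences μs ys rs r∉ μ-reps y-reps))
      where
      differences : ∀ {m} (μs ys : Vec _ m) rs → (∀ i → lookup rs i ≢ r) → Reps z μs rs → Reps z ys (Vec.map (ev (Vec.toList (c ∷ cs))) rs) →
                    Reps z (dividedDifferences μ y μs ys) (Vec.map (ev (Vec.toList (hornerVec r cs))) rs)
      differences []        []        []        _  []       []       = []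
      differences (μ′ ∷ μs) (y′ ∷ ys) (r′ ∷ rs) r∉ (p ∷ ps) (q ∷ qs) =
        ⊘-rep {f = y′ ⊟ y} {g = μ′ ⊟ μ} (⊟-rep {f = y′} {g = y} q y-rep) (⊟-rep {f = μ′} {g = μ} p μ-rep) (r∉ zero ∘ −≡0⇒≡)
          (trans (cong (λ l → (r′ − r) * ev l r′) (toList-hornerVec r cs)) (ev-− (c ∷ Vec.toList cs) r′ r))
        ∷ differences μs ys rs (r∉ ∘ suc) ps qs

-- Dimension counting and algebraic relations between fractions.

module AlgebraicDependence where
  open import Data.Nat using (ℕ; zero; suc; _≤_; _<_; z≤n; s≤s; _∸_) renaming (_+_ to _+ℕ_; _*_ to _*ℕ_; _^_ to _^ℕ_)
  import Data.Nat.Properties as ℕ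
  import Data.Nat.Tactic.RingSolver as ℕ
  open import Data.Fin using (Fin; zero; suc; toℕ; _≟_; combine; quotient; remainder; _↑ˡ_; _↑ʳ_)
  import Data.Fin.Properties as Fin
  open import Data.List using (List; []; _∷_; length; tabulate)
  import Data.List.Properties as List
  open import Data.List.Relation.Unary.All using (All; []; _∷_)
  import Data.List.Relation.Unary.All.Properties as All
  open import Data.Vec using (Vec; []; _∷_; _++_)
  import Data.Vec as Vec
  import Data.Vec.Functional as Vector
  open import Data.Product using (Σ; _×_; _,_; proj₁; proj₂; ∃-syntax)
  open import Data.Sum using (_⊎_; inj₁; inj₂)
  open import Function using (_∘_; id)
  open import Function.Definitions using (Injective)
  open import Relation.Nullary using (yes; no)
  open import Relation.Binary.PropositionalEquality
  open import Algebra.Bundles using (CommutativeRing)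
  import Algebra.Solver.Ring.NaturalCoefficients.Default

  open Counting renaming (∑ to ∑ℕ) hiding (sum-remove; ∑-distrib-+)
  open FiniteDomains

  -- The sets of R among M coordinates, given by a decision at each coordinate: the same case
  -- distinction drives the dimension count.
  data Thin : ℕ → ℕ → Set where
    done : Thin 0 0
    keep : ∀ {R M} → Thin R M → Thin (suc R) (suc M)
    drop : ∀ {R M} → Thin R M → Thin R (suc M)

  select : ∀ {A : Set} {R M} → Thin R M → Vec A M → Vec A R
  select done     []      = []
  select (keep T) (x ∷ v) = x ∷ select T v
  select (drop T) (x ∷ v) = select T v

  dropAll : ∀ M → Thin 0 M
  dropAll zero    = done
  dropAll (suc M) = drop (dropAll M)

  -- A product over all choices of coordinates, hence the indicator of a universal statement when f
  -- is 0 or 1. If R exceeds M there is no choice, and the empty product is 1.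
  allThin : ∀ R M → (Thin R M → ℕ) → ℕ
  allThin zero    zero    f = f done
  allThin (suc R) zero    f = 1
  allThin zero    (suc M) f = allThin zero M (f ∘ drop)
  allThin (suc R) (suc M) f = allThin R M (f ∘ keep) *ℕ allThin (suc R) M (f ∘ drop)

  allThin≤1 : ∀ {R M f} → (∀ T → f T ≤ 1) → allThin R M f ≤ 1
  allThin≤1 {zero}  {zero}  le = le done
  allThin≤1 {suc R} {zero}  le = s≤s z≤n
  allThin≤1 {zero}  {suc M} le = allThin≤1 (le ∘ drop)
  allThin≤1 {suc R} {suc M} le = ℕ.*-mono-≤ (allThin≤1 (le ∘ keep)) (allThin≤1 (le ∘ drop))

  allThin≤ : ∀ {R M f} → (∀ T → f T ≤ 1) → ∀ T → allThin R M f ≤ f T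
  allThin≤ le done = ℕ.≤-refl
  allThin≤ {f = f} le (keep T) = ℕ.≤-trans (ℕ.*-mono-≤ (allThin≤ (le ∘ keep) T) (allThin≤1 (le ∘ drop))) (ℕ.≤-reflexive (ℕ.*-identityʳ (f (keep T))))
  allThin≤ {zero}  le (drop T) = allThin≤ (le ∘ drop) T
  allThin≤ {suc R} {f = f} le (drop T) = ℕ.≤-trans (ℕ.*-mono-≤ (allThin≤1 (le ∘ keep)) (allThin≤ (le ∘ drop) T)) (ℕ.≤-reflexive (ℕ.*-identityˡ (f (drop T))))

  allThin-one : ∀ R M {f} → (∀ T → f T ≡ 1) → allThin R M f ≡ 1
  allThin-one zero    zero    eq = eq done
  allThin-one (suc R) zero    eq = refl
  allThin-one zero    (suc M) eq = allThin-one zero M (eq ∘ drop)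
  allThin-one (suc R) (suc M) eq = cong₂ _*ℕ_ (allThin-one R M (eq ∘ keep)) (allThin-one (suc R) M (eq ∘ drop))

  someThin : ∀ R M {P Q : Thin R M → Set} → (∀ T → P T ⊎ Q T) → (∀ T → P T) ⊎ (∃[ T ] Q T)
  someThin zero zero dec with dec done
  ... | inj₁ p = inj₁ λ { done → p }
  ... | inj₂ q = inj₂ (done , q)
  someThin (suc R) zero dec = inj₁ λ ()
  someThin zero (suc M) dec with someThin zero M (dec ∘ drop)
  ... | inj₁ p = inj₁ λ { (drop T) → p T }
  ... | inj₂ (T , q) = inj₂ (drop T , q)
  someThin (suc R) (suc M) dec with someThin R M (dec ∘ keep) | someThin (suc R) M (dec ∘ drop)
  ... | inj₂ (T , q) | _ = inj₂ (keep T , q)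
  ... | inj₁ _ | inj₂ (T , q) = inj₂ (drop T , q)
  ... | inj₁ p | inj₁ p′ = inj₁ λ { (keep T) → p T ; (drop T) → p′ T }

  -- The points of K^M all of whose projections to R coordinates satisfy a nontrivial equation of degree < Δ
  -- in each variable form a set of dimension < R; it has at most dimConst Δ M R · q^(R-1) points.
  dimConst : ℕ → ℕ → ℕ → ℕ
  dimConst Δ M       zero    = 0
  dimConst Δ zero    (suc R) = 1
  dimConst Δ (suc M) (suc R) = Δ *ℕ dimConst Δ M (suc R) +ℕ dimConst Δ M R

  -- Δ times this bounds a cleared monomial: each of the N fractions contributes powers of numerator
  -- and denominator with 1 + Δ D coefficients each, and the 2 covers the constant monomial and a
  -- scalar. Pulling out Δ lets it be chosen after this number.
  degreeFactor : ℕ → ℕ → ℕ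
  degreeFactor D N = 2 +ℕ N *ℕ (2 +ℕ 2 *ℕ D)

  module MultiPoly {q : ℕ} (F : FiniteDomain q) (Δ : ℕ) where
    open Polynomials F
    open Algebra.Solver.Ring.NaturalCoefficients.Default (CommutativeRing.commutativeSemiring ring) using (solve; _:*_; _:=_)

    Coefs : ℕ → Set
    Coefs N = Fin (Δ ^ℕ N) → K

    NonZero : ∀ N → Coefs N → Set
    NonZero N Q = ∃[ j ] Q j ≢ 0#

    slice : ∀ N → Coefs (suc N) → Fin Δ → Coefs N
    slice N Q i e = Q (combine i e)

    mono : ∀ N → Fin (Δ ^ℕ N) → Vec K N → K
    mono zero    e []      = 1#
    mono (suc N) e (x ∷ w) = pow x (toℕ (quotient {Δ} (Δ ^ℕ N) e)) * mono N (remainder {Δ} (Δ ^ℕ N) e) w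

    pev : ∀ {N} → Coefs N → Vec K N → K
    pev {N} Q w = ∑ (λ e → Q e * mono N e w)

    ∑-split : ∀ m {n} (f : Fin (m +ℕ n) → K) → ∑ f ≡ ∑ (λ i → f (i ↑ˡ n)) + ∑ (λ j → f (m ↑ʳ j))
    ∑-split zero    f = sym (+-identityˡ _)
    ∑-split (suc m) f = trans (cong (f zero +_) (∑-split m (f ∘ suc))) (sym (+-assoc _ _ _))

    ∑-combine : ∀ m {n} (f : Fin (m *ℕ n) → K) → ∑ f ≡ ∑ (λ i → ∑ (λ j → f (combine {m} {n} i j)))
    ∑-combine zero        f = refl
    ∑-combine (suc m) {n} f = trans (∑-split n f) (cong (∑ (λ j → f (j ↑ˡ (m *ℕ n))) +_) (∑-combine m (λ i → f (n ↑ʳ i))))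

    ev-tabulate : ∀ {m} (g : Fin m → K) x → ev (tabulate g) x ≡ ∑ (λ i → g i * pow x (toℕ i))
    ev-tabulate {zero}  g x = refl
    ev-tabulate {suc m} g x = cong₂ _+_ (sym (*-identityʳ _)) (begin
      x * ev (tabulate (g ∘ suc)) x                      ≡⟨ cong (x *_) (ev-tabulate (g ∘ suc) x) ⟩
      x * ∑ (λ i → g (suc i) * pow x (toℕ i))            ≡⟨ *-distribˡ-sum x (λ i → g (suc i) * pow x (toℕ i)) ⟩
      ∑ (λ i → x * (g (suc i) * pow x (toℕ i)))          ≡⟨ sum-cong-≗ (λ i → rearrange x (g (suc i)) (pow x (toℕ i))) ⟩
      ∑ (λ i → g (suc i) * (x * pow x (toℕ i)))          ∎)
      where
      open ≡-Reasoning
      rearrange : ∀ x g p → x * (g * p) ≡ g * (x * p)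
      rearrange = solve 3 (λ x g p → x :* (g :* p) := g :* (x :* p)) refl

    pev-∷ : ∀ {N} (Q : Coefs (suc N)) x w → pev Q (x ∷ w) ≡ ev (tabulate (λ i → pev (slice N Q i) w)) x
    pev-∷ {N} Q x w = begin
      ∑ (λ e → Q e * mono (suc N) e (x ∷ w))
        ≡⟨ ∑-combine Δ (λ e → Q e * mono (suc N) e (x ∷ w)) ⟩
      ∑ (λ i → ∑ (λ e → slice N Q i e * mono (suc N) (combine i e) (x ∷ w)))
        ≡⟨ sum-cong-≗ (λ i → sum-cong-≗ λ e → trans
             (cong (slice N Q i e *_) (cong (λ (i , e) → pow x (toℕ i) * mono N e w) (Fin.remQuot-combine {Δ} i e)))
             (rearrange (slice N Q i e) (pow x (toℕ i)) (mono N e w))) ⟩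
      ∑ (λ i → ∑ (λ e → slice N Q i e * mono N e w * pow x (toℕ i)))
        ≡⟨ sum-cong-≗ (λ i → *-distribʳ-sum (pow x (toℕ i)) (λ e → slice N Q i e * mono N e w)) ⟨
      ∑ (λ i → pev (slice N Q i) w * pow x (toℕ i))
        ≡⟨ ev-tabulate (λ i → pev (slice N Q i) w) x ⟨
      ev (tabulate (λ i → pev (slice N Q i) w)) x ∎
      where
      open ≡-Reasoning
      rearrange : ∀ a p m → a * (p * m) ≡ a * m * p
      rearrange = solve 3 (λ a p m → a :* (p :* m) := a :* m :* p) refl

    -- The coefficient, a polynomial in the last R variables, of the monomial in the first s
    -- variables whose exponents are the leading digits of `j`.
    leaf : ∀ s R → Coefs (s +ℕ R) → Fin (Δ ^ℕ (s +ℕ R)) → Coefs R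
    leaf zero    R Q j = Q
    leaf (suc s) R Q j = leaf s R (slice (s +ℕ R) Q (quotient {Δ} (Δ ^ℕ (s +ℕ R)) j)) (remainder {Δ} (Δ ^ℕ (s +ℕ R)) j)

    leaf-nonZero : ∀ s R (Q : Coefs (s +ℕ R)) j → Q j ≢ 0# → NonZero R (leaf s R Q j)
    leaf-nonZero zero    R Q j Qj≢0 = j , Qj≢0
    leaf-nonZero (suc s) R Q j Qj≢0 = leaf-nonZero s R _ _ λ eq → Qj≢0 (trans (cong Q (sym (Fin.combine-remQuot {Δ} (Δ ^ℕ (s +ℕ R)) j))) eq)

    -- Zeros at Δ distinct values of the first variable kill all Δ coefficients with respect to it,
    -- for each choice of the other variables; s rounds of this isolate the leaf.
    leaf-vanish : ∀ s R (Q : Coefs (s +ℕ R)) j (U : Fin s → Fin Δ → K) → (∀ p → Injective _≡_ _≡_ (U p)) → (w : Vec K R) →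
                  (∀ (τ : Fin s → Fin Δ) → pev Q (Vec.tabulate (λ p → U p (τ p)) ++ w) ≡ 0#) → pev (leaf s R Q j) w ≡ 0#
    leaf-vanish zero    R Q j U inj w zs = zs λ ()
    leaf-vanish (suc s) R Q j U inj w zs = leaf-vanish s R _ _ (U ∘ suc) (inj ∘ suc) w λ τ →
      All.tabulate⁻ {f = λ i → pev (slice (s +ℕ R) Q i) (Vec.tabulate (λ p → U (suc p) (τ p)) ++ w)}
        (manyRoots _ (U zero) (inj zero) (ℕ.≤-reflexive (List.length-tabulate {n = Δ} _)) λ i →
          trans (sym (pev-∷ {s +ℕ R} Q (U zero i) (Vec.tabulate (λ p → U (suc p) (τ p)) ++ w))) (zs (i Vector.∷ τ)))
        (quotient {Δ} (Δ ^ℕ (s +ℕ R)) j)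

    nonZero-slice : ∀ N (Q : Coefs (suc N)) → NonZero (suc N) Q → ∃[ i ] NonZero N (slice N Q i)
    nonZero-slice N Q (j , Qj≢0) = quotient {Δ} (Δ ^ℕ N) j , remainder {Δ} (Δ ^ℕ N) j ,
      λ eq → Qj≢0 (trans (cong Q (sym (Fin.combine-remQuot {Δ} (Δ ^ℕ N) j))) eq)

    Equations : ℕ → ℕ → Set
    Equations R M = Thin R M → Σ (Coefs R) (NonZero R)

    solutionInd : ∀ {R M} → Equations R M → Vec K M → ℕ
    solutionInd {R} {M} P v = allThin R M (λ T → isZero (pev (proj₁ (P T)) (select T v)))

    q≥1 : 1 ≤ q
    q≥1 = inhabited 0#
      where
      inhabited : ∀ {n} → Fin n → 1 ≤ n
      inhabited {suc n} _ = s≤s z≤n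

    vecSumK : ∀ M → (Vec K M → ℕ) → ℕ
    vecSumK = vecSum (finSummation q)

    -- Over a fixed rest `v`, every equation involving the first coordinate is expanded in it, and
    -- one nonzero coefficient is kept. If all kept coefficients vanish at `v`, then `v` lies in a
    -- set of smaller dimension and the first coordinate is free; otherwise it has at most Δ values,
    -- and `v` still satisfies the equations without it. This is the recursion of `dimConst`. For R
    -- = 0 nonzero constants have no zeros.
    solutionCount : ∀ M R (P : Equations R M) → q *ℕ vecSumK M (solutionInd P) ≤ dimConst Δ M R *ℕ q ^ℕ R
    solutionCount M zero P = ℕ.≤-reflexive (trans (cong (q *ℕ_) none) (ℕ.*-zeroʳ q))
      where
      constant : ∀ (Q : Coefs 0) → NonZero 0 Q → pev Q [] ≢ 0#
      constant Q (zero , Q≢0) eq = Q≢0 (trans (sym (trans (+-identityʳ _) (*-identityʳ _))) eq)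
      noPoint : ∀ v → solutionInd P v ≤ 0
      noPoint v = ℕ.≤-trans (allThin≤ (λ T → isZero≤1 _) (dropAll M)) (ℕ.≤-reflexive (isZero-no (lemma (select (dropAll M) v))))
        where
        lemma : ∀ w → pev (proj₁ (P (dropAll M))) w ≢ 0#
        lemma [] = constant _ (proj₂ (P (dropAll M)))
      none : vecSumK M (solutionInd P) ≡ 0
      none = ℕ.n≤0⇒n≡0 (ℕ.≤-trans (Additive.T-mono (vecSum-additive (finSummation q) M) noPoint)
                                  (ℕ.≤-reflexive (Additive.T-zero (vecSum-additive (finSummation q) M))))
    solutionCount zero (suc R) P = begin
      q *ℕ 1                ≤⟨ ℕ.*-monoʳ-≤ q (ℕ.m^n>0 q {{ℕ.>-nonZero q≥1}} R) ⟩
      q *ℕ q ^ℕ R           ≡⟨ ℕ.+-identityʳ _ ⟨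
      1 *ℕ q ^ℕ suc R       ∎
      where
      open ℕ.≤-Reasoning
      import Data.Nat as ℕ using (>-nonZero)
    solutionCount (suc M) (suc R) P = begin
      q *ℕ ∑ℕ (λ x → vecSumK M (λ v → solutionInd P (x ∷ v)))
        ≡⟨ cong (q *ℕ_) (Summation.S-fubini (finSummation q) Vs (λ x v → solutionInd P (x ∷ v))) ⟩
      q *ℕ vecSumK M (λ v → ∑ℕ (λ x → solutionInd P (x ∷ v)))
        ≤⟨ ℕ.*-monoʳ-≤ q (Additive.T-mono Vs fibre) ⟩
      q *ℕ vecSumK M (λ v → Δ *ℕ solutionInd Pdrop v +ℕ q *ℕ solutionInd Pkeep v)
        ≡⟨ cong (q *ℕ_) (trans (Additive.T-+ Vs _ _) (cong₂ _+ℕ_ (Additive.T-scale Vs Δ _) (Additive.T-scale Vs q _))) ⟩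
      q *ℕ (Δ *ℕ vecSumK M (solutionInd Pdrop) +ℕ q *ℕ vecSumK M (solutionInd Pkeep))
        ≡⟨ r₁ q Δ (vecSumK M (solutionInd Pdrop)) (vecSumK M (solutionInd Pkeep)) ⟩
      Δ *ℕ (q *ℕ vecSumK M (solutionInd Pdrop)) +ℕ q *ℕ (q *ℕ vecSumK M (solutionInd Pkeep))
        ≤⟨ ℕ.+-mono-≤ (ℕ.*-monoʳ-≤ Δ (solutionCount M (suc R) Pdrop)) (ℕ.*-monoʳ-≤ q (solutionCount M R Pkeep)) ⟩
      Δ *ℕ (dimConst Δ M (suc R) *ℕ q ^ℕ suc R) +ℕ q *ℕ (dimConst Δ M R *ℕ q ^ℕ R)
        ≡⟨ r₂ q Δ (dimConst Δ M (suc R)) (dimConst Δ M R) (q ^ℕ R) ⟩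
      dimConst Δ (suc M) (suc R) *ℕ q ^ℕ suc R ∎
      where
      open ℕ.≤-Reasoning
      Vs = vecSum-additive (finSummation q) M
      r₁ : ∀ q Δ a b → q *ℕ (Δ *ℕ a +ℕ q *ℕ b) ≡ Δ *ℕ (q *ℕ a) +ℕ q *ℕ (q *ℕ b)
      r₁ = ℕ.solve-∀
      r₂ : ∀ q Δ a b Q → Δ *ℕ (a *ℕ (q *ℕ Q)) +ℕ q *ℕ (b *ℕ Q) ≡ (Δ *ℕ a +ℕ b) *ℕ (q *ℕ Q)
      r₂ = ℕ.solve-∀
      Pdrop : Equations (suc R) M
      Pdrop T = P (drop T)
      Pkeep : Equations R M
      Pkeep T = let i , nz = nonZero-slice R (proj₁ (P (keep T))) (proj₂ (P (keep T))) in slice R (proj₁ (P (keep T))) i , nz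
      head : K → Vec K M → ℕ
      head x v = allThin R M (λ T → isZero (pev (proj₁ (P (keep T))) (x ∷ select T v)))
      head≤1 : ∀ x v → head x v ≤ 1
      head≤1 x v = allThin≤1 {R} {M} (λ T → isZero≤1 _)
      rest≤1 : ∀ v → solutionInd Pdrop v ≤ 1
      rest≤1 v = allThin≤1 {suc R} {M} (λ T → isZero≤1 _)
      fibre : ∀ v → ∑ℕ (λ x → solutionInd P (x ∷ v)) ≤ Δ *ℕ solutionInd Pdrop v +ℕ q *ℕ solutionInd Pkeep v
      fibre v with someThin R M {λ T → pev (proj₁ (Pkeep T)) (select T v) ≡ 0#} {λ T → pev (proj₁ (Pkeep T)) (select T v) ≢ 0#}
                    (λ T → dec (pev (proj₁ (Pkeep T)) (select T v)))
        where
        dec : ∀ x → x ≡ 0# ⊎ x ≢ 0#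
        dec x with x ≟ 0#
        ... | yes eq = inj₁ eq
        ... | no neq = inj₂ neq
      ... | inj₁ all = begin
        ∑ℕ (λ x → head x v *ℕ solutionInd Pdrop v)   ≤⟨ ∑-mono (λ x → ℕ.*-mono-≤ (head≤1 x v) (rest≤1 v)) ⟩
        ∑ℕ {q} (λ x → 1)                             ≡⟨ ∑-const q 1 ⟩
        q *ℕ 1                                       ≡⟨ cong (q *ℕ_) (allThin-one R M (λ T → isZero-yes (all T))) ⟨
        q *ℕ solutionInd Pkeep v                     ≤⟨ ℕ.m≤n+m _ _ ⟩
        Δ *ℕ solutionInd Pdrop v +ℕ q *ℕ solutionInd Pkeep v ∎
      ... | inj₂ (T , nz) = begin
        ∑ℕ (λ x → head x v *ℕ solutionInd Pdrop v)   ≤⟨ ∑-mono (λ x → ℕ.*-monoˡ-≤ (solutionInd Pdrop v) (head≤ x)) ⟩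
        ∑ℕ (λ x → isZero (pev Q (x ∷ select T v)) *ℕ solutionInd Pdrop v)
          ≡⟨ Summation.S-cong (finSummation q) (λ x → trans (ℕ.*-comm _ (solutionInd Pdrop v)) (cong (λ y → solutionInd Pdrop v *ℕ isZero y) (pev-∷ {R} Q x (select T v)))) ⟩
        ∑ℕ (λ x → solutionInd Pdrop v *ℕ isZero (ev as x)) ≡⟨ Summation.S-scale (finSummation q) (solutionInd Pdrop v) (λ x → isZero (ev as x)) ⟩
        solutionInd Pdrop v *ℕ ∑ℕ (λ x → isZero (ev as x)) ≤⟨ ℕ.*-monoʳ-≤ (solutionInd Pdrop v) (rootCount as id id λ zs → nz (All.tabulate⁻ zs _)) ⟩
        solutionInd Pdrop v *ℕ length as             ≡⟨ ℕ.*-comm (solutionInd Pdrop v) (length as) ⟩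
        length as *ℕ solutionInd Pdrop v             ≡⟨ cong (_*ℕ solutionInd Pdrop v) (List.length-tabulate {n = Δ} _) ⟩
        Δ *ℕ solutionInd Pdrop v                     ≤⟨ ℕ.m≤m+n _ _ ⟩
        Δ *ℕ solutionInd Pdrop v +ℕ q *ℕ solutionInd Pkeep v ∎
        where
        Q = proj₁ (P (keep T))
        head≤ : ∀ x → head x v ≤ isZero (pev Q (x ∷ select T v))
        head≤ x = allThin≤ {f = λ T → isZero (pev (proj₁ (P (keep T))) (x ∷ select T v))} (λ T → isZero≤1 _) T
        as = tabulate (λ i → pev (slice R Q i) (select T v))

    -- The monomial e at the fractions num / den, with denominators cleared by the product of all den ^ Δ.
    hmono : ∀ {n D} N → Fin (Δ ^ℕ N) → Vec (Frac n D) N → Vec K n → K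
    hmono zero    e []       z = 1#
    hmono (suc N) e (f ∷ fs) z =
      (pow (fun (num f) z) i * pow (fun (den f) z) (Δ ∸ i)) * hmono N (remainder {Δ} (Δ ^ℕ N) e) fs z
      where i = toℕ (quotient {Δ} (Δ ^ℕ N) e)

    scale : ∀ {n D N} → Vec (Frac n D) N → Vec K n → K
    scale []       z = 1#
    scale (f ∷ fs) z = pow (fun (den f) z) Δ * scale fs z

    pow-≢0 : ∀ {x} n → x ≢ 0# → pow x n ≢ 0#
    pow-≢0 zero    x≢0 = 1≢0
    pow-≢0 (suc n) x≢0 = *-≢0 x≢0 (pow-≢0 n x≢0)

    scale-≢0 : ∀ {n D N z} {fs : Vec (Frac n D) N} {w} → Reps z fs w → scale fs z ≢ 0#
    scale-≢0 []              = 1≢0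
    scale-≢0 ((b≢0 , _) ∷ r) = *-≢0 (pow-≢0 Δ b≢0) (scale-≢0 r)

    pow-+ : ∀ x m n → pow x (m +ℕ n) ≡ pow x m * pow x n
    pow-+ x zero    n = sym (*-identityˡ _)
    pow-+ x (suc m) n = trans (cong (x *_) (pow-+ x m n)) (sym (*-assoc x _ _))

    pow-* : ∀ x y n → pow (x * y) n ≡ pow x n * pow y n
    pow-* x y zero    = sym (*-identityˡ _)
    pow-* x y (suc n) = trans (cong (x * y *_) (pow-* x y n)) (rearrange x y (pow x n) (pow y n))
      where
      rearrange : ∀ x y a b → x * y * (a * b) ≡ x * a * (y * b)
      rearrange = solve 4 (λ x y a b → x :* y :* (a :* b) := x :* a :* (y :* b)) refl

    hmono-mono : ∀ {n D} N e {z} {fs : Vec (Frac n D) N} {w} → Reps z fs w → hmono N e fs z ≡ scale fs z * mono N e w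
    hmono-mono zero    e [] = sym (*-identityˡ _)
    hmono-mono (suc N) e {z} (_∷_ {f = f} {a = a} {fs} {w} (_ , eq) r) = begin
      (pow (fun (num f) z) i * pow b (Δ ∸ i)) * hmono N e′ fs z
        ≡⟨ cong₂ _*_ (cong (λ y → pow y i * pow b (Δ ∸ i)) eq) (hmono-mono N e′ r) ⟩
      (pow (a * b) i * pow b (Δ ∸ i)) * (scale fs z * mono N e′ w)
        ≡⟨ cong (λ y → y * pow b (Δ ∸ i) * (scale fs z * mono N e′ w)) (pow-* a b i) ⟩
      (pow a i * pow b i * pow b (Δ ∸ i)) * (scale fs z * mono N e′ w)
        ≡⟨ rearrange (pow a i) (pow b i) (pow b (Δ ∸ i)) (scale fs z) (mono N e′ w) ⟩
      (pow b i * pow b (Δ ∸ i)) * scale fs z * (pow a i * mono N e′ w)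
        ≡⟨ cong (λ y → y * scale fs z * (pow a i * mono N e′ w)) (trans (sym (pow-+ b i (Δ ∸ i))) (cong (pow b) (ℕ.m+[n∸m]≡n (ℕ.<⇒≤ (Fin.toℕ<n (quotient {Δ} (Δ ^ℕ N) e)))))) ⟩
      pow b Δ * scale fs z * (pow a i * mono N e′ w) ∎
      where
      open ≡-Reasoning
      i = toℕ (quotient {Δ} (Δ ^ℕ N) e)
      e′ = remainder {Δ} (Δ ^ℕ N) e
      b = fun (den f) z
      rearrange : ∀ a b c s m → (a * b * c) * (s * m) ≡ (b * c) * s * (a * m)
      rearrange = solve 5 (λ a b c s m → (a :* b :* c) :* (s :* m) := (b :* c) :* s :* (a :* m)) refl

    hmono-sep : ∀ {n D} N e (fs : Vec (Frac n D) N) → SepPoly n (suc (N *ℕ (2 +ℕ 2 *ℕ (Δ *ℕ D)))) (hmono N e fs)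
    hmono-sep zero    e []       = sep-const 1#
    hmono-sep {n} {D} (suc N) e (f ∷ fs) = sep-weaken (ℕ.≤-reflexive (r (Δ *ℕ D) (N *ℕ (2 +ℕ 2 *ℕ (Δ *ℕ D)))))
      (sep-* (sep-* (sep-weaken (s≤s (ℕ.*-monoˡ-≤ D (ℕ.<⇒≤ (Fin.toℕ<n i)))) (sep-pow (toℕ i) (isPoly (num f))))
                    (sep-weaken (s≤s (ℕ.*-monoˡ-≤ D (ℕ.m∸n≤m Δ (toℕ i)))) (sep-pow (Δ ∸ toℕ i) (isPoly (den f)))))
             (hmono-sep N (remainder {Δ} (Δ ^ℕ N) e) fs))
      where
      i = quotient {Δ} (Δ ^ℕ N) e
      r : ∀ x y → (1 +ℕ x) +ℕ (1 +ℕ x) +ℕ (1 +ℕ y) ≡ 1 +ℕ ((2 +ℕ 2 *ℕ x) +ℕ y)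
      r = ℕ.solve-∀

    -- The Δ^(n+1) monomials in the n + 1 functions become, after clearing denominators, polynomials in n variables
    -- of degree < Δ · degreeFactor; these are determined by their values on a grid, and the grid has fewer points.
    relation : ∀ {n D} (fs : Vec (Frac n D) (suc n)) → degreeFactor D (suc n) ^ℕ n < Δ →
               (g : Fin (Δ *ℕ degreeFactor D (suc n)) → K) → Injective _≡_ _≡_ g →
               Σ (Coefs (suc n)) λ Q → NonZero (suc n) Q × (∀ z w → Reps z fs w → pev Q w ≡ 0#)
    relation {n} {D} fs large g g-inj = Q , nz , λ z w r →
      *-cancel-0 (scale-≢0 r) (begin
        scale fs z * pev Q w                                 ≡⟨ *-distribˡ-sum (scale fs z) (λ e → Q e * mono (suc n) e w) ⟩
        ∑ (λ e → scale fs z * (Q e * mono (suc n) e w))      ≡⟨ sum-cong-≗ (λ e → trans (rearrange (scale fs z) (Q e) _) (cong (Q e *_) (sym (hmono-mono (suc n) e r)))) ⟩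
        f z                                                  ≡⟨ vanish n f-sep sol z ⟩
        0#                                                   ∎)
      where
      open ≡-Reasoning
      E = degreeFactor D (suc n)
      d = Δ *ℕ E
      open Grid {d} g g-inj
      rearrange : ∀ a b c → a * (b * c) ≡ b * (a * c)
      rearrange = solve 3 (λ a b c → a :* (b :* c) := b :* (a :* c)) refl
      -- (Δ E)^n = Δ^n E^n, so E^n < Δ leaves fewer grid points than monomials, that is, fewer
      -- linear conditions than unknown coefficients.
      d^n<Δ^1+n : d ^ℕ n < Δ ^ℕ suc n
      d^n<Δ^1+n = ℕ.≤-<-trans (ℕ.≤-reflexive (^-distribʳ-* n Δ E))
        (ℕ.<-≤-trans (ℕ.*-monoʳ-< (Δ ^ℕ n) {{ℕ.m^n≢0 Δ n {{Δ≢0}}}} large) (ℕ.≤-reflexive (ℕ.*-comm (Δ ^ℕ n) Δ)))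
        where
        import Data.Nat as ℕ using (NonZero; >-nonZero)
        Δ≢0 : ℕ.NonZero Δ
        Δ≢0 = ℕ.>-nonZero (ℕ.≤-<-trans z≤n large)
      K′ = kernel (Δ ^ℕ suc n) (d ^ℕ n) (λ β e → hmono (suc n) e fs (gridPoint n β)) d^n<Δ^1+n
      Q = proj₁ K′
      nz = proj₁ (proj₂ K′)
      sol = proj₂ (proj₂ K′)
      f : Vec K n → K
      f z = ∑ (λ e → Q e * hmono (suc n) e fs z)
      degree : 2 +ℕ suc n *ℕ (2 +ℕ 2 *ℕ (Δ *ℕ D)) ≤ d
      degree = bound Δ (ℕ.≤-<-trans z≤n large)
        where
        bound : ∀ Δ → 0 < Δ → 2 +ℕ suc n *ℕ (2 +ℕ 2 *ℕ (Δ *ℕ D)) ≤ Δ *ℕ E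
        bound (suc δ) _ = ℕ.≤-trans (ℕ.m≤m+n _ (2 *ℕ δ +ℕ 2 *ℕ δ *ℕ suc n)) (ℕ.≤-reflexive (eq δ (suc n) D))
          where
          eq : ∀ δ N D → 2 +ℕ N *ℕ (2 +ℕ 2 *ℕ ((1 +ℕ δ) *ℕ D)) +ℕ (2 *ℕ δ +ℕ 2 *ℕ δ *ℕ N) ≡ (1 +ℕ δ) *ℕ (2 +ℕ N *ℕ (2 +ℕ 2 *ℕ D))
          eq = ℕ.solve-∀
      f-sep : SepPoly n d f
      f-sep = sep-∑ (ℕ.≤-trans (s≤s z≤n) degree) λ e → sep-weaken degree (sep-scale (Q e) (hmono-sep (suc n) e fs))

    Reps-++ : ∀ {n D M N z} {fs : Vec (Frac n D) M} {gs : Vec (Frac n D) N} {v w} → Reps z fs v → Reps z gs w → Reps z (fs ++ gs) (v ++ w)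
    Reps-++ []      s = s
    Reps-++ (x ∷ r) s = x ∷ Reps-++ r s

    Reps-select : ∀ {n D R M z} {fs : Vec (Frac n D) M} {v} (T : Thin R M) → Reps z fs v → Reps z (select T fs) (select T v)
    Reps-select done     []      = []
    Reps-select (keep T) (x ∷ r) = x ∷ Reps-select T r
    Reps-select (drop T) (x ∷ r) = Reps-select T r

    module Dependence {n D s R M : ℕ} (s+R≡1+n : s +ℕ R ≡ suc n)
      (us : Vec (Frac n D) s) (ws : Vec (Frac n D) M)
      (large : degreeFactor D (suc n) ^ℕ n < Δ)
      (g : Fin (Δ *ℕ degreeFactor D (suc n)) → K) (g-inj : Injective _≡_ _≡_ g) where

      dependence : ∀ {N} → N ≡ suc n → (fs : Vec (Frac n D) N) → Σ (Coefs N) λ Q → NonZero N Q × (∀ z w → Reps z fs w → pev Q w ≡ 0#)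
      dependence refl fs = relation fs large g g-inj

      -- A leaf through a nonzero coefficient `j` of the relation is nontrivial. It is built from
      -- the fractions alone, before any c is given, so that the solutions c can be counted
      -- afterwards.
      equations : Equations R M
      equations T = let Q , (j , Qj≢0) , _ = dependence s+R≡1+n (us ++ select T ws) in leaf s R Q j , leaf-nonZero s R Q j Qj≢0

      -- With c fixed, the relation between us and R of the ws vanishes on a grid of values of us, hence so do its
      -- coefficients with respect to us: this leaves a nontrivial equation in R coordinates of c alone.
      equations-hold : ∀ c (U : Fin s → Fin Δ → K) → (∀ p → Injective _≡_ _≡_ (U p)) →
                       (∀ (τ : Fin s → Fin Δ) → ∃[ z ] Reps z us (Vec.tabulate (λ p → U p (τ p))) × Reps z ws c) →
                       solutionInd equations c ≡ 1
      equations-hold c U U-inj points = allThin-one R M λ T → isZero-yes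
        (let Q , (j , _) , rel = dependence s+R≡1+n (us ++ select T ws) in
         leaf-vanish s R Q j U U-inj (select T c) λ τ →
           let z , r , r′ = points τ in rel z _ (Reps-++ r (Reps-select T r′)))

-- Paths and their edges, alternating between two sides.

module Walks where
  open import Data.Nat using (zero; suc)
  open import Data.Bool using (Bool; true; false; not; if_then_else_)
  open import Data.Fin using (Fin; zero; suc; inject₁)
  open import Function using (_∘_)

  lastOr : ∀ {X : Set} {m} → X → (Fin m → X) → Fin (suc m) → X
  lastOr {m = zero}  y f _       = y
  lastOr {m = suc m} y f zero    = f zero
  lastOr {m = suc m} y f (suc i) = lastOr y (f ∘ suc) i

  -- Polymorphic on purpose: one combinator lays out the vertices of a theta graph, their images and
  -- their coordinates as polynomials, and `path-rel` compares such layouts pointwise.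
  path : ∀ {X : Set} {m} → X → X → (Fin m → X) → Fin (suc (suc m)) → X
  path x y f zero    = x
  path x y f (suc i) = lastOr y f i

  lastOr-rel : ∀ {X Y : Set} (_~_ : X → Y → Set) {m x y} {f : Fin m → X} {g : Fin m → Y} →
               x ~ y → (∀ i → f i ~ g i) → ∀ i → lastOr x f i ~ lastOr y g i
  lastOr-rel _~_ {zero}  r rs _       = r
  lastOr-rel _~_ {suc m} r rs zero    = rs zero
  lastOr-rel _~_ {suc m} r rs (suc i) = lastOr-rel _~_ r (rs ∘ suc) i

  path-rel : ∀ {X Y : Set} (_~_ : X → Y → Set) {m x y x′ y′} {f : Fin m → X} {g : Fin m → Y} →
             x ~ x′ → y ~ y′ → (∀ i → f i ~ g i) → ∀ i → path x y f i ~ path x′ y′ g i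
  path-rel _~_ r r′ rs zero    = r
  path-rel _~_ r r′ rs (suc i) = lastOr-rel _~_ r′ rs i

  side : ∀ {n} → Bool → Fin n → Bool
  side σ zero    = σ
  side σ (suc i) = side (not σ) i

  -- The left and the right end of the e-th edge of a path that starts on side σ (true = left).
  left right : ∀ {X : Set} {n} → Bool → Fin n → (Fin (suc n) → X) → X
  left  σ e w = if side σ e then w (inject₁ e) else w (suc e)
  right σ e w = if side σ e then w (suc e) else w (inject₁ e)

  left-rel : ∀ {X Y : Set} (_~_ : X → Y → Set) {n} σ (e : Fin n) {w : Fin (suc n) → X} {w′ : Fin (suc n) → Y} →
             (∀ i → w i ~ w′ i) → left σ e w ~ left σ e w′
  left-rel _~_ σ e {w} {w′} r = lemma (side σ e)
    where
    lemma : ∀ b → (if b then w (inject₁ e) else w (suc e)) ~ (if b then w′ (inject₁ e) else w′ (suc e))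
    lemma true  = r _
    lemma false = r _

  right-rel : ∀ {X Y : Set} (_~_ : X → Y → Set) {n} σ (e : Fin n) {w : Fin (suc n) → X} {w′ : Fin (suc n) → Y} →
              (∀ i → w i ~ w′ i) → right σ e w ~ right σ e w′
  right-rel _~_ σ e {w} {w′} r = lemma (side σ e)
    where
    lemma : ∀ b → (if b then w (suc e) else w (inject₁ e)) ~ (if b then w′ (suc e) else w′ (inject₁ e))
    lemma true  = r _
    lemma false = r _

-- Bipartite graphs padded by isolated vertices, and theta graphs in them.

module BipartiteGraphs where
  open import Data.Nat using (ℕ; zero; suc; _+_; _*_; _≤_; _<_; _<ᵇ_)
  import Data.Nat.Properties as ℕ
  import Data.Nat.ListAction as List
  open import Data.Bool using (Bool; true; false; not; if_then_else_; _∧_; T)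
  open import Data.Fin using (Fin; zero; suc; toℕ; inject₁; fromℕ; splitAt; _↑ˡ_; _↑ʳ_)
  import Data.Fin.Properties as Fin
  open import Data.List using (map; allFin; tabulate)
  import Data.List.Properties as List
  import Data.Vec.Functional as Vector
  open import Data.Product using (Σ; _×_; _,_; proj₁; proj₂; ∃-syntax)
  open import Data.Sum using (_⊎_; inj₁; inj₂; map₂)
  open import Data.Maybe using (Maybe; just; nothing)
  open import Data.Maybe.Properties using (just-injective)
  open import Data.Empty using (⊥-elim)
  open import Function using (_∘_; id)
  open import Function.Definitions using (Injective)
  open import Relation.Binary.PropositionalEquality

  open Counting
  open Walks

  lastOr-self : ∀ {X : Set} {m} (g : Fin (suc m) → X) i → lastOr (g (fromℕ m)) (g ∘ inject₁) i ≡ g i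
  lastOr-self {m = zero}  g zero    = refl
  lastOr-self {m = suc m} g zero    = refl
  lastOr-self {m = suc m} g (suc i) = lastOr-self (g ∘ suc) i

  path-self : ∀ {X : Set} {m} (g : Fin (suc (suc m)) → X) i → path (g zero) (g (fromℕ (suc m))) (g ∘ suc ∘ inject₁) i ≡ g i
  path-self g zero    = refl
  path-self g (suc i) = lastOr-self (g ∘ suc) i

  lastOr-inject₁ : ∀ {X : Set} {m} (y : X) (f : Fin m → X) i → lastOr y f (inject₁ i) ≡ f i
  lastOr-inject₁ {m = suc m} y f zero    = refl
  lastOr-inject₁ {m = suc m} y f (suc i) = lastOr-inject₁ y (f ∘ suc) i

  lastOr-zero : ∀ {m} → 0 < m → Σ (Fin m) λ i → toℕ i ≡ 0 × (∀ {X : Set} (y : X) (f : Fin m → X) → lastOr y f zero ≡ f i)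
  lastOr-zero {suc m} _ = zero , refl , λ _ _ → refl

  lastOr-cases : ∀ {X : Set} {m} (y : X) (f : Fin m → X) i →
                 (toℕ i ≡ m × lastOr y f i ≡ y) ⊎ (∃[ i′ ] toℕ i′ ≡ toℕ i × lastOr y f i ≡ f i′)
  lastOr-cases {m = zero}  y f zero    = inj₁ (refl , refl)
  lastOr-cases {m = suc m} y f zero    = inj₂ (zero , refl , refl)
  lastOr-cases {m = suc m} y f (suc i) with lastOr-cases y (f ∘ suc) i
  ... | inj₁ (eq , eq′)      = inj₁ (cong suc eq , eq′)
  ... | inj₂ (i′ , eq , eq′) = inj₂ (suc i′ , cong suc eq , eq′)

  side-inject₁ : ∀ {n} σ (e : Fin n) → side σ (inject₁ e) ≡ side σ e
  side-inject₁ σ zero    = refl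
  side-inject₁ σ (suc e) = side-inject₁ (not σ) e

  side-suc : ∀ {n} σ (e : Fin n) → side (not σ) e ≡ not (side σ e)
  side-suc σ zero    = refl
  side-suc σ (suc e) = side-suc (not σ) e

  listSum-allFin : ∀ n (f : Fin n → ℕ) → List.sum (map f (allFin n)) ≡ ∑ f
  listSum-allFin n f = trans (cong List.sum (List.map-tabulate id f)) (lemma n f)
    where
    lemma : ∀ n (f : Fin n → ℕ) → List.sum (tabulate f) ≡ ∑ f
    lemma zero    f = refl
    lemma (suc n) f = cong (f zero +_) (lemma n (f ∘ suc))

  module Bipartite {a : ℕ} (E : Fin a → Fin a → Bool) (r : ℕ) where

    -- Left vertices, right vertices, and r isolated ones that bring the number of vertices to a
    -- prescribed n.
    Split : Set
    Split = Fin a ⊎ (Fin a ⊎ Fin r)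

    split : Fin (a + (a + r)) → Split
    split v = map₂ (splitAt a) (splitAt a v)

    splitAdj : Split → Split → Bool
    splitAdj (inj₁ P)        (inj₂ (inj₁ L)) = E P L
    splitAdj (inj₂ (inj₁ L)) (inj₁ P)        = E P L
    splitAdj _               _               = false

    splitAdj-sym : ∀ u v → splitAdj u v ≡ splitAdj v u
    splitAdj-sym (inj₁ _)        (inj₁ _)        = refl
    splitAdj-sym (inj₁ _)        (inj₂ (inj₁ _)) = refl
    splitAdj-sym (inj₁ _)        (inj₂ (inj₂ _)) = refl
    splitAdj-sym (inj₂ (inj₁ _)) (inj₁ _)        = refl
    splitAdj-sym (inj₂ (inj₁ _)) (inj₂ (inj₁ _)) = refl
    splitAdj-sym (inj₂ (inj₁ _)) (inj₂ (inj₂ _)) = refl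
    splitAdj-sym (inj₂ (inj₂ _)) (inj₁ _)        = refl
    splitAdj-sym (inj₂ (inj₂ _)) (inj₂ (inj₁ _)) = refl
    splitAdj-sym (inj₂ (inj₂ _)) (inj₂ (inj₂ _)) = refl

    splitAdj-irrefl : ∀ u → splitAdj u u ≡ false
    splitAdj-irrefl (inj₁ _)        = refl
    splitAdj-irrefl (inj₂ (inj₁ _)) = refl
    splitAdj-irrefl (inj₂ (inj₂ _)) = refl

    graph : Graph (a + (a + r))
    graph = record
      { adj    = λ u v → splitAdj (split u) (split v)
      ; sym    = λ u v → splitAdj-sym (split u) (split v)
      ; irrefl = λ u → splitAdj-irrefl (split u)
      }

    vertex : Bool → Fin a → Fin (a + (a + r))
    vertex true  P = P ↑ˡ (a + r)
    vertex false L = a ↑ʳ (L ↑ˡ r)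

    split-left : ∀ P → split (vertex true P) ≡ inj₁ P
    split-left P = cong (map₂ (splitAt a)) (Fin.splitAt-↑ˡ a P (a + r))

    split-right : ∀ L → split (vertex false L) ≡ inj₂ (inj₁ L)
    split-right L = trans (cong (map₂ (splitAt a)) (Fin.splitAt-↑ʳ a (a + r) (L ↑ˡ r))) (cong inj₂ (Fin.splitAt-↑ˡ a L r))

    vertex-injective : ∀ σ {x y} → vertex σ x ≡ vertex σ y → x ≡ y
    vertex-injective true  eq = Fin.↑ˡ-injective (a + r) _ _ eq
    vertex-injective false eq = Fin.↑ˡ-injective r _ _ (Fin.↑ʳ-injective a _ _ eq)

    fromSplit : ∀ u v → splitAdj (split u) (split v) ≡ true → ∃[ σ ] ∃[ x ] u ≡ vertex σ x
    fromSplit u v eq with splitAt a u in p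
    ... | inj₁ P = true , P , sym (Fin.splitAt⁻¹-↑ˡ p)
    ... | inj₂ w with splitAt a w in p′
    ...   | inj₁ L = false , L , sym (trans (cong (a ↑ʳ_) (Fin.splitAt⁻¹-↑ˡ p′)) (Fin.splitAt⁻¹-↑ʳ p))
    fromSplit u v () | inj₂ w | inj₂ z

    Orient : Bool → Fin a → Fin a → Bool
    Orient true  x y = E x y
    Orient false x y = E y x

    adj-vertex : ∀ σ x σ′ y → adj graph (vertex σ x) (vertex σ′ y) ≡ true → σ′ ≡ not σ × Orient σ x y ≡ true
    adj-vertex true  x true  y eq rewrite split-left x  | split-left y with () ← eq
    adj-vertex true  x false y eq rewrite split-left x  | split-right y = refl , eq
    adj-vertex false x true  y eq rewrite split-right x | split-left y  = refl , eq
    adj-vertex false x false y eq rewrite split-right x | split-right y with () ← eq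

    -- `edges` counts a pair in the row of its smaller vertex. Left vertices precede right ones, so
    -- the rows of the left vertices already contribute d each.
    edges≥ : ∀ d (ν : Fin a → Fin d → Fin a) → (∀ P → Injective _≡_ _≡_ (ν P)) → (∀ P b → E P (ν P b) ≡ true) → a * d ≤ edges graph
    edges≥ d ν ν-inj ν-edge = begin
      a * d                                               ≡⟨ ∑-const a d ⟨
      ∑ {a} (λ _ → d)                                     ≤⟨ ∑-mono degree ⟩
      ∑ (λ P → ∑ (entry (vertex true P)))                 ≤⟨ ∑-injection (vertex true) (vertex-injective true) (λ u → ∑ (entry u)) ⟩
      ∑ (λ u → ∑ (entry u))                               ≡⟨ trans (Summation.S-cong (finSummation _) (λ u → sym (listSum-allFin _ (entry u))))
                                                                 (sym (listSum-allFin (a + (a + r)) (λ u → List.sum (map (entry u) (allFin (a + (a + r))))))) ⟩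
      edges graph                                         ∎
      where
      open ℕ.≤-Reasoning
      entry : Fin (a + (a + r)) → Fin (a + (a + r)) → ℕ
      entry u v = if (toℕ u <ᵇ toℕ v) ∧ adj graph u v then 1 else 0
      before : ∀ P L → toℕ (vertex true P) < toℕ (vertex false L)
      before P L = begin-strict
        toℕ (P ↑ˡ (a + r))      ≡⟨ Fin.toℕ-↑ˡ P (a + r) ⟩
        toℕ P                   <⟨ Fin.toℕ<n P ⟩
        a                       ≤⟨ ℕ.m≤m+n a _ ⟩
        a + toℕ (L ↑ˡ r)        ≡⟨ Fin.toℕ-↑ʳ a (L ↑ˡ r) ⟨
        toℕ (a ↑ʳ (L ↑ˡ r))     ∎
      present : ∀ P L → E P L ≡ true → entry (vertex true P) (vertex false L) ≡ 1
      present P L eq = cong₂ (λ x y → if x ∧ y then 1 else 0) (isTrue (ℕ.<⇒<ᵇ (before P L)))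
        (trans (cong₂ splitAdj (split-left P) (split-right L)) eq)
        where
        isTrue : ∀ {b} → T b → b ≡ true
        isTrue {true} _ = refl
      degree : ∀ P → d ≤ ∑ (entry (vertex true P))
      degree P = begin
        d                                                             ≡⟨ ℕ.*-identityʳ d ⟨
        d * 1                                                         ≡⟨ ∑-const d 1 ⟨
        ∑ {d} (λ _ → 1)                                               ≤⟨ ∑-mono (λ b → ℕ.≤-reflexive (sym (present P (ν P b) (ν-edge P b)))) ⟩
        ∑ (λ b → entry (vertex true P) (vertex false (ν P b)))        ≤⟨ ∑-injection (vertex false ∘ ν P) (ν-inj P ∘ vertex-injective false) (entry (vertex true P)) ⟩
        ∑ (entry (vertex true P))                                     ∎

    -- Adjacent vertices lie on opposite sides, so the side of the start determines the side at
    -- every position.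
    follow : ∀ {N} (w : Fin (suc N) → Fin (a + (a + r))) σ x → w zero ≡ vertex σ x →
             (∀ e → adj graph (w (inject₁ e)) (w (suc e)) ≡ true) →
             Σ (Fin (suc N) → Fin a) λ A → A zero ≡ x × (∀ i → w i ≡ vertex (side σ i) (A i))
    follow {zero}  w σ x eq adjs = (λ _ → x) , refl , λ { zero → eq }
    follow {suc N} w σ x eq adjs =
      let σ′ , y , eq′ = fromSplit (w (suc zero)) (w zero) (trans (Graph.sym graph (w (suc zero)) (w zero)) (adjs zero))
          σ′≡ , _ = adj-vertex σ x σ′ y (subst₂ (λ u v → adj graph u v ≡ true) eq eq′ (adjs zero))
          A , A0 , As = follow (w ∘ suc) (not σ) y (trans eq′ (cong (λ σ → vertex σ y) σ′≡)) (adjs ∘ suc)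
      in (x Vector.∷ A) , refl , λ { zero → eq ; (suc i) → As i }

    -- The form in which the algebra consumes a theta graph: disjointness enters through the fact
    -- that different pairs (path, position) give different edges.
    record ThetaCopy (k′ ℓ : ℕ) : Set where
      field
        σ        : Bool
        x y      : Fin a
        W        : Fin ℓ → Fin k′ → Fin a
        isEdge   : ∀ j e → E (left σ e (path x y (W j))) (right σ e (path x y (W j))) ≡ true
        distinct : ∀ j e j′ e′ → left σ e (path x y (W j)) ≡ left σ e′ (path x y (W j′)) →
                   right σ e (path x y (W j)) ≡ right σ e′ (path x y (W j′)) → (j , e) ≡ (j′ , e′)

    module _ {k′ ℓ : ℕ} (k′>0 : 0 < k′) where
      k : ℕ
      k = suc k′

      thetaPath : Fin ℓ → Fin (suc k) → ThetaV k ℓ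
      thetaPath j = path (inj₁ zero) (inj₁ (suc zero)) (λ i → inj₂ (j , i))

      thetaPath-step : ∀ j e → ThetaStep k ℓ (thetaPath j (inject₁ e)) (thetaPath j (suc e))
      thetaPath-step j zero    = let i , i≡0 , eq = lastOr-zero k′>0 in
        subst (ThetaStep k ℓ (inj₁ zero)) (sym (eq (inj₁ (suc zero)) (λ i → inj₂ (j , i)))) (start j i i≡0)
      thetaPath-step j (suc e) = subst (λ u → ThetaStep k ℓ u (thetaPath j (suc (suc e)))) (sym (lastOr-inject₁ _ _ e)) next
        where
        next : ThetaStep k ℓ (inj₂ (j , e)) (thetaPath j (suc (suc e)))
        next with lastOr-cases (inj₁ (suc zero)) (λ i → inj₂ (j , i)) (suc e)
        ... | inj₁ (eq , eq′)      = subst (ThetaStep k ℓ (inj₂ (j , e))) (sym eq′) (end j e eq)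
        ... | inj₂ (i′ , eq , eq′) = subst (ThetaStep k ℓ (inj₂ (j , e))) (sym eq′) (mid j e i′ eq)

      positionOf : ThetaV k ℓ → Fin (suc k)
      positionOf (inj₁ zero)    = zero
      positionOf (inj₁ (suc _)) = fromℕ k
      positionOf (inj₂ (j , i)) = suc (inject₁ i)

      positionOf-path : ∀ j i → positionOf (thetaPath j i) ≡ i
      positionOf-path j i = trans (path-rel (λ u v → positionOf u ≡ v) {x′ = zero} {y′ = fromℕ k} {g = suc ∘ inject₁} refl refl (λ _ → refl) i) (path-self id i)

      indexOf : ThetaV k ℓ → Maybe (Fin ℓ)
      indexOf (inj₁ _)       = nothing
      indexOf (inj₂ (j , _)) = just j

      -- In a path of length at least 2 every edge has an internal end, which carries the index of
      -- its path: the far end of edge 0, the near end of any other.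
      sameIndex : ∀ j j′ e → thetaPath j (inject₁ e) ≡ thetaPath j′ (inject₁ e) → thetaPath j (suc e) ≡ thetaPath j′ (suc e) → j ≡ j′
      sameIndex j j′ zero    _  eq = let i , _ , at = lastOr-zero k′>0 in
        just-injective (cong indexOf (trans (sym (at (inj₁ (suc zero)) (λ i → inj₂ (j , i)))) (trans eq (at (inj₁ (suc zero)) (λ i → inj₂ (j′ , i))))))
      sameIndex j j′ (suc e) eq _  = just-injective (cong indexOf (trans (sym (lastOr-inject₁ _ _ e)) (trans eq (lastOr-inject₁ _ _ e))))

      pathEdges-distinct : ∀ σ j e j′ e′ → left σ e (thetaPath j) ≡ left σ e′ (thetaPath j′) →
                           right σ e (thetaPath j) ≡ right σ e′ (thetaPath j′) → (j , e) ≡ (j′ , e′)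
      pathEdges-distinct σ j e j′ e′ = cases (side σ e) (side σ e′)
        where
        position≡ : ∀ {i i′} → thetaPath j i ≡ thetaPath j′ i′ → i ≡ i′
        position≡ {i} {i′} eq = trans (sym (positionOf-path j i)) (trans (cong positionOf eq) (positionOf-path j′ i′))
        aligned : thetaPath j (inject₁ e) ≡ thetaPath j′ (inject₁ e′) → thetaPath j (suc e) ≡ thetaPath j′ (suc e′) → (j , e) ≡ (j′ , e′)
        aligned p q = cong₂ _,_ (sameIndex j j′ e (subst (λ i → thetaPath j (inject₁ e) ≡ thetaPath j′ (inject₁ i)) (sym e≡e′) p)
                                                  (subst (λ i → thetaPath j (suc e) ≡ thetaPath j′ (suc i)) (sym e≡e′) q)) e≡e′
          where
          e≡e′ : e ≡ e′
          e≡e′ = Fin.inject₁-injective (position≡ {inject₁ e} {inject₁ e′} p)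
        -- Positions would have to satisfy both e = e′ + 1 and e + 1 = e′.
        crossed : thetaPath j (inject₁ e) ≡ thetaPath j′ (suc e′) → thetaPath j (suc e) ≡ thetaPath j′ (inject₁ e′) → (j , e) ≡ (j′ , e′)
        crossed p q = ⊥-elim (ℕ.<⇒≢ (ℕ.m≤n⇒m≤1+n ℕ.≤-refl) (trans
          (trans (sym (Fin.toℕ-inject₁ e′)) (sym (cong toℕ (position≡ {suc e} {inject₁ e′} q))))
          (cong suc (trans (sym (Fin.toℕ-inject₁ e)) (cong toℕ (position≡ {inject₁ e} {suc e′} p))))))
        cases : ∀ b b′ → (if b then thetaPath j (inject₁ e) else thetaPath j (suc e)) ≡ (if b′ then thetaPath j′ (inject₁ e′) else thetaPath j′ (suc e′)) →
                (if b then thetaPath j (suc e) else thetaPath j (inject₁ e)) ≡ (if b′ then thetaPath j′ (suc e′) else thetaPath j′ (inject₁ e′)) → (j , e) ≡ (j′ , e′)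
        cases true  true  p q = aligned p q
        cases true  false p q = crossed p q
        cases false true  p q = crossed q p
        cases false false p q = aligned q p

      -- The path `j₀` shows that the image of the first endpoint is not isolated, which fixes its
      -- side, and it names the image of the second; the other paths agree with it because they
      -- share both ends.
      thetaCopy : Fin ℓ → Contains graph (Theta k ℓ) → ThetaCopy k′ ℓ
      thetaCopy j₀ (f , f-inj , f-hom) = record
        { σ = σ₀ ; x = x₀ ; y = y₀ ; W = W
        ; isEdge = λ j e → trans (cong₂ E (leftWalk j e) (rightWalk j e)) (orient j e)
        ; distinct = λ j e j′ e′ p q → pathEdges-distinct σ₀ j e j′ e′
            (f-inj (trans (leftVertex j e) (trans (cong (vertex true) (trans (sym (leftWalk j e)) (trans p (leftWalk j′ e′)))) (sym (leftVertex j′ e′)))))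
            (f-inj (trans (rightVertex j e) (trans (cong (vertex false) (trans (sym (rightWalk j e)) (trans q (rightWalk j′ e′)))) (sym (rightVertex j′ e′)))))
        }
        where
        adjacent : ∀ j e → adj graph (f (thetaPath j (inject₁ e))) (f (thetaPath j (suc e))) ≡ true
        adjacent j e = f-hom _ _ (inj₁ (thetaPath-step j e))
        start₀ = fromSplit (f (inj₁ zero)) (f (thetaPath j₀ (suc zero))) (adjacent j₀ zero)
        σ₀ = proj₁ start₀
        x₀ = proj₁ (proj₂ start₀)
        followed : ∀ j → Σ (Fin (suc k) → Fin a) λ A → A zero ≡ x₀ × (∀ i → f (thetaPath j i) ≡ vertex (side σ₀ i) (A i))
        followed j = follow (f ∘ thetaPath j) σ₀ x₀ (proj₂ (proj₂ start₀)) (adjacent j)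
        A : Fin ℓ → Fin (suc k) → Fin a
        A j = proj₁ (followed j)
        A-vertex : ∀ j i → f (thetaPath j i) ≡ vertex (side σ₀ i) (A j i)
        A-vertex j = proj₂ (proj₂ (followed j))
        y₀ = A j₀ (fromℕ k)
        W : Fin ℓ → Fin k′ → Fin a
        W j i = A j (suc (inject₁ i))
        pathEnd : ∀ {X : Set} {m} (x y : X) (g : Fin m → X) → path x y g (fromℕ (suc m)) ≡ y
        pathEnd {m = zero}  x y g = refl
        pathEnd {m = suc m} x y g = pathEnd {m = m} x y (g ∘ suc)
        A-end : ∀ j → A j (fromℕ k) ≡ y₀
        A-end j = vertex-injective (side σ₀ (fromℕ k)) (trans (sym (A-vertex j (fromℕ k)))
          (trans (cong f (trans (pathEnd (inj₁ zero) (inj₁ (suc zero)) (λ i → inj₂ (j , i)))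
                             (sym (pathEnd (inj₁ zero) (inj₁ (suc zero)) (λ i → inj₂ (j₀ , i)))))) (A-vertex j₀ (fromℕ k))))
        walk : ∀ j i → path x₀ y₀ (W j) i ≡ A j i
        walk j i = trans (path-rel _≡_ (sym (proj₁ (proj₂ (followed j)))) (sym (A-end j)) (λ _ → refl) i) (path-self (A j) i)
        leftWalk : ∀ j e → left σ₀ e (path x₀ y₀ (W j)) ≡ left σ₀ e (A j)
        leftWalk j e = left-rel _≡_ σ₀ e {path x₀ y₀ (W j)} {A j} (walk j)
        rightWalk : ∀ j e → right σ₀ e (path x₀ y₀ (W j)) ≡ right σ₀ e (A j)
        rightWalk j e = right-rel _≡_ σ₀ e {path x₀ y₀ (W j)} {A j} (walk j)
        vertexAt : ∀ j e → f (thetaPath j (inject₁ e)) ≡ vertex (side σ₀ e) (A j (inject₁ e))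
        vertexAt j e = trans (A-vertex j (inject₁ e)) (cong (λ σ → vertex σ (A j (inject₁ e))) (side-inject₁ σ₀ e))
        vertexNext : ∀ j e → f (thetaPath j (suc e)) ≡ vertex (not (side σ₀ e)) (A j (suc e))
        vertexNext j e = trans (A-vertex j (suc e)) (cong (λ σ → vertex σ (A j (suc e))) (side-suc σ₀ e))
        orient : ∀ j e → E (left σ₀ e (A j)) (right σ₀ e (A j)) ≡ true
        orient j e = turn (side σ₀ e) (proj₂ (adj-vertex (side σ₀ e) (A j (inject₁ e)) (not (side σ₀ e)) (A j (suc e))
          (subst₂ (λ u v → adj graph u v ≡ true) (vertexAt j e) (vertexNext j e) (adjacent j e))))
          where
          turn : ∀ b → Orient b (A j (inject₁ e)) (A j (suc e)) ≡ true →
                 E (if b then A j (inject₁ e) else A j (suc e)) (if b then A j (suc e) else A j (inject₁ e)) ≡ true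
          turn true  p = p
          turn false p = p
        leftVertex : ∀ j e → f (left σ₀ e (thetaPath j)) ≡ vertex true (left σ₀ e (A j))
        leftVertex j e = turn (side σ₀ e) (vertexAt j e) (vertexNext j e)
          where
          turn : ∀ b → f (thetaPath j (inject₁ e)) ≡ vertex b (A j (inject₁ e)) → f (thetaPath j (suc e)) ≡ vertex (not b) (A j (suc e)) →
                 f (if b then thetaPath j (inject₁ e) else thetaPath j (suc e)) ≡ vertex true (if b then A j (inject₁ e) else A j (suc e))
          turn true  p q = p
          turn false p q = q
        rightVertex : ∀ j e → f (right σ₀ e (thetaPath j)) ≡ vertex false (right σ₀ e (A j))
        rightVertex j e = turn (side σ₀ e) (vertexAt j e) (vertexNext j e)
          where
          turn : ∀ b → f (thetaPath j (inject₁ e)) ≡ vertex b (A j (inject₁ e)) → f (thetaPath j (suc e)) ≡ vertex (not b) (A j (suc e)) →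
                 f (if b then thetaPath j (suc e) else thetaPath j (inject₁ e)) ≡ vertex false (if b then A j (suc e) else A j (inject₁ e))
          turn true  p q = q
          turn false p q = p

-- The polynomial bipartite graph and the absence of theta graphs in it.

module ThetaFree where
  open import Data.Nat using (ℕ; zero; suc; _≤_; _<_; z≤n; s≤s) renaming (_+_ to _+ℕ_; _*_ to _*ℕ_; _^_ to _^ℕ_)
  import Data.Nat as ℕ
  import Data.Nat.Properties as ℕ
  import Data.Nat.Tactic.RingSolver as ℕ
  open import Data.Bool using (Bool; true; false)
  open import Data.Fin using (Fin; zero; suc; _≟_; combine; remQuot; quotient; remainder; finToFun; funToFin)
  import Data.Fin.Properties as Fin
  open import Data.List using (List; []; _∷_; length; tabulate)
  import Data.List.Properties as List
  import Data.List.Relation.Unary.All.Properties as All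
  open import Data.Vec using (Vec; []; _∷_; lookup; _[_]≔_)
  import Data.Vec as Vec
  import Data.Vec.Properties as Vec
  open import Data.Product using (Σ; _×_; _,_; proj₁; proj₂; ∃-syntax)
  open import Data.Empty using (⊥; ⊥-elim)
  open import Function using (_∘_)
  open import Function.Definitions using (Injective)
  open import Relation.Nullary using (¬_; Dec; yes; no)
  open import Relation.Nullary.Decidable using (isYes)
  open import Relation.Binary.PropositionalEquality

  open import Algebra.Bundles using (CommutativeRing)
  import Algebra.Solver.Ring.NaturalCoefficients.Default

  open Counting renaming (∑ to ∑ℕ) hiding (sum-remove; ∑-distrib-+)
  open FiniteDomains
  open AlgebraicDependence
  open Walks

  -- Here `k′` = k - 1, `s` is the number of paths interpolated at once, `Δ` the size of a block of
  -- paths, `R` = M - s + 1 the number of coordinates of c in each equation, and 1 + `Λ′` the number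
  -- of forms. `node` and `gridNode` provide distinct elements of K.
  module Construction {q : ℕ} (F : FiniteDomain q) (k′ s d₀ Δ R Λ′ : ℕ)
    (node : Fin (suc Λ′) → Fin q) (node-injective : Injective _≡_ _≡_ node)
    (s+R≡1+n : s +ℕ R ≡ suc (s *ℕ (k′ *ℕ suc k′)))
    (form≤d₀ : suc (suc k′) +ℕ 2 ≤ d₀)
    (value≤d₀ : 2 +ℕ (s *ℕ suc k′) *ℕ (suc (suc k′) +ℕ 2) ≤ d₀)
    (Δ-large : degreeFactor (interpolationDegree (s *ℕ suc k′) d₀) (suc (s *ℕ (k′ *ℕ suc k′))) ^ℕ (s *ℕ (k′ *ℕ suc k′)) < Δ)
    (gridNode : Fin (Δ *ℕ degreeFactor (interpolationDegree (s *ℕ suc k′) d₀) (suc (s *ℕ (k′ *ℕ suc k′)))) → Fin q)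
    (gridNode-injective : Injective _≡_ _≡_ gridNode) where

    k m M n D ℓ Λ : ℕ
    k = suc k′
    Λ = suc Λ′
    m = s *ℕ k
    -- `M` and `n` are one number in two bracketings: coefficients are indexed by a degree below `m`
    -- and a coordinate of y, parameters by path, internal vertex and coordinate.
    M = m *ℕ k′
    n = s *ℕ (k′ *ℕ k)
    D = interpolationDegree m d₀
    ℓ = s *ℕ Δ

    open Polynomials F
    open MultiPoly F Δ
    open Algebra.Solver.Ring.NaturalCoefficients.Default (CommutativeRing.commutativeSemiring ring) using (solve; _:+_; _:*_; _:=_)

    Vertex : Set
    Vertex = Fin (q ^ℕ k)

    coord : Vertex → Fin k → K
    coord = finToFun

    finToFun-injective : ∀ j (a b : Fin (q ^ℕ j)) → (∀ i → finToFun {q} {j} a i ≡ finToFun b i) → a ≡ b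
    finToFun-injective zero    zero zero eq = refl
    finToFun-injective (suc j) a    b    eq = begin
      a                                                               ≡⟨ Fin.combine-remQuot {q} (q ^ℕ j) a ⟨
      combine (quotient {q} (q ^ℕ j) a) (remainder {q} (q ^ℕ j) a)    ≡⟨ cong₂ combine (eq zero) (finToFun-injective j _ _ (eq ∘ suc)) ⟩
      combine (quotient {q} (q ^ℕ j) b) (remainder {q} (q ^ℕ j) b)    ≡⟨ Fin.combine-remQuot {q} (q ^ℕ j) b ⟩
      b                                                               ∎
      where open ≡-Reasoning

    -- An edge has k + 1 free coordinates, those of `P` and the first one b of `L`; the polynomial
    -- map is evaluated at this point (b first).
    edgePoint : (Fin k → K) → (Fin k → K) → Fin (suc k) → K
    edgePoint P L zero    = L zero
    edgePoint P L (suc i) = P i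

    edgePoint-cong : ∀ {P P′ L L′} → (∀ i → P i ≡ P′ i) → (∀ i → L i ≡ L′ i) → ∀ i → edgePoint P L i ≡ edgePoint P′ L′ i
    edgePoint-cong eq eq′ zero    = eq′ zero
    edgePoint-cong eq eq′ (suc i) = eq i

    -- The coefficient vector of the form is (1, ν, ν², ...) with ν = `node t`. Read as a polynomial
    -- in ν, the difference of two points has few roots, so few forms confuse them.
    form : Fin Λ → (Fin (suc k) → K) → K
    form t e = ev (tabulate e) (node t)

    form-cong : ∀ t {e e′} → (∀ i → e i ≡ e′ i) → form t e ≡ form t e′
    form-cong t eq = cong (λ as → ev as (node t)) (List.tabulate-cong eq)

    Coefficients : Set
    Coefficients = Vec (Vec K M) Λ

    column : Vec K M → Fin k′ → Vec K m
    column v i = Vec.tabulate (λ j → lookup v (combine j i))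

    summand : Coefficients → (Fin (suc k) → K) → Fin k′ → Fin Λ → K
    summand c e i t = ev (Vec.toList (column (lookup c t) i)) (form t e)

    neighbour : Coefficients → (Fin (suc k) → K) → Fin k′ → K
    neighbour c e i = ∑ (summand c e i)

    neighbour-cong : ∀ c {e e′} i → (∀ j → e j ≡ e′ j) → neighbour c e i ≡ neighbour c e′ i
    neighbour-cong c i eq = sum-cong-≗ λ t → cong (ev (Vec.toList (column (lookup c t) i))) (form-cong t eq)

    -- Both sides of the graph are K^k; a right vertex L is read as (b , y), and the left vertex P is joined
    -- to it iff y is the value at (P , b) of the polynomial map with coefficients c.
    Edge : Coefficients → Vertex → Vertex → Set
    Edge c P L = ∀ i → coord L (suc i) ≡ neighbour c (edgePoint (coord P) (coord L)) i

    zeros : Vec K M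
    zeros = Vec.replicate M 0#

    -- The summands other than t, stored so that equations built from them do not change when entry
    -- t varies.
    erase : Fin Λ → Coefficients → Coefficients
    erase t c = c [ t ]≔ zeros

    neighbour-erase : ∀ c t e i → neighbour c e i ≡ neighbour (erase t c) e i + ev (Vec.toList (column (lookup c t) i)) (form t e)
    neighbour-erase c t e i = begin
      ∑ (summand c e i)
        ≡⟨ sum-remove {i = t} (summand c e i) ⟩
      summand c e i t + ∑ (λ u → summand c e i (punchIn t u))
        ≡⟨ cong (summand c e i t +_) (sum-cong-≗ λ u → cong (λ v → ev (Vec.toList (column v i)) (form (punchIn t u) e)) (sym (Vec.lookup∘update′ (Fin.punchInᵢ≢i t u) c zeros))) ⟩
      summand c e i t + ∑ (λ u → summand (erase t c) e i (punchIn t u))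
        ≡⟨ cong (summand c e i t +_) (trans (cong (_+ ∑ (λ u → summand (erase t c) e i (punchIn t u))) erased) (+-identityˡ _)) ⟨
      summand c e i t + (summand (erase t c) e i t + ∑ (λ u → summand (erase t c) e i (punchIn t u)))
        ≡⟨ cong (summand c e i t +_) (sum-remove {i = t} (summand (erase t c) e i)) ⟨
      summand c e i t + neighbour (erase t c) e i
        ≡⟨ +-comm _ _ ⟩
      neighbour (erase t c) e i + summand c e i t ∎
      where
      open ≡-Reasoning
      open import Data.Fin using (punchIn)
      allZero : ∀ {j} (f : Fin j → K) → (∀ i → f i ≡ 0#) → ∀ x → ev (Vec.toList (Vec.tabulate f)) x ≡ 0#
      allZero {zero}  f eq x = refl
      allZero {suc j} f eq x = trans (cong₂ (λ a b → a + x * b) (eq zero) (allZero (f ∘ suc) (eq ∘ suc) x)) (trans (+-identityˡ _) (zeroʳ x))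
      erased : summand (erase t c) e i t ≡ 0#
      erased = allZero {m} (λ j → lookup (lookup (erase t c) t) (combine {m} {k′} j i))
        (λ j → trans (cong (λ v → lookup v (combine {m} {k′} j i)) (Vec.lookup∘update t c zeros)) (Vec.lookup-replicate (combine {m} {k′} j i) 0#)) (form t e)

    sep-form : ∀ {d} t {e : Fin (suc k) → Vec K n → K} → 1 ≤ d → (∀ i → SepPoly n d (e i)) → SepPoly n (suc k +ℕ d) (λ z → form t (λ i → e i z))
    sep-form {d} t 1≤d p = lemma (suc k) p
      where
      lemma : ∀ j {e : Fin j → Vec K n → K} → (∀ i → SepPoly n d (e i)) → SepPoly n (j +ℕ d) (λ z → ev (tabulate (λ i → e i z)) (node t))
      lemma zero    p = sep-weaken 1≤d (sep-const 0#)
      lemma (suc j) p = sep-+ (sep-weaken (ℕ.m≤n+m d (suc j)) (p zero)) (sep-scale (node t) (lemma j (p ∘ suc)))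

    sep-ev : ∀ {d f} as → SepPoly n d f → SepPoly n (suc (length as *ℕ d)) (λ z → ev as (f z))
    sep-ev         []       p = sep-const 0#
    sep-ev {d} (a ∷ as) p = sep-+ (sep-weaken (s≤s z≤n) (sep-const a)) (sep-weaken (ℕ.≤-reflexive (ℕ.+-suc d _)) (sep-* p (sep-ev as p)))

    sep-neighbour : ∀ {d} c {e : Fin (suc k) → Vec K n → K} i → 1 ≤ d → (∀ i → SepPoly n d (e i)) →
                    SepPoly n (suc (m *ℕ (suc k +ℕ d))) (λ z → neighbour c (λ j → e j z) i)
    sep-neighbour {d} c i 1≤d p = sep-∑ (s≤s z≤n) λ t →
      sep-weaken (ℕ.≤-reflexive (cong (λ l → suc (l *ℕ (suc k +ℕ d))) (Vec.length-toList (column (lookup c t) i))))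
        (sep-ev (Vec.toList (column (lookup c t) i)) (sep-form t 1≤d p))

    -- The parameters are the s·k′·k coordinates of the internal vertices of s paths from x to y. If form t separates
    -- the edges of these paths, the coefficients belonging to t are rational functions of the parameters.
    module Paths (σ : Bool) (x y : Vertex) (t : Fin Λ) (h : Coefficients) where

      index : Fin s → Fin k′ → Fin k → Fin n
      index p i j = combine p (combine i j)

      position : Fin s → Fin (suc k) → Fin k → Vec K n → K
      position p = path (λ j _ → coord x j) (λ j _ → coord y j) (λ i j z → lookup z (index p i j))

      Linear : (Fin k → Vec K n → K) → Set
      Linear f = ∀ j → SepPoly n 2 (f j)

      position-linear : ∀ p i → Linear (position p i)
      position-linear p i = path-rel (λ f (_ : Bool) → Linear f) {x′ = true} {y′ = true} {g = λ _ → true}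
        (λ j → sep-weaken (s≤s z≤n) (sep-const _)) (λ j → sep-weaken (s≤s z≤n) (sep-const _)) (λ i j → sep-lookup _) i

      leftEnd rightEnd : Fin s → Fin k → Fin k → Vec K n → K
      leftEnd  p e = left  σ e (position p)
      rightEnd p e = right σ e (position p)

      point : Fin s → Fin k → Fin (suc k) → Vec K n → K
      point p e i z = edgePoint (λ j → leftEnd p e j z) (λ j → rightEnd p e j z) i

      leftEnd-linear : ∀ p e → Linear (leftEnd p e)
      leftEnd-linear p e = left-rel (λ f (_ : Bool) → Linear f) σ e {w′ = λ _ → true} (position-linear p)

      rightEnd-linear : ∀ p e → Linear (rightEnd p e)
      rightEnd-linear p e = right-rel (λ f (_ : Bool) → Linear f) σ e {w′ = λ _ → true} (position-linear p)

      point-linear : ∀ p e i → SepPoly n 2 (point p e i)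
      point-linear p e zero    = rightEnd-linear p e zero
      point-linear p e (suc i) = leftEnd-linear p e i

      nodeFun : Fin s → Fin k → Vec K n → K
      nodeFun p e z = form t (λ i → point p e i z)

      -- The edge equation solved for the summand of form t: the coordinate of the right end minus
      -- the contribution of the other forms, held in `h`. This is the value to be interpolated at
      -- the node `nodeFun p e`.
      valueFun : Fin s → Fin k → Fin k′ → Vec K n → K
      valueFun p e i z = rightEnd p e (suc i) z + - 1# * neighbour h (λ j → point p e j z) i

      nodeFun-sep : ∀ p e → SepPoly n d₀ (nodeFun p e)
      nodeFun-sep p e = sep-weaken form≤d₀ (sep-form t (s≤s z≤n) (point-linear p e))

      valueFun-sep : ∀ p e i → SepPoly n d₀ (valueFun p e i)
      valueFun-sep p e i = sep-weaken value≤d₀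
        (sep-+ (sep-weaken (s≤s (s≤s z≤n)) (rightEnd-linear p e (suc i))) (sep-scale (- 1#) (sep-neighbour h i (s≤s z≤n) (point-linear p e))))

      1≤d₀ : 1 ≤ d₀
      1≤d₀ = ℕ.≤-trans (s≤s z≤n) form≤d₀

      nodeFrac : Fin s → Fin k → Frac n d₀
      nodeFrac p e = polyFrac 1≤d₀ (nodeFun p e) (nodeFun-sep p e)

      valueFrac : Fin s → Fin k → Fin k′ → Frac n d₀
      valueFrac p e i = polyFrac 1≤d₀ (valueFun p e i) (valueFun-sep p e i)

      nodeFracs : Vec (Frac n d₀) m
      nodeFracs = Vec.tabulate (λ r → nodeFrac (quotient {s} k r) (remainder {s} k r))

      valueFracs : Fin k′ → Vec (Frac n d₀) m
      valueFracs i = Vec.tabulate (λ r → valueFrac (quotient {s} k r) (remainder {s} k r) i)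

      us : Vec (Frac n D) s
      us = Vec.tabulate (λ p → weaken (≤interpolationDegree m d₀) (nodeFrac p zero))

      ws : Vec (Frac n D) M
      ws = Vec.tabulate (λ α → lookup (interpolate m nodeFracs (valueFracs (remainder {m} k′ α))) (quotient {m} k′ α))

      open Dependence {n} {D} {s} {R} {M} s+R≡1+n us ws Δ-large gridNode gridNode-injective public using (equations; equations-hold)

      module _ (c : Coefficients) (h≡ : h ≡ erase t c) (W : Fin ℓ → Fin k′ → Vertex) where

        walk : Fin ℓ → Fin (suc k) → Vertex
        walk j = path x y (W j)

        edgeAt : Fin ℓ → Fin k → Fin (suc k) → K
        edgeAt j e = edgePoint (coord (left σ e (walk j))) (coord (right σ e (walk j)))

        module _ (edges : ∀ j e → Edge c (left σ e (walk j)) (right σ e (walk j)))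
                 (separated : ∀ j e j′ e′ → form t (edgeAt j e) ≡ form t (edgeAt j′ e′) → (j , e) ≡ (j′ , e′))
                 (τ : Fin s → Fin Δ) where

          pathOf : Fin s → Fin ℓ
          pathOf p = combine p (τ p)

          params : Vec K n
          params = Vec.tabulate (λ α → coord (W (pathOf (quotient {s} (k′ *ℕ k) α)) (quotient {k′} k (remainder {s} (k′ *ℕ k) α))) (remainder {k′} k (remainder {s} (k′ *ℕ k) α)))

          params-lookup : ∀ p i j → lookup params (index p i j) ≡ coord (W (pathOf p) i) j
          params-lookup p i j = trans (Vec.lookup∘tabulate _ (index p i j))
            (trans (cong (λ (p , β) → coord (W (pathOf p) (quotient {k′} k β)) (remainder {k′} k β)) (Fin.remQuot-combine {s} p (combine i j)))
                   (cong (λ (i , j) → coord (W (pathOf p) i) j) (Fin.remQuot-combine {k′} i j)))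

          Evaluates : (Fin k → Vec K n → K) → Vertex → Set
          Evaluates f v = ∀ j → f j params ≡ coord v j

          position-eval : ∀ p i → Evaluates (position p i) (walk (pathOf p) i)
          position-eval p = path-rel Evaluates (λ j → refl) (λ j → refl) (params-lookup p)

          leftEnd-eval : ∀ p e → Evaluates (leftEnd p e) (left σ e (walk (pathOf p)))
          leftEnd-eval p e = left-rel Evaluates σ e {position p} {walk (pathOf p)} (position-eval p)

          rightEnd-eval : ∀ p e → Evaluates (rightEnd p e) (right σ e (walk (pathOf p)))
          rightEnd-eval p e = right-rel Evaluates σ e {position p} {walk (pathOf p)} (position-eval p)

          point-eval : ∀ p e i → point p e i params ≡ edgeAt (pathOf p) e i
          point-eval p e = edgePoint-cong (leftEnd-eval p e) (rightEnd-eval p e)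

          nodeFun-eval : ∀ p e → nodeFun p e params ≡ form t (edgeAt (pathOf p) e)
          nodeFun-eval p e = form-cong t (point-eval p e)

          valueFun-eval : ∀ p e i → valueFun p e i params ≡ ev (Vec.toList (column (lookup c t) i)) (form t (edgeAt (pathOf p) e))
          valueFun-eval p e i = begin
            rightEnd p e (suc i) params + - 1# * neighbour h (λ j → point p e j params) i
              ≡⟨ cong₂ (λ a b → a + - 1# * b) (trans (rightEnd-eval p e (suc i)) (edges (pathOf p) e i))
                       (trans (cong (λ h → neighbour h (λ j → point p e j params) i) h≡) (neighbour-cong (erase t c) i (point-eval p e))) ⟩
            neighbour c E i + - 1# * neighbour (erase t c) E i
              ≡⟨ cong₂ _+_ (neighbour-erase c t E i) (-1*x≈-x _) ⟩
            (neighbour (erase t c) E i + v) − neighbour (erase t c) E i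
              ≡⟨ +-−-cancel _ v ⟩
            v ∎
            where
            open ≡-Reasoning
            E = edgeAt (pathOf p) e
            v = ev (Vec.toList (column (lookup c t) i)) (form t E)

          nodes : Vec K m
          nodes = Vec.tabulate (λ r → form t (edgeAt (pathOf (quotient {s} k r)) (remainder {s} k r)))

          nodes-distinct : Distinct nodes
          nodes-distinct = distinct _ λ {r} {r′} eq →
            trans (sym (Fin.combine-remQuot {s} k r)) (trans
              (same r r′ (separated (pathOf (quotient {s} k r)) (remainder {s} k r) (pathOf (quotient {s} k r′)) (remainder {s} k r′) eq)) (Fin.combine-remQuot {s} k r′))
            where
            same : ∀ r r′ → (pathOf (quotient {s} k r) , remainder {s} k r) ≡ (pathOf (quotient {s} k r′) , remainder {s} k r′) →
                   combine (quotient {s} k r) (remainder {s} k r) ≡ combine (quotient {s} k r′) (remainder {s} k r′)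
            same r r′ eq = cong₂ (combine {s} {k}) (Fin.combine-injectiveˡ {s} {Δ} (quotient {s} k r) (τ (quotient {s} k r))
              (quotient {s} k r′) (τ (quotient {s} k r′)) (cong proj₁ eq)) (cong proj₂ eq)
            distinct : ∀ {j} (f : Fin j → K) → Injective _≡_ _≡_ f → Distinct (Vec.tabulate f)
            distinct {zero}  f inj = _
            distinct {suc j} f inj =
              (λ i eq → Fin.0≢1+n (inj (sym (trans (sym (Vec.lookup∘tabulate (f ∘ suc) i)) eq)))) , distinct (f ∘ suc) (Fin.suc-injective ∘ inj)

          Rep-poly : ∀ {d f a} {1≤d : 1 ≤ d} {p : SepPoly n d f} → f params ≡ a → Rep params (polyFrac 1≤d f p) a
          Rep-poly {f = f} {1≤d = 1≤d} {p} refl = polyFrac-rep {1≤d = 1≤d} {f} {p}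

          Reps-tabulate : ∀ {d j} (f : Fin j → Frac n d) v → (∀ i → Rep params (f i) (lookup v i)) → Reps params (Vec.tabulate f) v
          Reps-tabulate f []      r = []
          Reps-tabulate f (x ∷ v) r = r zero ∷ Reps-tabulate (f ∘ suc) v (r ∘ suc)

          Reps-lookup : ∀ {d j} {fs : Vec (Frac n d) j} {v} → Reps params fs v → ∀ i → Rep params (lookup fs i) (lookup v i)
          Reps-lookup (x ∷ r) zero    = x
          Reps-lookup (x ∷ r) (suc i) = Reps-lookup r i

          us-reps : Reps params us (Vec.tabulate (λ p → form t (edgeAt (pathOf p) zero)))
          us-reps = Reps-tabulate _ _ λ p →
            Rep-poly {1≤d = ℕ.≤-trans 1≤d₀ (≤interpolationDegree m d₀)}
              {p = sep-weaken (≤interpolationDegree m d₀) (nodeFun-sep p zero)} (trans (nodeFun-eval p zero) (sym (Vec.lookup∘tabulate _ p)))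

          ws-reps : Reps params ws (lookup c t)
          ws-reps = Reps-tabulate _ _ λ α → subst (Rep params (lookup (interpolate m nodeFracs (valueFracs (remainder {m} k′ α))) (quotient {m} k′ α)))
              (trans (Vec.lookup∘tabulate _ (quotient {m} k′ α)) (cong (lookup (lookup c t)) (Fin.combine-remQuot {m} k′ α)))
              (Reps-lookup (interpolate-reps m (column (lookup c t) (remainder {m} k′ α)) nodes-distinct nodeReps (valueReps (remainder {m} k′ α))) (quotient {m} k′ α))
            where
            nodeReps : Reps params nodeFracs nodes
            nodeReps = Reps-tabulate _ _ λ r →
              Rep-poly {1≤d = 1≤d₀} {p = nodeFun-sep (quotient {s} k r) (remainder {s} k r)} (trans (nodeFun-eval (quotient {s} k r) (remainder {s} k r)) (sym (Vec.lookup∘tabulate _ r)))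
            valueReps : ∀ i → Reps params (valueFracs i) (Vec.map (ev (Vec.toList (column (lookup c t) i))) nodes)
            valueReps i = Reps-tabulate _ _ λ r →
              Rep-poly {1≤d = 1≤d₀} {p = valueFun-sep (quotient {s} k r) (remainder {s} k r) i} (trans (valueFun-eval (quotient {s} k r) (remainder {s} k r) i)
              (sym (trans (Vec.lookup-map r _ nodes) (cong (ev (Vec.toList (column (lookup c t) i))) (Vec.lookup∘tabulate _ r)))))

        -- As τ runs over the choices of one path per block, the values of the form at the first
        -- edges fill a product of Δ-element sets, while the interpolated coefficients stay equal to
        -- entry t of c.
        separated⇒solution :
          (∀ j e → Edge c (left σ e (walk j)) (right σ e (walk j))) →
          (∀ j e j′ e′ → form t (edgeAt j e) ≡ form t (edgeAt j′ e′) → (j , e) ≡ (j′ , e′)) →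
          solutionInd equations (lookup c t) ≡ 1
        separated⇒solution edges separated = equations-hold (lookup c t)
          (λ p a → form t (edgeAt (combine p a) zero))
          (λ p {a} {b} eq → Fin.combine-injectiveʳ p a p b (cong proj₁ (separated (combine p a) zero (combine p b) zero eq)))
          (λ τ → params edges separated τ , us-reps edges separated τ , ws-reps edges separated τ)

    toSide : Fin 2 → Bool
    toSide zero    = true
    toSide (suc _) = false

    fromSide : Bool → Fin 2
    fromSide true  = zero
    fromSide false = suc zero

    toSide-fromSide : ∀ σ → toSide (fromSide σ) ≡ σ
    toSide-fromSide true  = refl
    toSide-fromSide false = refl

    solves : Bool × Vertex × Vertex × Fin Λ → Coefficients → ℕ
    solves (σ , x , y , t) c = solutionInd (Paths.equations σ x y t (erase t c)) (lookup c t)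

    vectors : Summation (Vec K M)
    vectors = vecSummation (finSummation q) M

    -- Erasure makes the system independent of the new entry `a`, so with the rest of `v` frozen the
    -- dimension count applies to `a` alone.
    solves-count : ∀ R′ → R ≡ suc R′ → ∀ σ x y t v → vecSumK M (λ a → solves (σ , x , y , t) (v [ t ]≔ a)) ≤ dimConst Δ M R *ℕ q ^ℕ R′
    solves-count R′ R≡ σ x y t v = ℕ.≤-trans
      (ℕ.≤-reflexive (Summation.S-cong vectors (λ a → cong₂ (λ h b → solutionInd (Paths.equations σ x y t h) b) (Vec.[]≔-idempotent v t) (Vec.lookup∘update t v a))))
      (bound (Paths.equations σ x y t (erase t v)) R≡)
      where
      rearrange : ∀ c q r → c *ℕ (q *ℕ r) ≡ q *ℕ (c *ℕ r)
      rearrange = ℕ.solve-∀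
      bound : ∀ {R} (P : Equations R M) → R ≡ suc R′ → vecSumK M (solutionInd P) ≤ dimConst Δ M R *ℕ q ^ℕ R′
      bound {R} P refl = ℕ.*-cancelˡ-≤ q {{ℕ.>-nonZero q≥1}} (ℕ.≤-trans (solutionCount M R P) (ℕ.≤-reflexive (rearrange (dimConst Δ M R) q (q ^ℕ R′))))

    Configurations : ℕ
    Configurations = 2 *ℕ (q ^ℕ k *ℕ (q ^ℕ k *ℕ Λ))

    decode₂ : Fin (q ^ℕ k *ℕ Λ) → Vertex × Fin Λ
    decode₂ = remQuot Λ

    decode₁ : Fin (q ^ℕ k *ℕ (q ^ℕ k *ℕ Λ)) → Vertex × Vertex × Fin Λ
    decode₁ i = quotient {q ^ℕ k} (q ^ℕ k *ℕ Λ) i , decode₂ (remainder {q ^ℕ k} (q ^ℕ k *ℕ Λ) i)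

    decode : Fin Configurations → Bool × Vertex × Vertex × Fin Λ
    decode i = toSide (quotient {2} (q ^ℕ k *ℕ (q ^ℕ k *ℕ Λ)) i) , decode₁ (remainder {2} (q ^ℕ k *ℕ (q ^ℕ k *ℕ Λ)) i)

    encode : Bool × Vertex × Vertex × Fin Λ → Fin Configurations
    encode (σ , x , y , t) = combine {2} (fromSide σ) (combine {q ^ℕ k} x (combine {q ^ℕ k} y t))

    decode-encode : ∀ i → decode (encode i) ≡ i
    decode-encode (σ , x , y , t) = trans
      (cong (λ (σ , i) → toSide σ , decode₁ i) (Fin.remQuot-combine {2} (fromSide σ) (combine {q ^ℕ k} x (combine {q ^ℕ k} y t))))
      (cong₂ _,_ (toSide-fromSide σ) (trans
        (cong (λ (x , i) → x , decode₂ i) (Fin.remQuot-combine {q ^ℕ k} x (combine {q ^ℕ k} y t)))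
        (cong (x ,_) (Fin.remQuot-combine {q ^ℕ k} y t))))

    goodCoefficients : ∀ R′ → R ≡ suc R′ → Configurations *ℕ (dimConst Δ M R *ℕ q ^ℕ R′) < q ^ℕ M → ∃[ c ] (∀ i → solves i c ≡ 0)
    goodCoefficients R′ R≡ sparse =
      let c , good = unionBound vectors Λ Configurations (solves ∘ decode) (λ i → proj₂ (proj₂ (proj₂ (decode i))))
                       (dimConst Δ M R *ℕ q ^ℕ R′) zeros (ℕ.m^n>0 q {{ℕ.>-nonZero q≥1}} M)
                       (λ i → let σ , x , y , t = decode i in solves-count R′ R≡ σ x y t) sparse
      in c , λ i → subst (λ i → solves i c ≡ 0) (decode-encode i) (good (encode i))

    -- Two different points collide under a form only if their difference, a nonzero polynomial with
    -- k + 1 coefficients, vanishes at its node. The N * N pairs together cannot spoil all Λ nodes.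
    separate : ∀ {N} (e : Fin N → Fin (suc k) → K) → (∀ r r′ → (∀ i → e r i ≡ e r′ i) → r ≡ r′) → N *ℕ N *ℕ suc k < Λ →
               ∃[ t ] (∀ r r′ → form t (e r) ≡ form t (e r′) → r ≡ r′)
    separate {N} e e-inj enough = let t , lt = found in t , λ r r′ eq → resolve t r r′ eq (ℕ.≤-<-trans (≤∑ (λ i → collide i t) (combine r r′)) lt)
      where
      difference : Fin N → Fin N → List K
      difference r r′ = tabulate (λ i → e r i − e r′ i)
      rearrange : ∀ a b x p q → (a + p) + x * (b + q) ≡ (a + x * b) + (p + x * q)
      rearrange = solve 5 (λ a b x p q → (a :+ p) :+ x :* (b :+ q) := (a :+ x :* b) :+ (p :+ x :* q)) refl
      ev-difference : ∀ {j} (f g : Fin j → K) x → ev (tabulate (λ i → f i − g i)) x + ev (tabulate g) x ≡ ev (tabulate f) x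
      ev-difference {zero}  f g x = +-identityˡ _
      ev-difference {suc j} f g x = trans (sym (rearrange (f zero − g zero) _ x (g zero) _))
        (cong₂ (λ a b → a + x * b) (−-+ (f zero) (g zero)) (ev-difference (f ∘ suc) (g ∘ suc) x))
      collide′ : Fin N → Fin N → Fin Λ → ℕ
      collide′ r r′ t with r ≟ r′
      ... | yes _ = 0
      ... | no  _ = isZero (ev (difference r r′) (node t))
      collide : Fin (N *ℕ N) → Fin Λ → ℕ
      collide i = collide′ (quotient {N} N i) (remainder {N} N i)
      bound : ∀ r r′ → ∑ℕ (collide′ r r′) ≤ suc k
      bound r r′ with r ≟ r′
      ... | yes _  = ℕ.≤-trans (ℕ.≤-reflexive (trans (∑-const Λ 0) (ℕ.*-zeroʳ Λ))) z≤n
      ... | no r≢r′ = ℕ.≤-trans (rootCount (difference r r′) node node-injective λ zs → r≢r′ (e-inj r r′ λ i → −≡0⇒≡ (All.tabulate⁻ {f = λ i → e r i − e r′ i} zs i)))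
                               (ℕ.≤-reflexive (List.length-tabulate (λ i → e r i − e r′ i)))
      found : ∃[ t ] ∑ℕ (λ i → collide i t) < 1
      found = ∑-find (λ t → ∑ℕ (λ i → collide i t)) 1 (begin-strict
        ∑ℕ (λ t → ∑ℕ (λ i → collide i t))  ≡⟨ Additive.T-∑ (Summation.additive (finSummation Λ)) collide ⟨
        ∑ℕ (λ i → ∑ℕ (collide i))          ≤⟨ ∑-mono (λ i → bound (quotient {N} N i) (remainder {N} N i)) ⟩
        ∑ℕ {N *ℕ N} (λ _ → suc k)          ≡⟨ ∑-const (N *ℕ N) (suc k) ⟩
        N *ℕ N *ℕ suc k                    <⟨ enough ⟩
        Λ                                  ≡⟨ ℕ.*-identityʳ Λ ⟨
        Λ *ℕ 1                             ∎)
        where open ℕ.≤-Reasoning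
      resolve′ : ∀ t r r′ → form t (e r) ≡ form t (e r′) → collide′ r r′ t < 1 → r ≡ r′
      resolve′ t r r′ eq lt with r ≟ r′
      ... | yes r≡r′ = r≡r′
      ... | no _ = ⊥-elim (ℕ.<-irrefl (isZero-yes zero-difference) lt)
        where
        zero-difference : ev (difference r r′) (node t) ≡ 0#
        zero-difference = trans (sym (trans (cong (_− form t (e r′)) (+-comm _ _)) (+-−-cancel _ _)))
          (trans (cong (_− form t (e r′)) (trans (ev-difference (e r) (e r′) (node t)) eq)) (-‿inverseʳ _))
      resolve : ∀ t r r′ → form t (e r) ≡ form t (e r′) → collide (combine r r′) t < 1 → r ≡ r′
      resolve t r r′ eq lt = resolve′ t r r′ eq (subst (_< 1) (cong (λ (a , b) → collide′ a b t) (Fin.remQuot-combine {N} r r′)) lt)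

    walkEdge : Bool → (Fin (suc k) → Vertex) → Fin k → Fin (suc k) → K
    walkEdge σ w e = edgePoint (coord (left σ e w)) (coord (right σ e w))

    -- For the form separating all ℓ k edges of a copy, entry t of c would solve the equations of (σ
    -- , x , y , t), which the choice of c excludes.
    noTheta : ∀ c → (∀ i → solves i c ≡ 0) → (ℓ *ℕ k) *ℕ (ℓ *ℕ k) *ℕ suc k < Λ →
              ∀ σ x y (W : Fin ℓ → Fin k′ → Vertex) →
              (∀ j e → Edge c (left σ e (path x y (W j))) (right σ e (path x y (W j)))) →
              (∀ j e j′ e′ → (∀ i → walkEdge σ (path x y (W j)) e i ≡ walkEdge σ (path x y (W j′)) e′ i) → (j , e) ≡ (j′ , e′)) → ⊥
    noTheta c good enough σ x y W edges distinct =
      let t , sep = separate point point-inj enough in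
      contradict (trans (sym (good (σ , x , y , t)))
        (Paths.separated⇒solution σ x y t (erase t c) c refl W edges λ j e j′ e′ eq → split j e j′ e′
          (sep (combine j e) (combine j′ e′)
            (trans (form-cong t (at j e)) (trans eq (sym (form-cong t (at j′ e′))))))))
      where
      contradict : 0 ≡ 1 → ⊥
      contradict ()
      point : Fin (ℓ *ℕ k) → Fin (suc k) → K
      point r = walkEdge σ (path x y (W (quotient {ℓ} k r))) (remainder {ℓ} k r)
      at : ∀ j e i → point (combine j e) i ≡ walkEdge σ (path x y (W j)) e i
      at j e i = cong (λ (j , e) → walkEdge σ (path x y (W j)) e i) (Fin.remQuot-combine {ℓ} j e)
      point-inj : ∀ r r′ → (∀ i → point r i ≡ point r′ i) → r ≡ r′
      point-inj r r′ eq = trans (sym (Fin.combine-remQuot {ℓ} k r)) (trans (cong (λ (j , e) → combine j e) (distinct _ _ _ _ eq)) (Fin.combine-remQuot {ℓ} k r′))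
      split : ∀ j e j′ e′ → combine {ℓ} {k} j e ≡ combine j′ e′ → (j , e) ≡ (j′ , e′)
      split j e j′ e′ eq = cong₂ _,_ (Fin.combine-injectiveˡ {ℓ} {k} j e j′ e′ eq) (Fin.combine-injectiveʳ {ℓ} {k} j e j′ e′ eq)

    Edge? : ∀ c P L → Dec (Edge c P L)
    Edge? c P L = Fin.all? (λ i → coord L (suc i) ≟ neighbour c (edgePoint (coord P) (coord L)) i)

    edgeᵇ : Coefficients → Vertex → Vertex → Bool
    edgeᵇ c P L = isYes (Edge? c P L)

    edgeᵇ-sound : ∀ c P L → edgeᵇ c P L ≡ true → Edge c P L
    edgeᵇ-sound c P L eq with Edge? c P L
    edgeᵇ-sound c P L eq | yes e = e
    edgeᵇ-sound c P L () | no _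

    edgeᵇ-complete : ∀ c P L → Edge c P L → edgeᵇ c P L ≡ true
    edgeᵇ-complete c P L e with Edge? c P L
    ... | yes _ = refl
    ... | no ¬e = ⊥-elim (¬e e)

    neighbourCoord : Coefficients → Vertex → K → Fin k → K
    neighbourCoord c P b zero    = b
    neighbourCoord c P b (suc i) = neighbour c (edgePoint (coord P) (λ _ → b)) i

    neighbourVertex : Coefficients → Vertex → K → Vertex
    neighbourVertex c P b = funToFin (neighbourCoord c P b)

    coord-neighbourVertex : ∀ c P b i → coord (neighbourVertex c P b) i ≡ neighbourCoord c P b i
    coord-neighbourVertex c P b = Fin.finToFun-funToFin (neighbourCoord c P b)

    neighbourVertex-injective : ∀ c P → Injective _≡_ _≡_ (neighbourVertex c P)
    neighbourVertex-injective c P {b} {b′} eq = trans (sym (coord-neighbourVertex c P b zero)) (trans (cong (λ v → coord v zero) eq) (coord-neighbourVertex c P b′ zero))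

    neighbourVertex-edge : ∀ c P b → Edge c P (neighbourVertex c P b)
    neighbourVertex-edge c P b i = trans (coord-neighbourVertex c P b (suc i)) (neighbour-cong c i same)
      where
      same : ∀ j → edgePoint (coord P) (λ _ → b) j ≡ edgePoint (coord P) (coord (neighbourVertex c P b)) j
      same zero    = sym (coord-neighbourVertex c P b zero)
      same (suc j) = refl

    -- On an edge the remaining coordinates of the right end are values of the polynomial map at the
    -- point, so the point determines both ends.
    edgePoint-injective : ∀ c {P L P′ L′} → Edge c P L → Edge c P′ L′ →
                          (∀ i → edgePoint (coord P) (coord L) i ≡ edgePoint (coord P′) (coord L′) i) → P ≡ P′ × L ≡ L′
    edgePoint-injective c {P} {L} {P′} {L′} e e′ eq = finToFun-injective k P P′ (eq ∘ suc) , finToFun-injective k L L′ coords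
      where
      coords : ∀ i → coord L i ≡ coord L′ i
      coords zero    = eq zero
      coords (suc i) = trans (e i) (trans (neighbour-cong c i eq) (sym (e′ i)))

    thetaFree : ∀ R′ → R ≡ suc R′ → Configurations *ℕ (dimConst Δ M R *ℕ q ^ℕ R′) < q ^ℕ M → (ℓ *ℕ k) *ℕ (ℓ *ℕ k) *ℕ suc k < Λ →
                0 < k′ → Fin ℓ → ∀ r →
                Σ (Graph (q ^ℕ k +ℕ (q ^ℕ k +ℕ r))) λ G → ¬ Contains G (Theta k ℓ) × q ^ℕ k *ℕ q ≤ edges G
    thetaFree R′ R≡ sparse enough k′>0 j₀ r = graph , free , edges≥ q (neighbourVertex c) (neighbourVertex-injective c)
        (λ P b → edgeᵇ-complete c P (neighbourVertex c P b) (neighbourVertex-edge c P b))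
      where
      good = goodCoefficients R′ R≡ sparse
      c = proj₁ good
      open BipartiteGraphs.Bipartite (edgeᵇ c) r using (graph; edges≥; ThetaCopy; thetaCopy)
      free : ¬ Contains graph (Theta k ℓ)
      free contains = noTheta c (proj₂ good) enough σ x y W isEdge′ λ j e j′ e′ eq →
        let p , q = edgePoint-injective c (isEdge′ j e) (isEdge′ j′ e′) eq in distinct j e j′ e′ p q
        where
        open ThetaCopy (thetaCopy k′>0 j₀ contains)
        isEdge′ : ∀ j e → Edge c (left σ e (path x y (W j))) (right σ e (path x y (W j)))
        isEdge′ j e = edgeᵇ-sound c _ _ (isEdge j e)

-- The residues modulo a prime as a finite domain.

module Residues where
  open import Data.Nat using (ℕ; zero; suc; _+_; _*_; _∸_; _<_; s≤s; z≤n; NonZero; nonTrivial⇒n>1)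
  open import Data.Nat.Properties as ℕ using (+-comm; +-assoc; *-comm; *-assoc; *-distribˡ-+; +-identityʳ; m+[n∸m]≡n; <⇒≤; ≤⇒≯)
  open import Data.Nat.DivMod using (_%_; _mod_; m%n<n; m<n⇒m%n≡m; %-distribˡ-+; %-distribˡ-*; n%n≡0)
  open import Data.Nat.Divisibility using (_∣_; ∣⇒≤; m%n≡0⇒n∣m)
  open import Data.Nat.Primality using (Prime; euclidsLemma; prime⇒nonZero; prime⇒nonTrivial)
  open import Data.Fin using (Fin; toℕ)
  open import Data.Fin.Properties using (toℕ-injective; toℕ-fromℕ<; toℕ<n)
  open import Data.Product using (_,_)
  import Data.Sum as Sum
  open import Data.Empty using (⊥-elim)
  open import Relation.Binary.PropositionalEquality
  open import Algebra.Structures using (IsCommutativeRing)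

  open FiniteDomains using (FiniteDomain)

  module _ {p : ℕ} (pp : Prime p) where
    private instance
      p≢0 : NonZero p
      p≢0 = prime⇒nonZero pp

    1<p : 1 < p
    1<p = nonTrivial⇒n>1 p {{prime⇒nonTrivial pp}}

    0<p : 0 < p
    0<p = ℕ.<-trans (s≤s z≤n) 1<p

    residue : ℕ → Fin p
    residue n = n mod p

    toℕ-residue : ∀ n → toℕ (residue n) ≡ n % p
    toℕ-residue n = toℕ-fromℕ< (m%n<n n p)

    residue-toℕ : ∀ a → residue (toℕ a) ≡ a
    residue-toℕ a = toℕ-injective (trans (toℕ-residue _) (m<n⇒m%n≡m (toℕ<n a)))

    residue-% : ∀ {m n} → m % p ≡ n % p → residue m ≡ residue n
    residue-% eq = toℕ-injective (trans (toℕ-residue _) (trans eq (sym (toℕ-residue _))))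

    add mul : Fin p → Fin p → Fin p
    add a b = residue (toℕ a + toℕ b)
    mul a b = residue (toℕ a * toℕ b)

    neg : Fin p → Fin p
    neg a = residue (p ∸ toℕ a)

    residue-+ : ∀ m n → add (residue m) (residue n) ≡ residue (m + n)
    residue-+ m n = residue-% (trans (cong₂ (λ x y → (x + y) % p) (toℕ-residue m) (toℕ-residue n)) (sym (%-distribˡ-+ m n p)))

    residue-* : ∀ m n → mul (residue m) (residue n) ≡ residue (m * n)
    residue-* m n = residue-% (trans (cong₂ (λ x y → (x * y) % p) (toℕ-residue m) (toℕ-residue n)) (sym (%-distribˡ-* m n p)))

    add-comm : ∀ a b → add a b ≡ add b a
    add-comm a b = cong residue (+-comm (toℕ a) (toℕ b))

    mul-comm : ∀ a b → mul a b ≡ mul b a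
    mul-comm a b = cong residue (*-comm (toℕ a) (toℕ b))

    -- Lets an unreduced representative stand for a residue, so that associativity and
    -- distributivity descend from ℕ.
    add-residueʳ : ∀ a n → add a (residue n) ≡ residue (toℕ a + n)
    add-residueʳ a n = trans (cong (λ x → add x (residue n)) (sym (residue-toℕ a))) (residue-+ (toℕ a) n)

    mul-residueʳ : ∀ a n → mul a (residue n) ≡ residue (toℕ a * n)
    mul-residueʳ a n = trans (cong (λ x → mul x (residue n)) (sym (residue-toℕ a))) (residue-* (toℕ a) n)

    add-assoc : ∀ a b c → add (add a b) c ≡ add a (add b c)
    add-assoc a b c = begin
      add (add a b) c                   ≡⟨ add-comm (add a b) c ⟩
      add c (residue (toℕ a + toℕ b))   ≡⟨ add-residueʳ c _ ⟩
      residue (toℕ c + (toℕ a + toℕ b)) ≡⟨ cong residue (trans (+-comm (toℕ c) _) (+-assoc (toℕ a) (toℕ b) (toℕ c))) ⟩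
      residue (toℕ a + (toℕ b + toℕ c)) ≡⟨ add-residueʳ a _ ⟨
      add a (add b c)                   ∎
      where open ≡-Reasoning

    mul-assoc : ∀ a b c → mul (mul a b) c ≡ mul a (mul b c)
    mul-assoc a b c = begin
      mul (mul a b) c                   ≡⟨ mul-comm (mul a b) c ⟩
      mul c (residue (toℕ a * toℕ b))   ≡⟨ mul-residueʳ c _ ⟩
      residue (toℕ c * (toℕ a * toℕ b)) ≡⟨ cong residue (trans (*-comm (toℕ c) _) (*-assoc (toℕ a) (toℕ b) (toℕ c))) ⟩
      residue (toℕ a * (toℕ b * toℕ c)) ≡⟨ mul-residueʳ a _ ⟨
      mul a (mul b c)                   ∎
      where open ≡-Reasoning

    mul-distribˡ : ∀ a b c → mul a (add b c) ≡ add (mul a b) (mul a c)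
    mul-distribˡ a b c = begin
      mul a (residue (toℕ b + toℕ c))                 ≡⟨ mul-residueʳ a _ ⟩
      residue (toℕ a * (toℕ b + toℕ c))               ≡⟨ cong residue (*-distribˡ-+ (toℕ a) (toℕ b) (toℕ c)) ⟩
      residue (toℕ a * toℕ b + toℕ a * toℕ c)         ≡⟨ residue-+ _ _ ⟨
      add (mul a b) (mul a c)                         ∎
      where open ≡-Reasoning

    mul-distribʳ : ∀ a b c → mul (add b c) a ≡ add (mul b a) (mul c a)
    mul-distribʳ a b c = trans (mul-comm _ a) (trans (mul-distribˡ a b c) (cong₂ add (mul-comm a b) (mul-comm a c)))

    add-zeroʳ : ∀ a → add a (residue 0) ≡ a
    add-zeroʳ a = trans (add-residueʳ a 0) (trans (cong residue (+-identityʳ _)) (residue-toℕ a))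

    mul-oneʳ : ∀ a → mul a (residue 1) ≡ a
    mul-oneʳ a = trans (mul-residueʳ a 1) (trans (cong residue (ℕ.*-identityʳ _)) (residue-toℕ a))

    add-negʳ : ∀ a → add a (neg a) ≡ residue 0
    add-negʳ a = trans (add-residueʳ a (p ∸ toℕ a)) (trans (cong residue (m+[n∸m]≡n (<⇒≤ (toℕ<n a))))
      (residue-% (trans (n%n≡0 p) (sym (m<n⇒m%n≡m 0<p)))))

    residue-isCommutativeRing : IsCommutativeRing _≡_ add mul neg (residue 0) (residue 1)
    residue-isCommutativeRing = record
      { isRing = record
        { +-isAbelianGroup = record
          { isGroup = record
            { isMonoid = record
              { isSemigroup = record
                { isMagma = record { isEquivalence = isEquivalence ; ∙-cong = cong₂ add }
                ; assoc = add-assoc }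
              ; identity = (λ a → trans (add-comm _ a) (add-zeroʳ a)) , add-zeroʳ }
            ; inverse = (λ a → trans (add-comm _ a) (add-negʳ a)) , add-negʳ
            ; ⁻¹-cong = cong neg }
          ; comm = add-comm }
        ; *-cong = cong₂ mul
        ; *-assoc = mul-assoc
        ; *-identity = (λ a → trans (mul-comm _ a) (mul-oneʳ a)) , mul-oneʳ
        ; distrib = mul-distribˡ , mul-distribʳ }
      ; *-comm = mul-comm }

    residue-0⇒∣ : ∀ n → residue n ≡ residue 0 → p ∣ n
    residue-0⇒∣ n eq = m%n≡0⇒n∣m n p (trans (sym (toℕ-residue n)) (trans (cong toℕ eq) (trans (toℕ-residue 0) (m<n⇒m%n≡m 0<p))))

    ∣toℕ⇒0 : ∀ a → p ∣ toℕ a → a ≡ residue 0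
    ∣toℕ⇒0 a d = trans (sym (residue-toℕ a)) (cong residue (small (toℕ a) d (toℕ<n a)))
      where
      small : ∀ n → p ∣ n → n < p → n ≡ 0
      small zero    d lt = refl
      small (suc n) d lt = ⊥-elim (≤⇒≯ (∣⇒≤ d) lt)

    residueDomain : FiniteDomain p
    residueDomain = record
      { _⊕_ = add ; _⊗_ = mul ; ⊖_ = neg ; 𝟘 = residue 0 ; 𝟙 = residue 1
      ; isCommutativeRing = residue-isCommutativeRing
      ; noZeroDivisors = λ x y eq → Sum.map (∣toℕ⇒0 x) (∣toℕ⇒0 y) (euclidsLemma (toℕ x) (toℕ y) pp (residue-0⇒∣ _ eq))
      ; 𝟙≢𝟘 = λ eq → ≤⇒≯ (∣⇒≤ (residue-0⇒∣ 1 eq)) 1<p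
      }

-- Choice of the constants and passage to all n.

open import Data.Nat
open import Data.Nat.Properties
open import Data.Nat.Primality using (Prime)
open import Data.Nat.Tactic.RingSolver using (solve-∀)
open import Data.Fin using (Fin; inject≤; fromℕ<)
import Data.Fin.Properties as Fin
open import Data.Product using (Σ; _×_; _,_; ∃-syntax)
open import Data.Empty using (⊥-elim)
open import Relation.Nullary using (¬_; yes; no)
open import Relation.Binary.PropositionalEquality
open Counting using (^-distribʳ-*)
open FiniteDomains using (interpolationDegree)
open AlgebraicDependence using (degreeFactor; dimConst)
open Residues using (residueDomain)
open PrimesInIntervals using (primeAbove)

thetaFreeFromPrime : ∀ k′ s d₀ Δ R′ Λ′ → 0 < k′ → s ≡ suc (2 * suc k′) →
  let k = suc k′ ; Λ = suc Λ′ ; n = s * (k′ * k) ; m = s * k ; ℓ = s * Δ ; δ = degreeFactor (interpolationDegree m d₀) (suc n) in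
  s + R′ ≡ n → suc k + 2 ≤ d₀ → 2 + m * (suc k + 2) ≤ d₀ → δ ^ n < Δ → (ℓ * k) * (ℓ * k) * suc k < Λ →
  ∀ p → Prime p → Λ ≤ p → Δ * δ ≤ p → 2 * Λ * dimConst Δ (m * k′) (suc R′) < p → ∀ r →
  Σ (Graph (p ^ k + (p ^ k + r))) λ G → ¬ Contains G (Theta k ℓ) × p ^ k * p ≤ edges G
thetaFreeFromPrime k′ s d₀ Δ R′ Λ′ k′>0 s≡ s+R′≡n form≤ value≤ Δ-large enough p pp Λ≤p grid≤p sparse r =
  ThetaFree.Construction.thetaFree (residueDomain pp) k′ s d₀ Δ (suc R′) Λ′
    (λ t → inject≤ t Λ≤p) (Fin.inject≤-injective Λ≤p Λ≤p _ _)
    (trans (+-suc s R′) (cong suc s+R′≡n)) form≤ value≤ Δ-large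
    (λ t → inject≤ t grid≤p) (Fin.inject≤-injective grid≤p grid≤p _ _)
    R′ refl configurations enough k′>0 j₀ r
  where
  open ≤-Reasoning
  k = suc k′
  Λ = suc Λ′
  M = s * k * k′
  C = dimConst Δ M (suc R′)
  j₀ : Fin (s * Δ)
  j₀ = fromℕ< {0} (*-mono-≤ (subst (1 ≤_) (sym s≡) (s≤s z≤n)) (≤-<-trans z≤n Δ-large))
  instance
    p≢0 : NonZero p
    p≢0 = >-nonZero (≤-trans (s≤s z≤n) Λ≤p)
  -- Here s = 2k + 1 is spent: p^(2k) pairs of endpoints times p^R′ bad vectors give p^(M-1), and
  -- the remaining factor p absorbs the constant 2 Λ C.
  exponent : suc (k + k + R′) ≡ M
  exponent = begin-equality
    suc (k + k + R′)       ≡⟨ cong (λ x → suc (k + x + R′)) (+-identityʳ k) ⟨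
    suc (2 * k) + R′       ≡⟨ cong (_+ R′) s≡ ⟨
    s + R′                 ≡⟨ s+R′≡n ⟩
    s * (k′ * k)           ≡⟨ cong (s *_) (*-comm k′ k) ⟩
    s * (k * k′)           ≡⟨ *-assoc s k k′ ⟨
    M                      ∎
  rearrange : ∀ P Λ C Q → 2 * (P * (P * Λ)) * (C * Q) ≡ 2 * Λ * C * (P * P * Q)
  rearrange = solve-∀
  configurations : 2 * (p ^ k * (p ^ k * Λ)) * (C * p ^ R′) < p ^ M
  configurations = begin-strict
    2 * (p ^ k * (p ^ k * Λ)) * (C * p ^ R′)    ≡⟨ rearrange (p ^ k) Λ C (p ^ R′) ⟩
    2 * Λ * C * (p ^ k * p ^ k * p ^ R′)        <⟨ *-monoˡ-< _ {{m*n≢0 _ _ {{m*n≢0 _ _ {{m^n≢0 p k}} {{m^n≢0 p k}}}} {{m^n≢0 p R′}}}} sparse ⟩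
    p * (p ^ k * p ^ k * p ^ R′)                ≡⟨ cong (λ x → p * (x * p ^ R′)) (^-distribˡ-+-* p k k) ⟨
    p * (p ^ (k + k) * p ^ R′)                  ≡⟨ cong (p *_) (^-distribˡ-+-* p (k + k) R′) ⟨
    p ^ suc (k + k + R′)                        ≡⟨ cong (p ^_) exponent ⟩
    p ^ M                                       ∎

ThetaFreeGraphs : ℕ → ℕ → ℕ → Set
ThetaFreeGraphs k ℓ q₀ = ∀ p → Prime p → q₀ ≤ p → ∀ r →
  Σ (Graph (p ^ k + (p ^ k + r))) λ G → ¬ Contains G (Theta k ℓ) × p ^ k * p ≤ edges G

thetaFreeGraphs : ∀ k′ → 0 < k′ → ∃[ ℓ ] ∃[ q₀ ] ThetaFreeGraphs (suc k′) ℓ q₀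
thetaFreeGraphs k′ k′>0 = choose (suc (2 * suc k′)) refl
  where
  k = suc k′
  choose : ∀ s → s ≡ suc (2 * suc k′) → ∃[ ℓ ] ∃[ q₀ ] ThetaFreeGraphs (suc k′) ℓ q₀
  choose s s≡ = s * Δ , q₀ , λ p pp q₀≤p r →
      thetaFreeFromPrime k′ s d₀ Δ R′ Λ′ k′>0 s≡ s+R′≡n (m≤m+n _ _) (m≤n+m _ (suc k + 2)) ≤-refl ≤-refl p pp
        (≤-trans (≤-trans (m≤m+n _ _) (m≤m+n _ _)) q₀≤p)
        (≤-trans (≤-trans (m≤n+m _ (suc Λ′)) (m≤m+n _ _)) q₀≤p)
        (≤-trans (m≤n+m _ (suc Λ′ + Δ * δ)) q₀≤p) r
    where
    m = s * k
    n = s * (k′ * k)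
    d₀ = (suc k + 2) + (2 + m * (suc k + 2))
    δ = degreeFactor (interpolationDegree m d₀) (suc n)
    -- There is no circularity: `δ` involves neither Δ nor the number of forms, since adding forms
    -- leaves degrees unchanged. `Λ′` can therefore wait for ℓ = s Δ, and the bound `q₀` on p comes
    -- last.
    Δ = suc (δ ^ n)
    -- This is n - s, written as a multiple of s; the subtraction is exact because k′ * k is at
    -- least 1.
    R′ = s * (k′ * k ∸ 1)
    Λ′ = (s * Δ * k) * (s * Δ * k) * suc k
    q₀ = suc Λ′ + Δ * δ + suc (2 * suc Λ′ * dimConst Δ (m * k′) (suc R′))
    s+R′≡n : s + R′ ≡ n
    s+R′≡n = trans (sym (*-suc s (k′ * k ∸ 1))) (cong (s *_) (m+[n∸m]≡n {1} (*-mono-≤ k′>0 (s≤s z≤n))))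

n<2^n : ∀ n → n < 2 ^ n
n<2^n zero    = s≤s z≤n
n<2^n (suc n) = +-mono-≤ (m^n>0 2 n) (≤-trans (n<2^n n) (≤-reflexive (sym (+-identityʳ _))))

-- Since b < f b, the value at b₀ + n exceeds n, and an upward search from b₀ stops by then.
bracket : ∀ (f : ℕ → ℕ) → (∀ b → b < f b) → ∀ b₀ n → f b₀ ≤ n → ∃[ b ] b₀ ≤ b × f b ≤ n × n < f (suc b)
bracket f grows b₀ n f≤n₀ = search n b₀ f≤n₀ (≤-<-trans (m≤n+m n b₀) (grows (b₀ + n)))
  where
  search : ∀ j b → f b ≤ n → n < f (b + j) → ∃[ b′ ] b ≤ b′ × f b′ ≤ n × n < f (suc b′)
  search zero    b le lt = ⊥-elim (<⇒≱ (subst (λ x → n < f x) (+-identityʳ b) lt) le)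
  search (suc j) b le lt with f (suc b) ≤? n
  ... | no  f≰n = b , ≤-refl , le , ≰⇒> f≰n
  ... | yes f≤n = let b′ , b<b′ , rest = search j (suc b) f≤n (subst (λ x → n < f x) (+-suc b j) lt) in b′ , <⇒≤ b<b′ , rest

-- n ≤ H p^k gives n^(k+1) ≤ H^(k+1) (p^(k+1))^k. As `ExAtLeast` raises the factor of e to the power
-- k, H^(k+1) is enlarged to its own k-th power, which avoids a root.
edgeBound : ∀ k H p n e → 1 ≤ k → 1 ≤ H → n ≤ H * p ^ k → p ^ k * p ≤ e → 1 ^ k * n ^ (k + 1) ≤ (H ^ (k + 1) * e) ^ k
edgeBound k H p n e 1≤k 1≤H n≤ e≥ = begin
  1 ^ k * n ^ (k + 1)                     ≡⟨ trans (cong (_* n ^ (k + 1)) (^-zeroˡ k)) (+-identityʳ _) ⟩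
  n ^ (k + 1)                             ≤⟨ ^-monoˡ-≤ (k + 1) n≤ ⟩
  (H * p ^ k) ^ (k + 1)                   ≡⟨ ^-distribʳ-* (k + 1) H (p ^ k) ⟩
  H ^ (k + 1) * (p ^ k) ^ (k + 1)         ≤⟨ *-monoˡ-≤ ((p ^ k) ^ (k + 1)) (≤-trans (≤-reflexive (sym (^-identityʳ (H ^ (k + 1)))))
                                                                            (^-monoʳ-≤ (H ^ (k + 1)) {{m^n≢0 H (k + 1) {{>-nonZero 1≤H}}}} 1≤k)) ⟩
  (H ^ (k + 1)) ^ k * (p ^ k) ^ (k + 1)   ≡⟨ cong ((H ^ (k + 1)) ^ k *_) (trans (^-*-assoc p k (k + 1)) (trans (cong (p ^_) (*-comm k (k + 1))) (sym (^-*-assoc p (k + 1) k)))) ⟩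
  (H ^ (k + 1)) ^ k * (p ^ (k + 1)) ^ k   ≡⟨ ^-distribʳ-* k (H ^ (k + 1)) (p ^ (k + 1)) ⟨
  (H ^ (k + 1) * p ^ (k + 1)) ^ k         ≡⟨ cong (λ x → (H ^ (k + 1) * x) ^ k) (trans (^-distribˡ-+-* p k 1) (cong (p ^ k *_) (*-identityʳ p))) ⟩
  (H ^ (k + 1) * (p ^ k * p)) ^ k         ≤⟨ ^-monoˡ-≤ k (*-monoʳ-≤ (H ^ (k + 1)) e≥) ⟩
  (H ^ (k + 1) * e) ^ k                   ∎
  where open ≤-Reasoning

scale : ℕ → ℕ
scale b = 2 ^ (16 + 2 * b)

scale-suc : ∀ b → scale (suc b) ≡ 4 * scale b
scale-suc b = trans (cong (2 ^_) (rearrange b)) (^-distribˡ-+-* 2 2 (16 + 2 * b))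
  where
  rearrange : ∀ b → 16 + 2 * (1 + b) ≡ 2 + (16 + 2 * b)
  rearrange = solve-∀

b<scale : ∀ b → b < scale b
b<scale b = <-≤-trans (n<2^n b) (^-monoʳ-≤ 2 (≤-trans (m≤m+n b (b + 0)) (m≤n+m (2 * b) 16)))

-- With f b = 2 (16 y_b)^k, every large n lies between two consecutive f b and f (b + 1). The prime
-- above y_b satisfies 2 p^k ≤ f b ≤ n, and n - 2 p^k isolated vertices are added. Consecutive
-- scales differ by 4, so n < 2 (64 y_b)^k ≤ 2 * 64^k p^k; this is the constant H.
fromScales : ∀ k ℓ q₀ → 1 ≤ k → ThetaFreeGraphs k ℓ q₀ →
  (y : ℕ → ℕ) → (∀ b → b < y b) → (∀ b → y (suc b) ≡ 4 * y b) → (∀ b → ∃[ p ] Prime p × y b < p × p ≤ 16 * y b) →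
  ∃[ N ] (∀ n → N ≤ n → ExAtLeast n (Theta k ℓ) k 1 ((2 * 64 ^ k) ^ (k + 1)))
-- Starting the search at `q₀` secures q₀ ≤ b < y b < p, so the prime is large enough.
fromScales k ℓ q₀ 1≤k graphs y b<y y-suc primes = f q₀ , λ n N≤n →
  let b , q₀≤b , fb≤n , n<f = bracket f b<f q₀ n N≤n
      p , pp , y<p , p≤16y = primes b
      2p^k≤n = ≤-trans (*-monoʳ-≤ 2 (^-monoˡ-≤ k p≤16y)) fb≤n
      G , free , e≥ = graphs p pp (≤-trans q₀≤b (≤-trans (<⇒≤ (b<y b)) (<⇒≤ y<p))) (n ∸ 2 * p ^ k)
  in subst (λ n → ExAtLeast n (Theta k ℓ) k 1 ((2 * 64 ^ k) ^ (k + 1))) (total (p ^ k) n 2p^k≤n)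
       (G , free , edgeBound k (2 * 64 ^ k) p _ (edges G) 1≤k (*-mono-≤ {1} {2} (s≤s z≤n) (m^n>0 64 k))
          (≤-trans (≤-reflexive (total (p ^ k) n 2p^k≤n)) (upper b p n n<f y<p)) e≥)
  where
  open ≤-Reasoning
  f : ℕ → ℕ
  f b = 2 * (16 * y b) ^ k
  b<f : ∀ b → b < f b
  b<f b = begin-strict
    b                 <⟨ b<y b ⟩
    y b               ≤⟨ m≤n*m (y b) 16 ⟩
    16 * y b          ≡⟨ ^-identityʳ (16 * y b) ⟨
    (16 * y b) ^ 1    ≤⟨ ^-monoʳ-≤ (16 * y b) {{m*n≢0 16 (y b) {{_}} {{>-nonZero (≤-<-trans z≤n (b<y b))}}}} 1≤k ⟩
    (16 * y b) ^ k    ≤⟨ m≤n*m _ 2 ⟩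
    f b               ∎
  total : ∀ P n → 2 * P ≤ n → P + (P + (n ∸ 2 * P)) ≡ n
  total P n le = trans (sym (+-assoc P P _)) (trans (cong (λ x → x + (n ∸ 2 * P)) (cong (P +_) (sym (+-identityʳ P)))) (m+[n∸m]≡n le))
  rearrange : ∀ y → 16 * (4 * y) ≡ 64 * y
  rearrange = solve-∀
  upper : ∀ b p n → n < f (suc b) → y b < p → n ≤ 2 * 64 ^ k * p ^ k
  upper b p n n<f y<p = begin
    n                          ≤⟨ <⇒≤ n<f ⟩
    2 * (16 * y (suc b)) ^ k   ≡⟨ cong (λ x → 2 * x ^ k) (trans (cong (16 *_) (y-suc b)) (rearrange (y b))) ⟩
    2 * (64 * y b) ^ k         ≤⟨ *-monoʳ-≤ 2 (^-monoˡ-≤ k (*-monoʳ-≤ 64 (<⇒≤ y<p))) ⟩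
    2 * (64 * p) ^ k           ≡⟨ cong (2 *_) (^-distribʳ-* k 64 p) ⟩
    2 * (64 ^ k * p ^ k)       ≡⟨ *-assoc 2 (64 ^ k) (p ^ k) ⟨
    2 * 64 ^ k * p ^ k         ∎

theorem1 : ∀ (k : ℕ) → 2 ≤ k →
    ∃[ ℓ ] ∃[ p ] ∃[ q ] (0 < p) × (0 < q) ×
      ∃[ N ] (∀ (n : ℕ) → N ≤ n → ExAtLeast n (Theta k ℓ) k p q)
theorem1 (suc k′) (s≤s 1≤k′) =
  let ℓ , q₀ , graphs = thetaFreeGraphs k′ 1≤k′ in
  ℓ , 1 , (2 * 64 ^ suc k′) ^ (suc k′ + 1) , s≤s z≤n , m^n>0 (2 * 64 ^ suc k′) {{m*n≢0 2 _ {{_}} {{m^n≢0 64 (suc k′)}}}} (suc k′ + 1) ,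
  fromScales (suc k′) ℓ q₀ (s≤s z≤n) graphs scale b<scale scale-suc primeAbove
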